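{- Let $k \ge 4$ and $\zeta \in \{k-3,k-2\}$. If $G$ is a $k$-$\gamma_c$-critical graph with exactly $\zeta$ cut-vertices, then $G$ is traceable.
   Context: Graphs are finite and simple. For a connected graph $G$, a connected dominating set is a set $S\subseteq V(G)$ such that every vertex outside $S$ has a neighbor in $S$ and $G[S]$ is connected; $\gamma_c(G)$ is the minimum size of such a set. A connected graph $G$ is $k$-$\gamma_c$-critical if $\gamma_c(G)=k$ and $\gamma_c(G+uv)<k$ for every pair of non-adjacent vertices $u,v$. A graph is traceable if it has a hamiltonian path (a path through all vertices). -}

module Defs where

open import Data.Nat using (ℕ; _<_; _≤_)
open import Data.Fin using (Fin)
open import Data.Fin.Subset using (Subset; _∈_; _∉_; ∣_∣)
open import Data.List using (List)
open import Data.List.Relation.Unary.Unique.Propositional using (Unique)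
open import Data.List.Relation.Unary.Linked using (Linked)
import Data.List.Membership.Propositional as LM
open import Data.Product using (Σ; _×_; ∃; ∃-syntax)
open import Data.Sum using (_⊎_)
open import Data.Unit using (⊤)
open import Relation.Nullary using (¬_; Dec)
open import Relation.Binary.PropositionalEquality using (_≡_; _≢_)

record Graph (n : ℕ) : Set₁ where
  field
    Adj    : Fin n → Fin n → Set
    sym    : ∀ {u v} → Adj u v → Adj v u
    irrefl : ∀ {u} → ¬ Adj u u
    dec    : ∀ u v → Dec (Adj u v)
open Graph public

-- Raw adjacency relations (used so that G + uv need not be repackaged).
Rel : ℕ → Set₁
Rel n = Fin n → Fin n → Set

data WalkIn {n : ℕ} (R : Rel n) (P : Fin n → Set) : Fin n → Fin n → Set where
  [_]  : ∀ {u} → P u → WalkIn R P u u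
  step : ∀ {u w v} → P u → R u w → WalkIn R P w v → WalkIn R P u v

ConnectedOn : ∀ {n} → Rel n → (Fin n → Set) → Set
ConnectedOn R P = ∀ u v → P u → P v → WalkIn R P u v

Connected : ∀ {n} → Rel n → Set
Connected R = ConnectedOn R (λ _ → ⊤)

IsCDS : ∀ {n} → Rel n → Subset n → Set
IsCDS R S = (∀ v → v ∉ S → ∃[ u ] (u ∈ S × R u v)) × ConnectedOn R (_∈ S)

γc≡ : ∀ {n} → Rel n → ℕ → Set
γc≡ R k = (∃[ S ] (IsCDS R S × ∣ S ∣ ≡ k)) × (∀ S → IsCDS R S → k ≤ ∣ S ∣)

addEdge : ∀ {n} → Rel n → Fin n → Fin n → Rel n
addEdge R u v x y = R x y ⊎ ((x ≡ u × y ≡ v) ⊎ (x ≡ v × y ≡ u))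

IsCritical : ∀ {n} → ℕ → Graph n → Set
IsCritical k G =
  Connected (Adj G) × γc≡ (Adj G) k ×
  (∀ u v → u ≢ v → ¬ Adj G u v →
     ∃[ j ] (j < k × γc≡ (addEdge (Adj G) u v) j))

IsCutVertex : ∀ {n} → Graph n → Fin n → Set
IsCutVertex G v = ∃[ a ] ∃[ b ] (a ≢ v × b ≢ v × ¬ WalkIn (Adj G) (λ x → x ≢ v) a b)

NumCutVertices : ∀ {n} → Graph n → ℕ → Set
NumCutVertices G ζ =
  ∃[ C ] ((∀ v → (v ∈ C → IsCutVertex G v) × (IsCutVertex G v → v ∈ C)) × ∣ C ∣ ≡ ζ)

Traceable : ∀ {n} → Graph n → Set
Traceable {n} G =
  Σ (List (Fin n)) λ xs → Unique xs × (∀ v → v LM.∈ xs) × Linked (Adj G) xs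

-- A minimum connected dominating set D₀ contains every cut vertex, so by the hypothesis on ζ at most three of its vertices lie
-- elsewhere. Call a part of the graph beyond a cut vertex an end if it contains no further cut vertex. Two disjoint ends use at
-- least two of the further vertices: otherwise both are cliques in which at most one vertex w is not adjacent to the cut vertex,
-- and joining the two vertices w would not make γc smaller. Hence there are no three disjoint ends, the blocks form a chain, and
-- an inner block of the chain uses at most one further vertex. Such a block is complete up to one or two edges, and is traversed
-- at once.
--
-- An end that uses at most three further vertices has a hamiltonian path from its cut vertex c. Take a longest path from c, a
-- component K of what it misses, the set X of the neighbours of K on the path, and the set T of their predecessors together with
-- the last vertex. Then T is independent and has one vertex more than X. Adding an edge between two vertices of T yields a vertex
-- of X that is adjacent to all of T but one vertex, which it is said to own. Counting owners leaves so little room that in each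
-- case the path can be rerouted through K and becomes longer.
module Submission where

open import Defs
open import Data.Nat using (ℕ; zero; suc; _+_; _∸_; _≤_; _<_; z≤n; s≤s; s≤s⁻¹)
import Data.Nat.Properties as ℕₚ
open import Data.Fin using (Fin; zero; suc)
import Data.Fin.Properties as Finₚ
open import Data.List using (List; []; _∷_; _++_; length; filter; allFin; reverse; map)
import Data.List.Properties as Listₚ
open import Data.List.Membership.Propositional using (_∈_; _∉_; find; lose)
open import Data.List.Membership.Propositional.Properties
  using (∈-++⁺ˡ; ∈-++⁺ʳ; ∈-++⁻; ∈-filter⁺; ∈-filter⁻; ∈-allFin; ∈-map⁺; ∈-map⁻; ∈-∃++)
open import Data.List.Relation.Unary.Any as Any using (here; there)
open import Data.List.Relation.Unary.All as All using (All; []; _∷_)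
import Data.List.Relation.Unary.All.Properties as Allₚ
open import Data.List.Relation.Unary.AllPairs using ([]; _∷_)
open import Data.List.Relation.Unary.Unique.Propositional using (Unique)
import Data.List.Relation.Unary.Unique.Propositional.Properties as Uniqueₚ
open import Data.List.Relation.Binary.Permutation.Propositional
  using (_↭_; ↭-refl; ↭-sym; ↭-trans; ↭-reflexive; ↭⇒↭ₛ)
import Data.List.Relation.Binary.Permutation.Propositional.Properties as Permₚ
import Data.List.Relation.Binary.Permutation.Setoid.Properties as PermSetoidₚ
import Algebra.Solver.CommutativeMonoid as CMSolver
open import Data.List.Relation.Unary.Linked using (Linked; []; [-]; _∷_)
open import Data.Product using (_×_; _,_; proj₁; proj₂; ∃-syntax; Σ-syntax)
open import Data.Sum using (_⊎_; inj₁; inj₂; [_,_]′; map₂; swap)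
open import Data.Empty using (⊥; ⊥-elim)
open import Data.Unit using (⊤; tt)
open import Function using (_∘_; id; case_of_)
open import Relation.Nullary using (¬_; Dec; yes; no; ¬?; _×-dec_; _⊎-dec_; decidable-stable)
open import Relation.Unary using (Decidable)
open import Relation.Binary.PropositionalEquality
  using (_≡_; _≢_; refl; cong; subst; subst₂; trans; setoid; ≢-sym) renaming (sym to ≡-sym)
open import Relation.Nullary.Decidable using (map′)
open import Data.Fin.Subset as Subset using (Subset; ∣_∣) renaming (_∈_ to _∈ₛ_)
open import Data.Vec as Vec using ([]; _∷_)
import Data.Vec.Properties as Vecₚ

-- Lists without repetition

-- Criticality concerns the whole graph, the path arguments are local. The bridge: a vertex that
-- separates a part from the rest lies in every connected dominating set, also after an edge is
-- added inside the closed part. So such sets can be exchanged part by part, and an edge added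
-- inside a part lowers the number of vertices needed in that very part.
--
-- Owner counting is tight because |T| = |X| + 1 and a vertex of X owns at most one vertex of T. The
-- root spoils it: lying outside the end, it takes part in no pair of T. If the root is not in T,
-- exactly one vertex is unowned and the rest is forced. If it is, there is one more degree of
-- freedom; a path that could be rerouted into the first case is excluded, which yields
-- non-adjacencies.
--
-- The number 3 is the largest possible excess of k over the number of cut vertices. That k ≥ 4
-- supplies a cut vertex and excludes two tight ends that exhaust the graph around a common cut
-- vertex. Minimal sets and longest paths are never computed: existence is shown up to double
-- negation, which is removed at the end since traceability is decidable.

unique-⊆⇒length≤ : ∀ {A : Set} {xs ys : List A} → Unique xs → (∀ {x} → x ∈ xs → x ∈ ys) → length xs ≤ length ys
unique-⊆⇒length≤ {xs = []} _ _ = z≤n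
unique-⊆⇒length≤ {xs = x ∷ xs} (x∉ ∷ u) sub with ∈-∃++ (sub (here refl))
... | as , bs , refl = ℕₚ.≤-trans (s≤s (unique-⊆⇒length≤ u sub′))
        (ℕₚ.≤-reflexive (≡-sym (Permₚ.↭-length (Permₚ.shift x as bs))))
  where
  sub′ : ∀ {y} → y ∈ xs → y ∈ as ++ bs
  sub′ {y} y∈ with ∈-++⁻ as (sub (there y∈))
  ... | inj₁ p = ∈-++⁺ˡ p
  ... | inj₂ (here refl) = ⊥-elim (All.lookup x∉ y∈ refl)
  ... | inj₂ (there p) = ∈-++⁺ʳ as p

unique-↭ : ∀ {A : Set} {xs ys : List A} → xs ↭ ys → Unique xs → Unique ys
unique-↭ p u = PermSetoidₚ.Unique-resp-↭ (setoid _) (↭⇒↭ₛ p) u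

unique-++⁻ : ∀ {A : Set} (xs : List A) {ys} → Unique (xs ++ ys) →
             Unique xs × Unique ys × (∀ {v} → v ∈ xs → v ∉ ys)
unique-++⁻ [] u = [] , u , λ ()
unique-++⁻ (x ∷ xs) (h ∷ u) with unique-++⁻ xs u
... | ux , uy , disj = (Allₚ.++⁻ˡ xs h ∷ ux) , uy , λ where
  (here refl) q → All.lookup (Allₚ.++⁻ʳ xs h) q refl
  (there p) q → disj p q

length-filter-¬ : ∀ {A : Set} {P : A → Set} (P? : Decidable P) (xs : List A) →
                  length xs ≡ length (filter P? xs) + length (filter (¬? ∘ P?) xs)
length-filter-¬ P? [] = refl
length-filter-¬ P? (x ∷ xs) with P? x
... | yes _ = cong suc (length-filter-¬ P? xs)
... | no _ = trans (cong suc (length-filter-¬ P? xs)) (≡-sym (ℕₚ.+-suc _ _))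

-- The owner found for the first element is deleted from `zs`; it serves nobody else, so what is
-- left still covers the others.
pigeonhole : ∀ {A B : Set} (Own : B → A → Set) (_≟_ : (x y : A) → Dec (x ≡ y)) → (ts : List A) (zs : List B) → Unique ts →
             (∀ {t} → t ∈ ts → ∃[ z ] z ∈ zs × Own z t) →
             (∀ {z t t′} → Own z t → Own z t′ → t ≡ t′) → length ts ≤ length zs
pigeonhole Own _≟_ [] zs u own inj = z≤n
pigeonhole Own _≟_ (t ∷ ts) zs (t∉ ∷ u) own inj with own (here refl)
... | z , z∈ , zt with ∈-∃++ z∈
...   | as , bs , refl = ℕₚ.≤-trans (s≤s (pigeonhole Own _≟_ ts (as ++ bs) u own′ inj))
          (ℕₚ.≤-reflexive (≡-sym (Permₚ.↭-length (Permₚ.shift z as bs))))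
  where
  own′ : ∀ {s} → s ∈ ts → ∃[ y ] y ∈ as ++ bs × Own y s
  own′ s∈ with own (there s∈)
  ... | y , y∈ , ys with ∈-++⁻ as y∈
  ...   | inj₁ p = y , ∈-++⁺ˡ p , ys
  ...   | inj₂ (here refl) = ⊥-elim (All.lookup t∉ s∈ (inj zt ys))
  ...   | inj₂ (there p) = y , ∈-++⁺ʳ as p , ys

-- Walks

module _ {n : ℕ} {R : Rel n} where

  infixr 5 _◅◅_
  _◅◅_ : ∀ {P : Fin n → Set} {u v w} → WalkIn R P u v → WalkIn R P v w → WalkIn R P u w
  [ _ ] ◅◅ q = q
  step p e w ◅◅ q = step p e (w ◅◅ q)

  walk-start : ∀ {P : Fin n → Set} {u v} → WalkIn R P u v → P u
  walk-start [ p ] = p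
  walk-start (step p _ _) = p

  walk-end : ∀ {P : Fin n → Set} {u v} → WalkIn R P u v → P v
  walk-end [ p ] = p
  walk-end (step _ _ w) = walk-end w

  walk-map : ∀ {P Q : Fin n → Set} {u v} → (∀ {x} → P x → Q x) → WalkIn R P u v → WalkIn R Q u v
  walk-map f [ p ] = [ f p ]
  walk-map f (step p e w) = step (f p) e (walk-map f w)

  walk-snoc : ∀ {P : Fin n → Set} {u v w} → WalkIn R P u v → R v w → P w → WalkIn R P u w
  walk-snoc w e p = w ◅◅ step (walk-end w) e [ p ]

  walk-reverse : ∀ {P : Fin n → Set} {u v} → (∀ {x y} → R x y → R y x) → WalkIn R P u v → WalkIn R P v u
  walk-reverse s [ p ] = [ p ]
  walk-reverse s (step p e w) = walk-snoc (walk-reverse s w) (s e) p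

  walk-closed : ∀ {P Q : Fin n → Set} {u v} → WalkIn R P u v → Q u →
                (∀ {x y} → P x → P y → R x y → Q x → Q y) → WalkIn R Q u v
  walk-closed [ p ] q cl = [ q ]
  walk-closed (step p e w) q cl = step q e (walk-closed w (cl p (walk-start w) e q) cl)

-- Edges may collapse, because the maps used later are mostly retractions that send a whole part of
-- the graph to one cut vertex.
walk-image : ∀ {m n} {R : Rel m} {S : Rel n} {P : Fin m → Set} {Q : Fin n → Set} (f : Fin m → Fin n) →
             (∀ {x} → P x → Q (f x)) → (∀ {x y} → P x → P y → R x y → f x ≡ f y ⊎ S (f x) (f y)) →
             ∀ {u v} → WalkIn R P u v → WalkIn S Q (f u) (f v)
walk-image f pq adj [ p ] = [ pq p ]
walk-image {S = S} {Q = Q} f pq adj {v = v} (step p e w) with adj p (walk-start w) e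
... | inj₁ eq = subst (λ z → WalkIn S Q z (f v)) (≡-sym eq) (walk-image f pq adj w)
... | inj₂ e′ = step (pq p) e′ (walk-image f pq adj w)

walk-rel : ∀ {n} {R S : Rel n} {P : Fin n → Set} → (∀ {x y} → R x y → S x y) →
           ∀ {u v} → WalkIn R P u v → WalkIn S P u v
walk-rel f = walk-image id id (λ _ _ e → inj₂ (f e))

-- The component of a vertex in an induced subgraph

module _ {n : ℕ} (G : Graph n) {Q : Fin n → Set} (Q? : Decidable Q) where

  record Component (a : Fin n) : Set where
    field
      verts : List (Fin n)
      self : a ∈ verts
      reach : ∀ {k} → k ∈ verts → WalkIn (Adj G) (λ v → v ∈ verts × Q v) a k
      closed : ∀ {k u} → k ∈ verts → Adj G k u → Q u → u ∈ verts

  component : ∀ a → Q a → Component a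
  component a qa = grow n (a ∷ []) ([] ∷ []) ℕₚ.≤-refl (here refl) λ where
      (here refl) → [ here refl , qa ]
    where
    open import Data.List.Membership.DecPropositional (Finₚ._≟_ {n}) using (_∈?_)
    -- `ks` has no repetition, so the bound makes `fuel` larger than the number of vertices still
    -- missing: it cannot run out.
    grow : ∀ fuel ks → Unique ks → n < length ks + fuel → a ∈ ks →
           (∀ {k} → k ∈ ks → WalkIn (Adj G) (λ v → v ∈ ks × Q v) a k) → Component a
    grow fuel ks u bound a∈ reach with Finₚ.any? (λ u → (¬? (u ∈? ks) ×-dec Q? u) ×-dec Any.any? (λ k → dec G k u) ks)
    ... | no stuck = record { verts = ks ; self = a∈ ; reach = reach ; closed = closed }
      where
      closed : ∀ {k u} → k ∈ ks → Adj G k u → Q u → u ∈ ks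
      closed {k} {u} k∈ e q with u ∈? ks
      ... | yes u∈ = u∈
      ... | no u∉ = ⊥-elim (stuck (u , (u∉ , q) , lose k∈ e))
    grow zero ks u bound a∈ reach | yes _ =
      ⊥-elim (ℕₚ.<⇒≱ bound (ℕₚ.≤-trans (ℕₚ.≤-reflexive (ℕₚ.+-identityʳ _))
        (ℕₚ.≤-trans (unique-⊆⇒length≤ u (λ {x} _ → ∈-allFin x)) (ℕₚ.≤-reflexive (Listₚ.length-tabulate {n = n} id)))))
    grow (suc fuel) ks u bound a∈ reach | yes (v , (v∉ , qv) , adj) with find adj
    ... | k , k∈ , e = grow fuel (v ∷ ks) (All.tabulate (λ x∈ v≡x → v∉ (subst (_∈ ks) (≡-sym v≡x) x∈)) ∷ u)
            (ℕₚ.≤-trans bound (ℕₚ.≤-reflexive (ℕₚ.+-suc _ _))) (there a∈) λ where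
              (here refl) → walk-snoc (walk-map wk (reach k∈)) e (here refl , qv)
              (there k′∈) → walk-map wk (reach k′∈)
      where
      wk : ∀ {x} → x ∈ ks × Q x → x ∈ v ∷ ks × Q x
      wk (p , q) = there p , q

  walk? : ∀ a b → Dec (WalkIn (Adj G) Q a b)
  walk? a b with Q? a
  ... | no ¬q = no (¬q ∘ walk-start)
  ... | yes q with component a q
  ...   | K with b ∈? Component.verts K
    where open import Data.List.Membership.DecPropositional (Finₚ._≟_ {n}) using (_∈?_)
  ...     | yes b∈ = yes (walk-map proj₂ (Component.reach K b∈))
  ...     | no b∉ = no λ w → b∉ (walk-end (walk-closed w (Component.self K) λ _ qy e x∈ → Component.closed K x∈ e qy))

-- Paths with their lists of vertices

module Paths {n : ℕ} (R : Rel n) (R-sym : ∀ {u v} → R u v → R v u) where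

  private V = Fin n

  infixr 5 _∷_

  data Path : V → V → List V → Set where
    [-] : ∀ {u} → Path u u (u ∷ [])
    _∷_ : ∀ {u w v xs} → R u w → Path w v xs → Path u v (u ∷ xs)

  infixr 4 _⟨_⟩_

  _⟨_⟩_ : ∀ {a b c d xs ys} → Path a b xs → R b c → Path c d ys → Path a d (xs ++ ys)
  [-] ⟨ e ⟩ q = e ∷ q
  (f ∷ p) ⟨ e ⟩ q = f ∷ (p ⟨ e ⟩ q)

  reverseᵖ : ∀ {a b xs} → Path a b xs → Path b a (reverse xs)
  reverseᵖ [-] = [-]
  reverseᵖ {xs = x ∷ xs} (e ∷ p) =
    subst (Path _ _) (≡-sym (Listₚ.unfold-reverse x xs)) (reverseᵖ p ⟨ R-sym e ⟩ [-])

  start∈ : ∀ {a b xs} → Path a b xs → a ∈ xs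
  start∈ [-] = here refl
  start∈ (_ ∷ _) = here refl

  end∈ : ∀ {a b xs} → Path a b xs → b ∈ xs
  end∈ [-] = here refl
  end∈ (_ ∷ p) = there (end∈ p)

  closed-path : ∀ {a v xs} → Path a a xs → Unique xs → v ∈ xs → v ≡ a
  closed-path [-] _ (here eq) = eq
  closed-path (_ ∷ p) u _ = ⊥-elim (Uniqueₚ.Unique[x∷xs]⇒x∉xs u (end∈ p))

  linked : ∀ {a b xs} → Path a b xs → Linked R xs
  linked [-] = [-]
  linked (e ∷ [-]) = e ∷ [-]
  linked (e ∷ p@(_ ∷ _)) = e ∷ linked p

  -- A trail remembers the vertices of a path only up to order, so reversing it leaves the list unchanged.
  Trail : V → V → List V → Set
  Trail a b ys = ∃[ xs ] Path a b xs × xs ↭ ys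

  ⌊_⌋ : ∀ {a b xs} → Path a b xs → Trail a b xs
  ⌊ p ⌋ = _ , p , ↭-refl

  ⌊_⌋ʳ : ∀ {a b xs} → Path a b xs → Trail b a xs
  ⌊_⌋ʳ {xs = xs} p = _ , reverseᵖ p , Permₚ.↭-reverse xs

  infixr 4 _⟪_⟫_

  _⟪_⟫_ : ∀ {a b c d xs ys} → Trail a b xs → R b c → Trail c d ys → Trail a d (xs ++ ys)
  (_ , p , s) ⟪ e ⟫ (_ , q , t) = _ , (p ⟨ e ⟩ q) , Permₚ.++⁺ s t

  cut-before : ∀ {a b ps y} → Path a b ps → y ∈ ps →
    y ≡ a ⊎ ∃[ p ] ∃[ xs ] ∃[ ys ] Path a p xs × R p y × Path y b ys × ps ≡ xs ++ ys
  cut-before [-] (here refl) = inj₁ refl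
  cut-before (e ∷ p) (here refl) = inj₁ refl
  cut-before (e ∷ p) (there y∈) with cut-before p y∈
  ... | inj₁ refl = inj₂ (_ , _ , _ , [-] , e , p , refl)
  ... | inj₂ (_ , _ , _ , q , f , r , refl) = inj₂ (_ , _ , _ , (e ∷ q) , f , r , refl)

  cut-after : ∀ {a b ps y} → Path a b ps → y ∈ ps →
    y ≡ b ⊎ ∃[ q ] ∃[ xs ] ∃[ ys ] Path a y xs × R y q × Path q b ys × ps ≡ xs ++ ys
  cut-after [-] (here refl) = inj₁ refl
  cut-after (e ∷ p) (here refl) = inj₂ (_ , _ , _ , [-] , e , p , refl)
  cut-after (e ∷ p) (there y∈) with cut-after p y∈
  ... | inj₁ refl = inj₁ refl
  ... | inj₂ (_ , _ , _ , q , f , r , refl) = inj₂ (_ , _ , _ , (e ∷ q) , f , r , refl)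

  head-≡ : ∀ {a b ps qs x} → Path a b ps → ps ≡ x ∷ qs → x ≡ a
  head-≡ [-] refl = refl
  head-≡ (_ ∷ _) refl = refl

  uncons : ∀ {a b ps} → Path a b ps → ∃[ qs ] ps ≡ a ∷ qs
  uncons [-] = _ , refl
  uncons (_ ∷ _) = _ , refl

  starts-agree : ∀ {a a′ b b′ ps ps′} → Path a b ps → Path a′ b′ ps′ → ps ≡ ps′ → a ≡ a′
  starts-agree p q refl with uncons p
  ... | _ , refl = head-≡ q refl

  -- Two cuts of the same list, the first at the edge t x and the second at the edge t′ x′.
  data Compare {x t : V} (xs ys : List V) {x′ t′ : V} (xs′ ys′ : List V) : Set where
    before : ∀ {bs} → Path x t′ bs → ys ≡ bs ++ ys′ → xs′ ≡ xs ++ bs → Compare {x} {t} xs ys {x′} {t′} xs′ ys′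
    same : t ≡ t′ → x ≡ x′ → Compare xs ys xs′ ys′
    after : ∀ {bs} → Path x′ t bs → ys′ ≡ bs ++ ys → xs ≡ xs′ ++ bs → Compare xs ys xs′ ys′

  starts-++ : ∀ {a b xs ys c d zs ws} → Path a b xs → Path c d zs → xs ++ ys ≡ zs ++ ws → a ≡ c
  starts-++ p q eq with uncons p | uncons q
  ... | _ , refl | _ , refl = Listₚ.∷-injectiveˡ eq

  compare : ∀ {a e e′ t x xs ys t′ x′ xs′ ys′} → Path a t xs → Path x e ys → Path a t′ xs′ → Path x′ e′ ys′ →
            xs ++ ys ≡ xs′ ++ ys′ → Compare {x} {t} xs ys {x′} {t′} xs′ ys′
  compare [-] q [-] q′ eq = same refl (starts-agree q q′ (Listₚ.∷-injectiveʳ eq))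
  compare [-] q (e ∷ p′) q′ eq
    with refl ← starts-++ q p′ (trans (Listₚ.++-identityʳ _) (Listₚ.∷-injectiveʳ eq)) =
    before p′ (Listₚ.∷-injectiveʳ eq) refl
  compare (e ∷ p) q [-] q′ eq
    with refl ← starts-++ q′ p (trans (Listₚ.++-identityʳ _) (≡-sym (Listₚ.∷-injectiveʳ eq))) =
    after p (≡-sym (Listₚ.∷-injectiveʳ eq)) refl
  compare (e ∷ p) q (e′ ∷ p′) q′ eq with refl ← starts-++ p p′ (Listₚ.∷-injectiveʳ eq)
    with compare p q p′ q′ (Listₚ.∷-injectiveʳ eq)
  ... | before r refl refl = before r refl refl
  ... | same h k = same h k
  ... | after r refl refl = after r refl refl

  module _ {X : V → Set} (X? : Decidable X) where

    Avoids : List V → Set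
    Avoids = All (λ v → ¬ X v)

    data LastIn (a b : V) (ps : List V) : Set where
      none : Avoids ps → LastIn a b ps
      at : ∀ {x s xs ys} → X x → Path a x xs → R x s → Path s b ys → Avoids ys → ps ≡ xs ++ ys → LastIn a b ps

    -- That `b` is outside X guarantees a successor of the last vertex of X, and it is at this
    -- successor that paths are rerouted.
    last-in : ∀ {a b ps} → Path a b ps → ¬ X b → LastIn a b ps
    last-in [-] ¬Xb = none (¬Xb ∷ [])
    last-in {a} (e ∷ p) ¬Xb with last-in p ¬Xb
    ... | at Xx q f r av refl = at Xx (e ∷ q) f r av refl
    ... | none av with X? a
    ...   | yes Xa = at Xa [-] e p av refl
    ...   | no ¬Xa = none (¬Xa ∷ av)

    data FirstIn (a b : V) (ps : List V) : Set where
      none : Avoids ps → FirstIn a b ps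
      at : ∀ {t x xs ys} → Path a t xs → Avoids xs → R t x → X x → Path x b ys → ps ≡ xs ++ ys → FirstIn a b ps

    first-in : ∀ {a b ps} → Path a b ps → ¬ X a → FirstIn a b ps
    first-in [-] ¬Xa = none (¬Xa ∷ [])
    first-in {a} (_∷_ {w = w} e p) ¬Xa with X? w
    ... | yes Xw = at [-] (¬Xa ∷ []) e Xw p refl
    ... | no ¬Xw with first-in p ¬Xw
    ...   | none av = none (¬Xa ∷ av)
    ...   | at q av f Xx r refl = at (e ∷ q) (¬Xa ∷ av) f Xx r refl

  suffix : ∀ {a b xs u} → Path a b xs → u ∈ xs →
           ∃[ ys ] Path u b ys × (∀ {v} → v ∈ ys → v ∈ xs) × (Unique xs → Unique ys)
  suffix p (here refl) with uncons p
  ... | _ , refl = _ , p , id , id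
  suffix (e ∷ p) (there u∈) with suffix p u∈
  ... | ys , q , sub , u = ys , q , there ∘ sub , λ { (_ ∷ v) → u v }
  suffix [-] (there ())

  loop-erase : ∀ {P : V → Set} {a b} → WalkIn R P a b → ∃[ xs ] Path a b xs × Unique xs × All P xs
  loop-erase [ p ] = _ , [-] , ([] ∷ []) , (p ∷ [])
  loop-erase (step {u} p e w) with loop-erase w
  ... | xs , q , uq , all with u ∈? xs
    where open import Data.List.Membership.DecPropositional (Finₚ._≟_ {n}) using (_∈?_)
  ...   | yes u∈ with suffix q u∈
  ...     | ys , r , sub , u′ = ys , r , u′ uq , All.tabulate (All.lookup all ∘ sub)
  loop-erase (step {u} p e w) | xs , q , uq , all | no u∉ =
    u ∷ xs , e ∷ q , All.tabulate (λ x∈ u≡x → u∉ (subst (_∈ xs) (≡-sym u≡x) x∈)) ∷ uq , p ∷ all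

-- A rerouted path consists of segments of the old one in another order; the solver checks that no
-- segment is lost or used twice.
module BlockSolver {A : Set} = CMSolver (Permₚ.++-commutativeMonoid {A = A})

-- Longest paths from the root of a block

-- An end reduced to what rerouting uses. Criticality enters only through `clique`, derived from it
-- later, and through separate hypotheses on pairs of vertices.
record RootedBlock {n : ℕ} (G : Graph n) : Set₁ where
  field
    root : Fin n
    R : Fin n → Set
    R? : Decidable R
    root∉R : ¬ R root
    closed : ∀ {u w} → R u → Adj G u w → w ≢ root → R w
    clique : ∀ {a b} → R a → R b → Adj G root a → Adj G root b → a ≢ b → Adj G a b
    connected : ∀ h → WalkIn (Adj G) (λ _ → ⊤) h root
    nonseparating : ∀ {h x} → R h → R x → h ≢ x → WalkIn (Adj G) (_≢ x) h root

module Block {n : ℕ} (G : Graph n) (B : RootedBlock G) where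

  open RootedBlock B renaming (root to c; root∉R to c∉R) public

  V = Fin n
  infix 4 _~_
  _~_ = Adj G

  ~sym : ∀ {u v} → u ~ v → v ~ u
  ~sym = Graph.sym G

  open Paths _~_ ~sym public
  open import Data.List.Membership.DecPropositional (Finₚ._≟_ {n}) using (_∈?_) public
  _≟_ = Finₚ._≟_ {n}

  A : V → Set
  A v = R v × c ~ v

  A-clique : ∀ {a b} → A a → A b → a ≢ b → a ~ b
  A-clique (Ra , ca) (Rb , cb) = clique Ra Rb ca cb

  R⇒≢c : ∀ {v} → R v → v ≢ c
  R⇒≢c r refl = c∉R r

  In : V → Set
  In v = v ≡ c ⊎ R v

  record Longest : Set where
    field
      ps₀ : List V
      end₀ : V
      path₀ : Path c end₀ ps₀
      unique₀ : Unique ps₀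
      in₀ : ∀ {v} → v ∈ ps₀ → In v
      longest : ∀ {e qs} → Path c e qs → Unique qs → (∀ {v} → v ∈ qs → In v) → length qs ≤ length ps₀
      h : V
      Rh : R h
      h∉ps₀ : h ∉ ps₀

  module Long (L : Longest) where
    open Longest L public

    -- A rerouted path with the same vertices is again longest and has the same K and X, so all that
    -- is shown for one path can be applied to the next.
    LP : V → List V → Set
    LP e ps = Path c e ps × ps ↭ ps₀

    Out : V → Set
    Out v = R v × v ∉ ps₀

    Out? : Decidable Out
    Out? v = R? v ×-dec ¬? (v ∈? ps₀)

    K : Component G Out? h
    K = component G Out? h (Rh , h∉ps₀)

    InK : V → Set
    InK v = v ∈ Component.verts K

    h∈K : InK h
    h∈K = Component.self K

    K⇒Out : ∀ {k} → InK k → Out k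
    K⇒Out k∈ = proj₂ (walk-end (Component.reach K k∈))

    tooLong : ∀ {e ys ks ps} → Trail c e ys → ps ↭ ps₀ → ys ↭ ks ++ ps →
              Unique ks → (∀ {k} → k ∈ ks → Out k) → 0 < length ks → ⊥
    tooLong {ks = ks} (zs , p , zs↭) ps↭ ys↭ uks out pos =
      ℕₚ.<⇒≱ (ℕₚ.≤-trans (ℕₚ.+-monoˡ-≤ (length ps₀) pos)
               (ℕₚ.≤-reflexive (trans (≡-sym (Listₚ.length-++ ks)) (Permₚ.↭-length (↭-sym perm)))))
             (longest p (unique-↭ (↭-sym perm) unq) λ v∈ → inn (∈-++⁻ ks (Permₚ.∈-resp-↭ perm v∈)))
      where
      perm : zs ↭ ks ++ ps₀
      perm = ↭-trans zs↭ (↭-trans ys↭ (Permₚ.++⁺ˡ ks ps↭))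
      unq : Unique (ks ++ ps₀)
      unq = Uniqueₚ.++⁺ uks unique₀ λ (k∈ , k∈ps) → proj₂ (out k∈) k∈ps
      inn : ∀ {v} → v ∈ ks ⊎ v ∈ ps₀ → In v
      inn (inj₁ k∈) = inj₂ (proj₁ (out k∈))
      inn (inj₂ v∈) = in₀ v∈

    -- A missed neighbour of the root could be inserted directly after the root, as the neighbours
    -- of the root form a clique.
    A⊆ps₀ : ∀ {a} → A a → a ∈ ps₀
    A⊆ps₀ {a} (Ra , ca) with a ∈? ps₀
    ... | yes a∈ = a∈
    ... | no a∉ = ⊥-elim (go path₀ refl)
      where
      single : Unique (a ∷ [])
      single = [] ∷ []
      out : ∀ {k} → k ∈ a ∷ [] → Out k
      out (here refl) = Ra , a∉
      go : ∀ {qs} → Path c end₀ qs → qs ≡ ps₀ → ⊥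
      go [-] refl = tooLong (⌊ ca ∷ [-] ⌋) ↭-refl (Permₚ.++-comm (c ∷ []) (a ∷ [])) single out (s≤s z≤n)
      go (_∷_ {w = w} {xs = xs} e p) refl = tooLong (⌊ ca ∷ aw ∷ p ⌋) ↭-refl
          (Permₚ.++⁺ʳ xs (Permₚ.++-comm (c ∷ []) (a ∷ []))) single out (s≤s z≤n)
        where
        w≢c : w ≢ c
        w≢c w≡c = Uniqueₚ.Unique[x∷xs]⇒x∉xs unique₀ (subst (_∈ _) w≡c (start∈ p))
        Rw : R w
        Rw with in₀ (there (start∈ p))
        ... | inj₁ eq = ⊥-elim (w≢c eq)
        ... | inj₂ r = r
        aw : a ~ w
        aw = clique Ra Rw ca e λ { refl → a∉ (there (start∈ p)) }

    X : V → Set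
    X v = v ∈ ps₀ × Any.Any (λ k → k ~ v) (Component.verts K)

    abstract
      X? : Decidable X
      X? v = (v ∈? ps₀) ×-dec Any.any? (λ k → dec G k v) _

    c≁K : ∀ {k} → InK k → ¬ c ~ k
    c≁K k∈ e = proj₂ (K⇒Out k∈) (A⊆ps₀ (proj₁ (K⇒Out k∈) , e))

    K-adj : ∀ {k u} → InK k → k ~ u → InK u ⊎ X u
    K-adj {k} {u} k∈ e with u ≟ c | u ∈? ps₀
    ... | yes refl | _ = ⊥-elim (c≁K k∈ (~sym e))
    ... | no u≢c | yes u∈ = inj₂ (u∈ , lose k∈ e)
    ... | no u≢c | no u∉ = inj₁ (Component.closed K k∈ e (closed (proj₁ (K⇒Out k∈)) e u≢c , u∉))

    K-adj-ps : ∀ {k u} → InK k → k ~ u → u ∈ ps₀ → X u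
    K-adj-ps k∈ e u∈ with K-adj k∈ e
    ... | inj₁ u∈K = ⊥-elim (proj₂ (K⇒Out u∈K) u∈)
    ... | inj₂ Xu = Xu

    X⇒≢c : ∀ {x} → X x → x ≢ c
    X⇒≢c (_ , any) refl with find any
    ... | k , k∈ , e = c≁K k∈ (~sym e)

    X⇒R : ∀ {x} → X x → R x
    X⇒R Xx@(x∈ , _) with in₀ x∈
    ... | inj₁ refl = ⊥-elim (X⇒≢c Xx refl)
    ... | inj₂ r = r

    ps₀⇒R : ∀ {v} → v ∈ ps₀ → v ≢ c → R v
    ps₀⇒R v∈ v≢c with in₀ v∈
    ... | inj₁ eq = ⊥-elim (v≢c eq)
    ... | inj₂ r = r

    record Conn (x x′ : V) : Set where
      field
        k k′ : V
        ks : List V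
        e : x ~ k
        e′ : k′ ~ x′
        path : Path k k′ ks
        unq : Unique ks
        out : ∀ {k} → k ∈ ks → Out k
        pos : 0 < length ks

    conn : ∀ {x x′} → X x → X x′ → Conn x x′
    conn (_ , any) (_ , any′) with find any | find any′
    ... | k , k∈ , e | k′ , k′∈ , e′
      with loop-erase (walk-reverse ~sym (Component.reach K k∈) ◅◅ Component.reach K k′∈)
    ...   | ks , p , u , all = record
      { k = k ; k′ = k′ ; ks = ks ; e = ~sym e ; e′ = e′ ; path = p ; unq = u
      ; out = λ k∈ → proj₂ (All.lookup all k∈) ; pos = len p }
      where
      len : ∀ {a b xs} → Path a b xs → 0 < length xs
      len [-] = s≤s z≤n
      len (_ ∷ _) = s≤s z≤n

    via : ∀ {a b x x′ xs ys} → Trail a x xs → (C : Conn x x′) → Trail x′ b ys → Trail a b (xs ++ Conn.ks C ++ ys)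
    via p C q = p ⟪ Conn.e C ⟫ ⌊ Conn.path C ⌋ ⟪ Conn.e′ C ⟫ q

    -- Runs along p, through K, and along q; since p and q together use up the vertices of ps, this is longer than the longest path.
    no-detour : ∀ {b x x′ xs ys ps} → Trail c x xs → X x → X x′ → Trail x′ b ys → ps ↭ ps₀ → xs ++ ys ↭ ps → ⊥
    no-detour {xs = xs} {ys} p Xx Xx′ q ps↭ perm = tooLong (via p C q) ps↭
        (↭-trans (↭-sym (↭-trans (↭-reflexive (≡-sym (Listₚ.++-assoc ks xs ys)))
                  (↭-trans (Permₚ.++⁺ʳ ys (Permₚ.++-comm ks xs)) (↭-reflexive (Listₚ.++-assoc xs ks ys)))))
                 (Permₚ.++⁺ˡ ks perm))
        (Conn.unq C) (Conn.out C) (Conn.pos C)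
      where
      C = conn Xx Xx′
      ks = Conn.ks C

    -- A path on the same vertices that ends in X could be continued into K.
    no-exit : ∀ {x xs ps} → Trail c x xs → X x → ps ↭ ps₀ → xs ↭ ps → ⊥
    no-exit {xs = xs} p (_ , any) ps↭ perm with find any
    ... | k , k∈ , e = tooLong (p ⟪ ~sym e ⟫ ⌊ [-] ⌋) ps↭
          (↭-trans (Permₚ.++-comm xs (k ∷ [])) (Permₚ.++⁺ˡ (k ∷ []) perm))
          ([] ∷ []) (λ { (here refl) → K⇒Out k∈ }) (s≤s z≤n)

    -- Otherwise y would separate h from the root.
    another-X : ∀ {y} → R y → y ≢ h → ∃[ x ] X x × x ≢ y
    another-X {y} Ry y≢h with Finₚ.any? (λ x → X? x ×-dec ¬? (x ≟ y))
    ... | yes (x , Xx , x≢y) = x , Xx , x≢y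
    ... | no ¬any = ⊥-elim (c∉R (proj₁ (K⇒Out (walk-end (walk-closed (nonseparating Rh Ry (y≢h ∘ ≡-sym)) h∈K stay)))))
      where
      stay : ∀ {u v} → u ≢ y → v ≢ y → u ~ v → InK u → InK v
      stay {v = v} _ v≢y e u∈ with K-adj u∈ e
      ... | inj₁ v∈ = v∈
      ... | inj₂ Xv = ⊥-elim (¬any (v , Xv , v≢y))

    some-X : ∃[ x ] X x
    some-X with Finₚ.any? X?
    ... | yes r = r
    ... | no ¬any = ⊥-elim (c∉R (proj₁ (K⇒Out (walk-end (walk-closed (connected h) h∈K stay)))))
      where
      stay : ∀ {u v} → ⊤ → ⊤ → u ~ v → InK u → InK v
      stay {v = v} _ _ e u∈ with K-adj u∈ e
      ... | inj₁ v∈ = v∈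
      ... | inj₂ Xv = ⊥-elim (¬any (v , Xv))

    X⇒≢h : ∀ {x} → X x → x ≢ h
    X⇒≢h (x∈ , _) refl = h∉ps₀ x∈

    -- The predecessors on a path of the neighbours of K, together with the last vertex. By maximality they are independent.
    predsFrom : V → List V → List V
    predsFrom u [] = u ∷ []
    predsFrom u (w ∷ ws) with X? w
    ... | yes _ = u ∷ predsFrom w ws
    ... | no _ = predsFrom w ws

    preds : List V → List V
    preds [] = []
    preds (u ∷ ws) = predsFrom u ws

    predsFrom-⊆ : ∀ u ws {t} → t ∈ predsFrom u ws → t ∈ u ∷ ws
    predsFrom-⊆ u [] t∈ = t∈
    predsFrom-⊆ u (w ∷ ws) t∈ with X? w
    predsFrom-⊆ u (w ∷ ws) (here refl) | yes _ = here refl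
    predsFrom-⊆ u (w ∷ ws) (there t∈) | yes _ = there (predsFrom-⊆ w ws t∈)
    predsFrom-⊆ u (w ∷ ws) t∈ | no _ = there (predsFrom-⊆ w ws t∈)

    preds-⊆ : ∀ ps {t} → t ∈ preds ps → t ∈ ps
    preds-⊆ (u ∷ ws) = predsFrom-⊆ u ws

    predsFrom-unique : ∀ u ws → Unique (u ∷ ws) → Unique (predsFrom u ws)
    predsFrom-unique v [] u = u
    predsFrom-unique v (w ∷ ws) (v∉ ∷ u) with X? w
    ... | yes _ = All.tabulate (λ t∈ → All.lookup v∉ (predsFrom-⊆ w ws t∈)) ∷ predsFrom-unique w ws u
    ... | no _ = predsFrom-unique w ws u

    preds-unique : ∀ ps → Unique ps → Unique (preds ps)
    preds-unique [] u = u
    preds-unique (v ∷ ws) u = predsFrom-unique v ws u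

    length-preds : ∀ u ws → length (preds (u ∷ ws)) ≡ suc (length (filter X? ws))
    length-preds u [] = refl
    length-preds u (w ∷ ws) with X? w
    ... | yes _ = cong suc (length-preds w ws)
    ... | no _ = length-preds w ws

    data Pos (a e : V) (ps : List V) (t : V) : Set where
      last : t ≡ e → Pos a e ps t
      pred : ∀ {x xs ys} → Path a t xs → t ~ x → X x → Path x e ys → ps ≡ xs ++ ys → Pos a e ps t

    Pos-∷ : ∀ {u w e xs t} → u ~ w → Pos w e xs t → Pos u e (u ∷ xs) t
    Pos-∷ e (last eq) = last eq
    Pos-∷ e (pred q f Xx r refl) = pred (e ∷ q) f Xx r refl

    preds⇒Pos : ∀ {a e ps t} → Path a e ps → t ∈ preds ps → Pos a e ps t
    preds⇒Pos [-] (here refl) = last refl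
    preds⇒Pos (_∷_ {w = w} e p) t∈ with uncons p
    ... | qs , refl with X? w
    ...   | no _ = Pos-∷ e (preds⇒Pos p t∈)
    ...   | yes Xw with t∈
    ...     | here refl = pred [-] e Xw p refl
    ...     | there t∈′ = Pos-∷ e (preds⇒Pos p t∈′)

    last∈preds : ∀ {a e ps} → Path a e ps → e ∈ preds ps
    last∈preds [-] = here refl
    last∈preds (_∷_ {w = w} e p) with uncons p
    ... | qs , refl with X? w
    ...   | yes _ = there (last∈preds p)
    ...   | no _ = last∈preds p

    pred∈preds : ∀ {a e t x xs ys} → Path a t xs → X x → Path x e ys → t ∈ preds (xs ++ ys)
    pred∈preds {x = x} [-] Xx q with uncons q
    ... | qs , refl with X? x
    ...   | yes _ = here refl
    ...   | no ¬Xx = ⊥-elim (¬Xx Xx)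
    pred∈preds {ys = ys} (_∷_ {w = w} e p) Xx q with uncons p
    ... | qs , refl with X? w
    ...   | yes _ = there (pred∈preds p Xx q)
    ...   | no _ = pred∈preds p Xx q

unique-length> : ∀ {n} {xs ys : List (Fin n)} → Unique xs → length ys < length xs → ∃[ x ] x ∈ xs × x ∉ ys
unique-length> {n} {xs} {ys} u lt with Any.any? (λ x → ¬? (x ∈? ys)) xs
  where open import Data.List.Membership.DecPropositional (Finₚ._≟_ {n}) using (_∈?_)
... | yes any = find any
... | no ¬any = ⊥-elim (ℕₚ.<⇒≱ lt (unique-⊆⇒length≤ u λ {x} x∈ → decidable-stable (x ∈? ys) λ x∉ → ¬any (lose x∈ x∉)))
  where open import Data.List.Membership.DecPropositional (Finₚ._≟_ {n}) using (_∈?_)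

-- Edge-criticality inside a block
module Criticality {n : ℕ} (G : Graph n) (B : RootedBlock G) where

  open Block G B

  Nbr : V → V → Set
  Nbr u x = u ≡ x ⊎ x ~ u

  Nbr? : ∀ u x → Dec (Nbr u x)
  Nbr? u x = (u ≟ x) ⊎-dec dec G x u

  -- {x , z} dominates everything but y, as in a minimum connected dominating set of G + xy.
  record Arrow (x y z : V) : Set where
    field
      Rz : R z
      link : z ≡ x ⊎ x ~ z
      hits : A x ⊎ A z
      z≢y : z ≢ y
      z≁y : ¬ z ~ y
      dom : ∀ {u} → R u → u ≢ y → Nbr u x ⊎ Nbr u z

  -- In a set for G + xy the new edge either dominates the one vertex missed in G, which is an
  -- arrow, or joins the two chosen vertices x and y, which is `dom₂`.
  data Pair (x y : V) : Set where
    arrow : ∀ {z} → Arrow x y z → Pair x y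
    arrow′ : ∀ {z} → Arrow y x z → Pair x y
    dom₂ : (∀ {u} → R u → Nbr u x ⊎ Nbr u y) → Pair x y

  -- The same for G + cv, where c is the root.
  data RootPair (v : V) : Set where
    away : ∀ {a b} → A a → R b → b ≡ a ⊎ a ~ b → ¬ Nbr v a → ¬ Nbr v b →
           (∀ {u} → R u → u ≢ v → Nbr u a ⊎ Nbr u b) → RootPair v
    through : ∀ {b} → R b → b ≡ v ⊎ v ~ b ⊎ c ~ b →
           (∀ {u} → R u → ¬ c ~ u → Nbr u v ⊎ Nbr u b) → RootPair v

  record Critical₃ : Set where
    field
      pair : ∀ {x y} → R x → R y → x ≢ y → ¬ x ~ y → Pair x y
      rootPair : ∀ {v} → R v → ¬ c ~ v → RootPair v
      notSmall : ∀ {s t} → A s → R t → t ≡ s ⊎ s ~ t → ¬ (∀ {u} → R u → Nbr u s ⊎ Nbr u t)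

  -- Critical₃ is for blocks that need exactly three further vertices, Critical₂ for those that need at most two.
  Critical₂ : Set
  Critical₂ = ∀ {x y} → R x → R y → x ≢ y → ¬ x ~ y →
    (A x × (∀ {u} → R u → u ≢ y → Nbr u x)) ⊎ (A y × (∀ {u} → R u → u ≢ x → Nbr u y))

-- Predecessors and owners on a longest path

module LongFacts {n : ℕ} (G : Graph n) (B : RootedBlock G) (L : Block.Longest G B) where

  open Block G B
  open Long L
  open Criticality G B

  -- With an edge between two vertices of T, the segment between them could be traversed backwards,
  -- which frees the two neighbours of K for a detour.
  T-indep : ∀ {e ps} → LP e ps → ∀ {t t′} → t ∈ preds ps → t′ ∈ preds ps → t ≢ t′ → ¬ t ~ t′
  T-indep (p , ps↭) t∈ t′∈ t≢t′ f with preds⇒Pos p t∈ | preds⇒Pos p t′∈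
  ... | last refl | last refl = t≢t′ refl
  ... | pred q _ Xx r refl | last refl = no-exit (⌊ q ⌋ ⟪ f ⟫ ⌊ r ⌋ʳ) Xx ps↭ ↭-refl
  ... | last refl | pred q _ Xx r refl = no-exit (⌊ q ⌋ ⟪ ~sym f ⟫ ⌊ r ⌋ʳ) Xx ps↭ ↭-refl
  ... | pred {xs = xs} q g Xx r refl | pred {ys = ys} q′ g′ Xx′ r′ eq with compare q r q′ r′ eq
  ...   | same refl _ = t≢t′ refl
  ...   | before {bs} m refl refl = no-detour (⌊ q ⌋ ⟪ f ⟫ ⌊ m ⌋ʳ) Xx Xx′ ⌊ r′ ⌋ ps↭ (↭-reflexive (Listₚ.++-assoc xs bs ys))
  T-indep (p , ps↭) t∈ t′∈ t≢t′ f | pred {ys = ys} q g Xx r refl | pred {xs = xs} q′ g′ Xx′ r′ eq | after {bs} m refl refl =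
    no-detour (⌊ q′ ⌋ ⟪ ~sym f ⟫ ⌊ m ⌋ʳ) Xx′ Xx ⌊ r ⌋ ps↭ ↭-refl

  -- Two consecutive vertices of X admit K between them, and a last vertex in X admits K after it.
  T∩X : ∀ {e ps} → LP e ps → ∀ {t} → t ∈ preds ps → ¬ X t
  T∩X (p , ps↭) t∈ Xt with preds⇒Pos p t∈
  ... | last refl = no-exit ⌊ p ⌋ Xt ps↭ ↭-refl
  ... | pred q _ Xx r refl = no-detour ⌊ q ⌋ Xt Xx ⌊ r ⌋ ps↭ ↭-refl

  -- Otherwise: c ... x, K, x′ ... e, s ... t.
  last≁succ : ∀ {e ps x s t x′ xs bs ys} → LP e ps → Path c x xs → Path s t bs → Path x′ e ys →
              ps ≡ xs ++ bs ++ ys → X x → X x′ → ¬ e ~ s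
  last≁succ {xs = xs} {bs} {ys} (p , ps↭) q m r refl Xx Xx′ f =
    no-detour ⌊ q ⌋ Xx Xx′ (⌊ r ⌋ ⟪ f ⟫ ⌊ m ⌋) ps↭ (Permₚ.++⁺ˡ xs (Permₚ.++-comm ys bs))

  module _ {e ps} (lp : LP e ps) where

    private
      p = proj₁ lp
      ps↭ = proj₂ lp

    ∈ps : ∀ {v} → v ∈ ps₀ → v ∈ ps
    ∈ps = Permₚ.∈-resp-↭ (↭-sym ps↭)

    ∈ps₀ : ∀ {v} → v ∈ ps → v ∈ ps₀
    ∈ps₀ = Permₚ.∈-resp-↭ ps↭

    unique-ps : Unique ps
    unique-ps = unique-↭ (↭-sym ps↭) unique₀

    T⇒∈ps₀ : ∀ {t} → t ∈ preds ps → t ∈ ps₀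
    T⇒∈ps₀ t∈ = ∈ps₀ (preds-⊆ ps t∈)

    T⇒R : ∀ {t} → t ∈ preds ps → t ≢ c → R t
    T⇒R t∈ = ps₀⇒R (T⇒∈ps₀ t∈)

    T≁K : ∀ {t k} → t ∈ preds ps → InK k → ¬ t ~ k
    T≁K t∈ k∈ f = T∩X lp t∈ (K-adj-ps k∈ (~sym f) (T⇒∈ps₀ t∈))

    T≢h : ∀ {t} → t ∈ preds ps → t ≢ h
    T≢h t∈ refl = h∉ps₀ (T⇒∈ps₀ t∈)

    Xs : List V
    Xs = filter X? ps

    X⇒∈Xs : ∀ {x} → X x → x ∈ Xs
    X⇒∈Xs Xx = ∈-filter⁺ X? (∈ps (proj₁ Xx)) Xx

    -- The path starts at the root, which is not in X; so each vertex of X has a predecessor, and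
    -- the last vertex of the path adds one.
    length-T : length (preds ps) ≡ suc (length Xs)
    length-T with uncons p
    ... | qs , refl with X? c in eq | length-preds c qs
    ...   | yes Xc | _ = ⊥-elim (X⇒≢c Xc refl)
    ...   | no _ | len = len

    c∈T⇒ : c ∈ preds ps → ∀ {t} → t ∈ preds ps → t ≢ c → ¬ c ~ t
    c∈T⇒ c∈ t∈ t≢c = T-indep lp c∈ t∈ (t≢c ∘ ≡-sym)

    -- `t` has no neighbour in K, so `z` must dominate `h`; being adjacent to `t`, it cannot lie in
    -- K itself.
    arrow-X : ∀ {t w z} → t ∈ ps₀ → ¬ X t → w ≢ h → Arrow t w z → X z × t ~ z × z ~ h
    arrow-X {t} {w} {z} t∈ ¬Xt w≢h a = Xz , t~z , z~h
      where
      open Arrow a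
      t≢h : t ≢ h
      t≢h refl = h∉ps₀ t∈
      h≁t : ¬ t ~ h
      h≁t f = ¬Xt (K-adj-ps h∈K (~sym f) t∈)
      nbr : Nbr h z
      nbr with dom Rh (w≢h ∘ ≡-sym)
      ... | inj₁ (inj₁ eq) = ⊥-elim (t≢h (≡-sym eq))
      ... | inj₁ (inj₂ f) = ⊥-elim (h≁t f)
      ... | inj₂ nz = nz
      t~z : t ~ z
      t~z with link
      ... | inj₂ f = f
      ... | inj₁ refl with nbr
      ...   | inj₁ eq = ⊥-elim (t≢h (≡-sym eq))
      ...   | inj₂ f = ⊥-elim (h≁t f)
      z~h : z ~ h
      z~h with nbr
      ... | inj₂ f = f
      ... | inj₁ refl = ⊥-elim (h≁t t~z)
      Xz : X z
      Xz with K-adj h∈K (~sym z~h)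
      ... | inj₂ x = x
      ... | inj₁ z∈K = ⊥-elim (¬Xt (K-adj-ps z∈K (~sym t~z) t∈))

    record Own (x t : V) : Set where
      field
        Xx : X x
        t∈T : t ∈ preds ps
        x≁t : ¬ x ~ t
        rest : ∀ {s} → s ∈ preds ps → s ≢ t → x ~ s

    open Own

    Own? : ∀ x t → Dec (Own x t)
    Own? x t = map′
      (λ (a , b , d , r) → record { Xx = a ; t∈T = b ; x≁t = d ; rest = λ s∈ s≢t → [ (λ s≡t → ⊥-elim (s≢t s≡t)) , id ]′ (All.lookup r s∈) })
      (λ o → Xx o , t∈T o , x≁t o , All.tabulate λ {s} s∈ → aux o s∈ (s ≟ t))
      (X? x ×-dec (t ∈? preds ps) ×-dec ¬? (dec G x t) ×-dec All.all? (λ s → (s ≟ t) ⊎-dec dec G x s) (preds ps))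
      where
      aux : Own x t → ∀ {s} → s ∈ preds ps → Dec (s ≡ t) → s ≡ t ⊎ x ~ s
      aux o s∈ (yes eq) = inj₁ eq
      aux o s∈ (no s≢t) = inj₂ (rest o s∈ s≢t)

    own-exact : ∀ {x t t′} → Own x t → t′ ∈ preds ps → ¬ x ~ t′ → t′ ≡ t
    own-exact {x} {t} {t′} o t′∈ ¬f = decidable-stable (t′ ≟ t) λ t′≢t → ¬f (rest o t′∈ t′≢t)

    own-injective : ∀ {x t t′} → Own x t → Own x t′ → t ≡ t′
    own-injective o o′ = own-exact o′ (t∈T o) (x≁t o)

    -- T is independent, so `t` dominates no other vertex of T and `z` has to do it.
    arrow-T : ∀ {t w z} → t ∈ preds ps → t ≢ c → w ≢ h → Arrow t w z →
              X z × t ~ z × (∀ {s} → s ∈ preds ps → s ≢ w → z ~ s)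
    arrow-T {t} {w} {z} t∈ t≢c w≢h a with arrow-X (T⇒∈ps₀ t∈) (T∩X lp t∈) w≢h a
    ... | Xz , t~z , _ = Xz , t~z , all
      where
      open Arrow a
      all : ∀ {s} → s ∈ preds ps → s ≢ w → z ~ s
      all {s} s∈ s≢w with s ≟ t | s ≟ c
      ... | yes refl | _ = ~sym t~z
      -- The root is not in R, hence not covered by `dom`. Here `hits` replaces it: `t` cannot be
      -- adjacent to the root, so `z` is.
      ... | no s≢t | yes refl with hits
      ...   | inj₁ (_ , c~t) = ⊥-elim (c∈T⇒ s∈ t∈ t≢c c~t)
      ...   | inj₂ (_ , c~z) = ~sym c~z
      all {s} s∈ s≢w | no s≢t | no s≢c with dom (T⇒R s∈ s≢c) s≢w
      ... | inj₁ (inj₁ eq) = ⊥-elim (s≢t eq)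
      ... | inj₁ (inj₂ f) = ⊥-elim (T-indep lp t∈ s∈ (s≢t ∘ ≡-sym) f)
      ... | inj₂ (inj₁ refl) = ⊥-elim (T∩X lp s∈ Xz)
      ... | inj₂ (inj₂ f) = f

    arrow-own : ∀ {t t′ z} → t ∈ preds ps → t ≢ c → t′ ∈ preds ps → Arrow t t′ z → Own z t′ × t ~ z
    arrow-own t∈ t≢c t′∈ a with arrow-T t∈ t≢c (T≢h t′∈) a
    ... | Xz , t~z , all = record { Xx = Xz ; t∈T = t′∈ ; x≁t = Arrow.z≁y a ; rest = all } , t~z

    module _ (crit : Critical₃) where
      open Critical₃ crit

      -- `dom₂` is impossible: `h` would be dominated by a vertex of T, and T has no neighbour in K.
      T-pair : ∀ {t t′} → t ∈ preds ps → t ≢ c → t′ ∈ preds ps → t′ ≢ c → t ≢ t′ →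
               (∃[ x ] Arrow t t′ x × Own x t′ × t ~ x) ⊎ (∃[ x ] Arrow t′ t x × Own x t × t′ ~ x)
      T-pair {t} {t′} t∈ t≢c t′∈ t′≢c t≢t′ with pair (T⇒R t∈ t≢c) (T⇒R t′∈ t′≢c) t≢t′ (T-indep lp t∈ t′∈ t≢t′)
      ... | arrow a = inj₁ (_ , a , arrow-own t∈ t≢c t′∈ a)
      ... | arrow′ a = inj₂ (_ , a , arrow-own t′∈ t′≢c t∈ a)
      ... | dom₂ d with d Rh
      ...   | inj₁ (inj₁ eq) = ⊥-elim (T≢h t∈ (≡-sym eq))
      ...   | inj₁ (inj₂ f) = ⊥-elim (T≁K t∈ h∈K f)
      ...   | inj₂ (inj₁ eq) = ⊥-elim (T≢h t′∈ (≡-sym eq))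
      ...   | inj₂ (inj₂ f) = ⊥-elim (T≁K t′∈ h∈K f)

      unowned-arrow : ∀ {t t′} → t ∈ preds ps → t ≢ c → (∀ {x} → ¬ Own x t) → t′ ∈ preds ps → t′ ≢ c → t ≢ t′ →
                      ∃[ x ] Arrow t t′ x × Own x t′ × t ~ x
      unowned-arrow t∈ t≢c un t′∈ t′≢c t≢t′ with T-pair t∈ t≢c t′∈ t′≢c t≢t′
      ... | inj₁ r = r
      ... | inj₂ (_ , _ , o , _) = ⊥-elim (un o)

      two-X : ∃[ x ] ∃[ y ] X x × X y × y ≢ x
      two-X with some-X
      ... | x , Xx with another-X (X⇒R Xx) (X⇒≢h Xx)
      ...   | y , Xy , y≢x = x , y , Xx , Xy , y≢x

      2≤X : 2 ≤ length Xs
      2≤X with two-X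
      ... | x , y , Xx , Xy , y≢x = unique-⊆⇒length≤ {xs = x ∷ y ∷ []} (((y≢x ∘ ≡-sym) ∷ []) ∷ [] ∷ []) λ where
          (here refl) → X⇒∈Xs Xx
          (there (here refl)) → X⇒∈Xs Xy

      -- T has |X| + 1 ≥ 3 vertices, of which only two are excluded.
      other-T : ∀ t → ∃[ t′ ] t′ ∈ preds ps × t′ ≢ t × t′ ≢ c
      other-T t with unique-length> {ys = t ∷ c ∷ []} (preds-unique ps unique-ps)
                       (ℕₚ.≤-trans (s≤s 2≤X) (ℕₚ.≤-reflexive (≡-sym length-T)))
      ... | t′ , t′∈ , t′∉ = t′ , t′∈ , (λ eq → t′∉ (here eq)) , (λ eq → t′∉ (there (here eq)))

      -- The outcomes of joining `t` to `h`. The valuable one is `to-h`, whose `z` is adjacent to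
      -- all of T and leads to most reroutings.
      data HPair (t : V) : Set where
        to-t : ∀ {x} → Arrow h t x → A x → Own x t → h ~ x → HPair t
        to-h : ∀ {z} → Arrow t h z → A z → ¬ z ~ h → (∀ {s} → s ∈ preds ps → z ~ s) → HPair t

      -- Neither `h` nor `t` is adjacent to the root, so the middle vertex of the arrow is.
      h-pair : ∀ {t} → t ∈ preds ps → t ≢ c → ¬ c ~ t → HPair t
      h-pair {t} t∈ t≢c c≁t with pair Rh (T⇒R t∈ t≢c) (T≢h t∈ ∘ ≡-sym) (λ f → T≁K t∈ h∈K (~sym f))
      ... | dom₂ d with other-T t
      ...   | t′ , t′∈ , t′≢t , t′≢c with d (T⇒R t′∈ t′≢c)
      ...     | inj₁ (inj₁ eq) = ⊥-elim (T≢h t′∈ eq)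
      ...     | inj₁ (inj₂ f) = ⊥-elim (T≁K t′∈ h∈K (~sym f))
      ...     | inj₂ (inj₁ eq) = ⊥-elim (t′≢t eq)
      ...     | inj₂ (inj₂ f) = ⊥-elim (T-indep lp t∈ t′∈ (t′≢t ∘ ≡-sym) f)
      h-pair {t} t∈ t≢c c≁t | arrow {z} a = to-t a Az (record { Xx = Xz ; t∈T = t∈ ; x≁t = z≁y ; rest = all }) h~z
        where
        open Arrow a
        Az : A z
        Az with hits
        ... | inj₁ Ah = ⊥-elim (h∉ps₀ (A⊆ps₀ Ah))
        ... | inj₂ az = az
        h~z : h ~ z
        h~z with link
        ... | inj₁ refl = ⊥-elim (h∉ps₀ (A⊆ps₀ Az))
        ... | inj₂ f = f
        Xz : X z
        Xz = K-adj-ps h∈K h~z (A⊆ps₀ Az)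
        all : ∀ {s} → s ∈ preds ps → s ≢ t → z ~ s
        all {s} s∈ s≢t with s ≟ c
        ... | yes refl = ~sym (proj₂ Az)
        ... | no s≢c with dom (T⇒R s∈ s≢c) s≢t
        ...   | inj₁ (inj₁ eq) = ⊥-elim (T≢h s∈ eq)
        ...   | inj₁ (inj₂ f) = ⊥-elim (T≁K s∈ h∈K (~sym f))
        ...   | inj₂ (inj₁ refl) = ⊥-elim (T∩X lp s∈ Xz)
        ...   | inj₂ (inj₂ f) = f
      h-pair {t} t∈ t≢c c≁t | arrow′ {z} a = to-h a Az z≁y all
        where
        open Arrow a
        Az : A z
        Az with hits
        ... | inj₁ (_ , c~t) = ⊥-elim (c≁t c~t)
        ... | inj₂ az = az
        t~z : t ~ z
        t~z with link
        ... | inj₁ refl = ⊥-elim (c≁t (proj₂ Az))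
        ... | inj₂ f = f
        all : ∀ {s} → s ∈ preds ps → z ~ s
        all {s} s∈ with s ≟ c | s ≟ t
        ... | yes refl | _ = ~sym (proj₂ Az)
        ... | no _ | yes refl = ~sym t~z
        ... | no s≢c | no s≢t with dom (T⇒R s∈ s≢c) (T≢h s∈)
        ...   | inj₁ (inj₁ eq) = ⊥-elim (s≢t eq)
        ...   | inj₁ (inj₂ f) = ⊥-elim (T-indep lp t∈ s∈ (s≢t ∘ ≡-sym) f)
        ...   | inj₂ (inj₁ refl) = ⊥-elim (T-indep lp t∈ s∈ (s≢t ∘ ≡-sym) t~z)
        ...   | inj₂ (inj₂ f) = f

  -- Pair `h` with the last vertex `e`. As A lies on the path, `h` is not in A, so `e` is in A and
  -- dominates all of R but `h`. This contradicts the independence of T at the predecessor of any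
  -- vertex of X.
  no-longest₂ : Critical₂ → ∀ {e ps} → LP e ps → ⊥
  no-longest₂ crit {e} lp@(p , ps↭) with some-X
  ... | x , Xx with cut-before p (∈ps lp (proj₁ Xx))
  ...   | inj₁ refl = X⇒≢c Xx refl
  ...   | inj₂ (t , xs , ys , q , f , r , refl) = go (e ≟ c)
    where
    e∈T = last∈preds p
    t∈T = pred∈preds q Xx r
    t≢e : t ≢ e
    t≢e refl = proj₂ (proj₂ (unique-++⁻ xs (unique-ps lp))) (end∈ q) (end∈ r)
    go : Dec (e ≡ c) → ⊥
    go (yes refl) = proj₂ (proj₂ (unique-++⁻ xs (unique-ps lp))) (start∈ q) (end∈ r)
    go (no e≢c) with crit Rh (T⇒R lp e∈T e≢c) (T≢h lp e∈T ∘ ≡-sym) (λ g → T≁K lp e∈T h∈K (~sym g))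
    ... | inj₁ (Ah , _) = h∉ps₀ (A⊆ps₀ Ah)
    ... | inj₂ ((_ , c~e) , dom) with t ≟ c
    ...   | yes refl = T-indep lp t∈T e∈T t≢e c~e
    ...   | no t≢c with dom (T⇒R lp t∈T t≢c) (T≢h lp t∈T)
    ...     | inj₁ eq = t≢e eq
    ...     | inj₂ g = T-indep lp e∈T t∈T (t≢e ∘ ≡-sym) g

-- Blocks that need exactly three further vertices

module ThreeMore {n : ℕ} (G : Graph n) (B : RootedBlock G) (L : Block.Longest G B) (crit : Criticality.Critical₃ G B) where

  open Block G B
  open Long L
  open Criticality G B
  open LongFacts G B L
  open Critical₃ crit
  open BlockSolver {A = V} using (solve; _⊕_)

  without : V → List V → List V
  without v = filter (λ u → ¬? (u ≟ v))

  without⁺ : ∀ {v xs u} → u ∈ xs → u ≢ v → u ∈ without v xs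
  without⁺ = ∈-filter⁺ (λ u → ¬? (u ≟ _))

  without⁻ : ∀ {v xs u} → u ∈ without v xs → u ∈ xs × u ≢ v
  without⁻ = ∈-filter⁻ (λ u → ¬? (u ≟ _))

  without-unique : ∀ v {xs} → Unique xs → Unique (without v xs)
  without-unique v = Uniqueₚ.filter⁺ (λ u → ¬? (u ≟ v))

  length-without< : ∀ {v xs} → v ∈ xs → length (without v xs) < length xs
  length-without< {v} {xs} v∈ = Listₚ.filter-notAll (λ u → ¬? (u ≟ v)) xs (Any.map (λ eq ¬eq → ¬eq (≡-sym eq)) v∈)

  length≤suc-without : ∀ v {xs} → Unique xs → length xs ≤ suc (length (without v xs))
  length≤suc-without v u = unique-⊆⇒length≤ {ys = v ∷ _} u λ {x} x∈ → case x ≟ v of λ where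
    (yes eq) → here eq
    (no x≢v) → there (without⁺ x∈ x≢v)

  notSmall′ : ∀ {s t} → A s → R t → t ≡ s ⊎ s ~ t → ∃[ u ] R u × ¬ Nbr u s × ¬ Nbr u t
  notSmall′ {s} {t} As Rt link with Finₚ.any? (λ u → R? u ×-dec ¬? (Nbr? u s) ×-dec ¬? (Nbr? u t))
  ... | yes r = r
  ... | no ¬any = ⊥-elim (notSmall As Rt link λ {u} Ru → dom Ru (Nbr? u s) (Nbr? u t))
    where
    dom : ∀ {u} → R u → Dec (Nbr u s) → Dec (Nbr u t) → Nbr u s ⊎ Nbr u t
    dom Ru (yes a) _ = inj₁ a
    dom Ru (no _) (yes b) = inj₂ b
    dom Ru (no ¬a) (no ¬b) = ⊥-elim (¬any (_ , Ru , ¬a , ¬b))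

  -- Counting owners

  module _ {e ps} (lp : LP e ps) where

    T = preds ps
    T-unique : Unique T
    T-unique = preds-unique ps (unique-ps lp)

    Ts : List V
    Ts = without c T

    Ts-unique : Unique Ts
    Ts-unique = without-unique c T-unique

    X≤Ts : length (Xs lp) ≤ length Ts
    X≤Ts = s≤s⁻¹ (ℕₚ.≤-trans (ℕₚ.≤-reflexive (≡-sym (length-T lp))) (length≤suc-without c T-unique))

    X<Ts : c ∉ T → length (Xs lp) < length Ts
    X<Ts c∉ = ℕₚ.≤-trans (ℕₚ.≤-reflexive (≡-sym (length-T lp)))
      (unique-⊆⇒length≤ T-unique λ {t} t∈ → without⁺ t∈ λ { refl → c∉ t∈ })

    Owned : V → Set
    Owned t = ∃[ x ] Own lp x t

    owned? : ∀ t → Dec (Owned t)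
    owned? t = Finₚ.any? (λ x → Own? lp x t)

    count : ∀ ts zs → Unique ts → (∀ {t} → t ∈ ts → ∃[ z ] z ∈ zs × Own lp z t) → length ts ≤ length zs
    count ts zs u own = pigeonhole (Own lp) _≟_ ts zs u own (own-injective lp)

    data Ownership : Set where
      all-owned : (∀ {t} → t ∈ T → t ≢ c → Owned t) → Ownership
      unowned : ∀ {t} → t ∈ T → t ≢ c → (∀ {x} → ¬ Own lp x t) → Ownership

    ownership : Ownership
    ownership with All.all? owned? Ts
    ... | yes all = all-owned λ t∈ t≢c → All.lookup all (without⁺ t∈ t≢c)
    ... | no ¬all with find (Allₚ.¬All⇒Any¬ owned? Ts ¬all)
    ...   | t , t∈ , ¬owned with without⁻ {v = c} t∈
    ...     | t∈T , t≢c = unowned t∈T t≢c λ o → ¬owned (_ , o)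

    own∈ : ∀ {x t} → Own lp x t → x ∈ Xs lp
    own∈ o = X⇒∈Xs lp (Own.Xx o)

    -- Pairing the unowned `t` with another vertex of T must produce an owner of the latter. `zs` is
    -- any list that still holds an owner of each of these; shortening it shows which vertices of X
    -- are indispensable.
    unowned-count : ∀ {t} → t ∈ T → t ≢ c → (∀ {x} → ¬ Own lp x t) → ∀ zs →
      (∀ {x s} → Own lp x s → s ≢ c → ∃[ y ] y ∈ zs × Own lp y s) → length Ts ≤ suc (length zs)
    unowned-count {t} t∈ t≢c un zs own = ℕₚ.≤-trans (length≤suc-without t Ts-unique) (s≤s
        (count (without t Ts) zs (without-unique t Ts-unique) λ s∈ → case without⁻ {v = t} s∈ of λ where
          (s∈Ts , s≢t) → case without⁻ {v = c} s∈Ts of λ where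
            (s∈T , s≢c) → case unowned-arrow lp crit t∈ t≢c un s∈T s≢c (s≢t ∘ ≡-sym) of λ where
              (x , _ , o , _) → own o s≢c))

    Xs-without : ∀ {x} → X x → length (without x (Xs lp)) < length (Xs lp)
    Xs-without Xx = length-without< (X⇒∈Xs lp Xx)

    -- One of `a`, `b` dominates `h`. Neither is in K, so that one is in X and hence adjacent to
    -- `t`, which the pair was to miss.
    away-contra : ∀ {t a b} → t ∈ T → (∀ {x} → X x → x ~ t) → A a → R b → b ≡ a ⊎ a ~ b → ¬ Nbr t a → ¬ Nbr t b →
                  (∀ {u} → R u → u ≢ t → Nbr u a ⊎ Nbr u b) → ⊥
    away-contra {t} {a} {b} t∈ X~t Aa Rb link ¬ta ¬tb dom = go (dom Rh (T≢h lp t∈ ∘ ≡-sym))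
      where
      a-near : ∀ {k} → InK k → ¬ k ~ a
      a-near k∈ f = ¬ta (inj₂ (X~t (K-adj-ps k∈ f (A⊆ps₀ Aa))))
      b-out : ∀ {k} → InK k → b ≢ k
      b-out k∈ refl = [ (λ b≡a → proj₂ (K⇒Out k∈) (subst (_∈ ps₀) (≡-sym b≡a) (A⊆ps₀ Aa))) , a-near k∈ ∘ ~sym ]′ link
      go : Nbr h a ⊎ Nbr h b → ⊥
      go (inj₁ (inj₁ refl)) = h∉ps₀ (A⊆ps₀ Aa)
      go (inj₁ (inj₂ f)) = a-near h∈K (~sym f)
      go (inj₂ (inj₁ eq)) = b-out h∈K (≡-sym eq)
      go (inj₂ (inj₂ f)) = [ (λ b∈K → b-out b∈K refl) , (λ Xb → ¬tb (inj₂ (X~t Xb))) ]′ (K-adj h∈K (~sym f))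

    through-T : ∀ {t b} → c ∈ T → t ∈ T → (∀ {u} → R u → ¬ c ~ u → Nbr u t ⊎ Nbr u b) →
                ∀ {s} → s ∈ T → s ≢ c → s ≢ t → s ≡ b ⊎ b ~ s
    through-T c∈ t∈ dom s∈ s≢c s≢t with dom (T⇒R lp s∈ s≢c) (c∈T⇒ lp c∈ s∈ s≢c)
    ... | inj₁ (inj₁ eq) = ⊥-elim (s≢t eq)
    ... | inj₁ (inj₂ f) = ⊥-elim (T-indep lp t∈ s∈ (s≢t ∘ ≡-sym) f)
    ... | inj₂ nb = nb

    -- `t` cannot dominate `h`, so `b` does; and `b` is not in K because it dominates a further
    -- vertex of T.
    through-X : ∀ {t b} → c ∈ T → t ∈ T → (∀ {u} → R u → ¬ c ~ u → Nbr u t ⊎ Nbr u b) → X b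
    through-X {t} {b} c∈ t∈ dom with other-T lp crit t
    ... | s , s∈ , s≢t , s≢c = go (through-T c∈ t∈ dom s∈ s≢c s≢t) (dom Rh (λ f → h∉ps₀ (A⊆ps₀ (Rh , f))))
      where
      go : s ≡ b ⊎ b ~ s → Nbr h t ⊎ Nbr h b → X b
      go _ (inj₁ (inj₁ eq)) = ⊥-elim (T≢h lp t∈ (≡-sym eq))
      go _ (inj₁ (inj₂ f)) = ⊥-elim (T≁K lp t∈ h∈K f)
      go (inj₁ refl) (inj₂ (inj₁ eq)) = ⊥-elim (T≢h lp s∈ (≡-sym eq))
      go (inj₁ refl) (inj₂ (inj₂ f)) = ⊥-elim (T≁K lp s∈ h∈K f)
      go (inj₂ f) (inj₂ (inj₁ refl)) = ⊥-elim (T≁K lp s∈ h∈K (~sym f))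
      go (inj₂ f) (inj₂ (inj₂ g)) = [ (λ b∈K → ⊥-elim (T≁K lp s∈ b∈K (~sym f))) , id ]′ (K-adj h∈K (~sym g))

    -- Such an `x₀` owns nothing, so the rest of X must own all of T but the root and at most one
    -- vertex. The count allows this only if the root is in T, some `t` is unowned, and every other
    -- vertex of X is an owner; then the pair of `t` with the root fails.
    X-misses-T : ∀ {x} → X x → ¬ (∀ {t} → t ∈ T → x ~ t)
    X-misses-T {x₀} Xx₀ adj with ownership
    ... | all-owned own = ℕₚ.<⇒≱ (Xs-without Xx₀) (ℕₚ.≤-trans X≤Ts (count Ts _ Ts-unique λ t∈ →
            case without⁻ {v = c} t∈ of λ where
              (t∈T , t≢c) → case own t∈T t≢c of λ where
                (x , o) → x , without⁺ (own∈ o) (λ { refl → Own.x≁t o (adj t∈T) }) , o))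
    ... | unowned {t} t∈ t≢c un with c ∈? T
    ...   | no c∉ = ℕₚ.<⇒≱ (X<Ts c∉) (ℕₚ.≤-trans (unowned-count t∈ t≢c un (without x₀ (Xs lp)) λ {x} o _ →
              x , without⁺ (own∈ o) (λ { refl → Own.x≁t o (adj (Own.t∈T o)) }) , o) (Xs-without Xx₀))
    ...   | yes c∈ with rootPair (T⇒R lp t∈ t≢c) (c∈T⇒ lp c∈ t∈ t≢c)
    ...     | through {b} Rb link dom = notSmall Ab (T⇒R lp t∈ t≢c) (inj₂ (proj₁ (X-adj Xb))) all-dom
      where
      X-adj : ∀ {x} → X x → x ~ t × x ~ c
      -- Every vertex of X but `x₀` is needed as owner of a vertex other than `t` and the root,
      -- hence is adjacent to both.
      X-adj {x} Xx = decidable-stable (dec G x t ×-dec dec G x c) λ ¬both →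
        ℕₚ.<⇒≱ (length-without< {v = x} {xs = without x₀ (Xs lp)} (without⁺ (X⇒∈Xs lp Xx) λ { refl → ¬both (adj t∈ , adj c∈) }))
          (s≤s⁻¹ (ℕₚ.≤-trans (Xs-without Xx₀) (ℕₚ.≤-trans X≤Ts
            (unowned-count t∈ t≢c un (without x (without x₀ (Xs lp))) λ {y} {s} o s≢c →
              y , without⁺ (without⁺ (own∈ o) (λ { refl → Own.x≁t o (adj (Own.t∈T o)) }))
                    (λ { refl → ¬both (Own.rest o t∈ (λ { refl → un o }) , Own.rest o c∈ (s≢c ∘ ≡-sym)) }) , o))))
      Xb : X b
      Xb = through-X c∈ t∈ dom
      Ab : A b
      Ab = Rb , ~sym (proj₂ (X-adj Xb))
      all-dom : ∀ {u} → R u → Nbr u b ⊎ Nbr u t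
      all-dom {u} Ru with dec G c u
      ... | no c≁u = swap (dom Ru c≁u)
      ... | yes c~u with b ≟ u
      ...   | yes refl = inj₁ (inj₁ refl)
      ...   | no b≢u = inj₁ (inj₂ (clique Rb Ru (proj₂ Ab) c~u b≢u))
    X-misses-T {x₀} Xx₀ adj | unowned {t} t∈ t≢c un | yes c∈ | away Aa Rb link ¬ta ¬tb dom = away-contra t∈ X~t Aa Rb link ¬ta ¬tb dom
      where
      X~t : ∀ {x} → X x → x ~ t
      X~t {x} Xx = decidable-stable (dec G x t) λ ¬x~t →
        ℕₚ.<⇒≱ (length-without< {v = x} {xs = without x₀ (Xs lp)} (without⁺ (X⇒∈Xs lp Xx) λ { refl → ¬x~t (adj t∈) }))
          (s≤s⁻¹ (ℕₚ.≤-trans (Xs-without Xx₀) (ℕₚ.≤-trans X≤Ts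
            (unowned-count t∈ t≢c un (without x (without x₀ (Xs lp))) λ {y} {s} o s≢c →
              y , without⁺ (without⁺ (own∈ o) (λ { refl → Own.x≁t o (adj (Own.t∈T o)) }))
                    (λ { refl → ¬x~t (Own.rest o t∈ (λ { refl → un o })) }) , o))))

  -- Consecutive vertices of a path

  data Next (t w : V) : List V → Set where
    here : ∀ {vs} → Next t w (t ∷ w ∷ vs)
    there : ∀ {v vs} → Next t w vs → Next t w (v ∷ vs)

  next-++ʳ : ∀ {t w} xs {ys} → Next t w ys → Next t w (xs ++ ys)
  next-++ʳ [] nx = nx
  next-++ʳ (x ∷ xs) nx = there (next-++ʳ xs nx)

  next-++ˡ : ∀ {t w xs} ys → Next t w xs → Next t w (xs ++ ys)
  next-++ˡ ys here = here
  next-++ˡ ys (there nx) = there (next-++ˡ ys nx)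

  next-join : ∀ {a b t w xs ys} → Path a t xs → Path w b ys → Next t w (xs ++ ys)
  next-join [-] q with uncons q
  ... | _ , refl = here
  next-join (_ ∷ p) q = there (next-join p q)

  next-∈ˡ : ∀ {t w xs} → Next t w xs → t ∈ xs
  next-∈ˡ here = here refl
  next-∈ˡ (there nx) = there (next-∈ˡ nx)

  next-∈ʳ : ∀ {t w xs} → Next t w xs → w ∈ xs
  next-∈ʳ here = there (here refl)
  next-∈ʳ (there nx) = there (next-∈ʳ nx)

  next-pred : ∀ {t w xs} → Next t w xs → X w → t ∈ preds xs
  next-pred {w = w} here Xw with X? w
  ... | yes _ = here refl
  ... | no ¬Xw = ⊥-elim (¬Xw Xw)
  next-pred (there {vs = u ∷ _} nx) Xw with X? u
  ... | yes _ = there (next-pred nx Xw)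
  ... | no _ = next-pred nx Xw

  next-unique : ∀ {t w w′ xs} → Unique xs → Next t w xs → Next t w′ xs → w ≡ w′
  next-unique u here here = refl
  next-unique u here (there nx) = ⊥-elim (Uniqueₚ.Unique[x∷xs]⇒x∉xs u (next-∈ˡ nx))
  next-unique u (there nx) here = ⊥-elim (Uniqueₚ.Unique[x∷xs]⇒x∉xs u (next-∈ˡ nx))
  next-unique (_ ∷ u) (there nx) (there nx′) = next-unique u nx nx′

  next≢end : ∀ {a b t w xs} → Path a b xs → Unique xs → Next t w xs → t ≢ b
  next≢end (_ ∷ p) u here refl = Uniqueₚ.Unique[x∷xs]⇒x∉xs u (end∈ p)
  next≢end (_ ∷ p) (_ ∷ u) (there nx) eq = next≢end p u nx eq
  next≢end [-] u (there ()) eq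

  next≢start : ∀ {a b t w xs} → Path a b xs → Unique xs → Next t w xs → w ≢ a
  next≢start p u nx refl with uncons p | nx
  ... | _ , refl | here = Uniqueₚ.Unique[x∷xs]⇒x∉xs u (here refl)
  ... | _ , refl | there nx′ = Uniqueₚ.Unique[x∷xs]⇒x∉xs u (next-∈ʳ nx′)

  unsnoc : ∀ {a b xs} → Path a b xs → (a ≡ b × xs ≡ a ∷ []) ⊎ ∃[ y ] ∃[ ys ] Path a y ys × y ~ b × xs ≡ ys ++ b ∷ []
  unsnoc [-] = inj₁ (refl , refl)
  unsnoc (e ∷ p) with unsnoc p
  ... | inj₁ (refl , refl) = inj₂ (_ , _ , [-] , e , refl)
  ... | inj₂ (_ , _ , q , f , refl) = inj₂ (_ , _ , (e ∷ q) , f , refl)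

  module _ {e ps} (lp : LP e ps) where

    private p = proj₁ lp

    T-next : ∀ {t w} → t ∈ preds ps → Next t w ps → X w
    T-next t∈ nx with preds⇒Pos p t∈
    ... | last refl = ⊥-elim (next≢end p (unique-ps lp) nx refl)
    ... | pred q f Xx r refl = subst X (next-unique (unique-ps lp) (next-join q r) nx) Xx

    next⇒≢c : ∀ {t w} → Next t w ps → w ≢ c
    next⇒≢c = next≢start p (unique-ps lp)

    X-single : ∀ {x} → (∀ {y} → y ∈ ps → X y → y ≡ x) → ⊥
    X-single only with two-X lp crit
    ... | a , b , Xa , Xb , b≢a = b≢a (trans (only (∈ps lp (proj₁ Xb)) Xb) (≡-sym (only (∈ps lp (proj₁ Xa)) Xa)))

  First : V → List V → Set
  First z ps = ∃[ zs ] ps ≡ c ∷ z ∷ zs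

  first-unique : ∀ {y z ps} → First y ps → First z ps → y ≡ z
  first-unique (_ , refl) (_ , eq) = Listₚ.∷-injectiveˡ (Listₚ.∷-injectiveʳ eq)

  -- The root is not in T

  module _ {e ps} (lp : LP e ps) (c∉T : c ∉ preds ps) where

    private
      p = proj₁ lp
      ps↭ = proj₂ lp

    T≢c : ∀ {t} → t ∈ preds ps → t ≢ c
    T≢c t∈ refl = c∉T t∈

    record Source : Set where
      field
        τ : V
        τ∈ : τ ∈ preds ps
        τ-unowned : ∀ {x} → ¬ Own lp x τ

    abstract
      source : Source
      source with ownership lp
      ... | unowned t∈ t≢c un = record { τ = _ ; τ∈ = t∈ ; τ-unowned = un }
      ... | all-owned own = ⊥-elim (ℕₚ.<⇒≱ (X<Ts lp c∉T) (count lp (Ts lp) (Xs lp) (Ts-unique lp) λ t∈ →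
        case without⁻ {v = c} t∈ of λ where (t∈T , t≢c) → case own t∈T t≢c of λ where (x , o) → x , own∈ lp o , o))

    open Source source

    too-few : ∀ {x} → X x → (∀ {y s} → Own lp y s → ∃[ z ] z ∈ without x (Xs lp) × Own lp z s) → ⊥
    too-few Xx own = ℕₚ.<⇒≱ (X<Ts lp c∉T) (ℕₚ.≤-trans
      (unowned-count lp τ∈ (T≢c τ∈) τ-unowned (without _ (Xs lp)) (λ o _ → own o)) (Xs-without lp Xx))

    -- The count is exact once `τ` is set aside: a vertex of X that owns nothing could be dropped,
    -- and too few owners would remain.
    X-owns : ∀ {x} → X x → ∃[ s ] Own lp x s
    X-owns {x} Xx with Finₚ.any? (λ s → Own? lp x s)
    ... | yes r = r
    ... | no ¬any = ⊥-elim (too-few Xx λ o → _ , without⁺ (own∈ lp o) (λ { refl → ¬any (_ , o) }) , o)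

    X~τ : ∀ {x} → X x → x ~ τ
    X~τ Xx with X-owns Xx
    ... | s , o = Own.rest o τ∈ λ { refl → τ-unowned o }

    misses-once : ∀ {x t t′} → X x → t ∈ preds ps → ¬ x ~ t → t′ ∈ preds ps → t′ ≢ t → x ~ t′
    misses-once {x} {t} {t′} Xx t∈ ¬f t′∈ t′≢t with X-owns Xx
    ... | s , o = Own.rest o t′∈ λ t′≡s → t′≢t (trans t′≡s (≡-sym (own-exact lp o t∈ ¬f)))

    -- Two vertices of X that miss the same `t` would both own it, and one of them could be dropped.
    missed-once : ∀ {x x′ t} → X x → X x′ → x′ ≢ x → t ∈ preds ps → ¬ x ~ t → x′ ~ t
    missed-once {x} {x′} {t} Xx Xx′ x′≢x t∈ ¬f = decidable-stable (dec G x′ t) λ ¬f′ → too-few Xx′ λ {y} {s} o →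
      case y ≟ x′ of λ where
        (no y≢x′) → y , without⁺ (own∈ lp o) y≢x′ , o
        (yes refl) → x , without⁺ (X⇒∈Xs lp Xx) (x′≢x ∘ ≡-sym) ,
          (case X-owns Xx of λ where
            (r , o′) → subst (Own lp x) (trans (≡-sym (own-exact lp o′ t∈ ¬f)) (own-exact lp o t∈ ¬f′)) o′)

    -- Join `τ` to `w`. If `w` is the missed vertex, the middle vertex is in X and adjacent to all
    -- of T; if `τ` is, the middle vertex is in X and not adjacent to `τ`. Both are excluded.
    τ-dominates : ∀ {w} → w ∈ ps₀ → w ≢ c → w ∉ preds ps → τ ~ w
    τ-dominates {w} w∈ w≢c w∉ with X? w | dec G τ w
    ... | _ | yes f = f
    ... | yes Xw | _ = ~sym (X~τ Xw)
    ... | no ¬Xw | no ¬f with pair (T⇒R lp τ∈ (T≢c τ∈)) (ps₀⇒R w∈ w≢c) (λ { refl → w∉ τ∈ }) ¬f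
    ...   | arrow a with arrow-T lp τ∈ (T≢c τ∈) (λ { refl → h∉ps₀ w∈ }) a
    ...     | Xz , _ , all = ⊥-elim (X-misses-T lp Xz λ t∈ → all t∈ λ { refl → w∉ t∈ })
    τ-dominates {w} w∈ w≢c w∉ | no ¬Xw | no ¬f | arrow′ a =
      ⊥-elim (Arrow.z≁y a (X~τ (proj₁ (arrow-X lp w∈ ¬Xw (T≢h lp τ∈) a))))
    τ-dominates {w} w∈ w≢c w∉ | no ¬Xw | no ¬f | dom₂ d with d Rh
    ... | inj₁ (inj₁ eq) = ⊥-elim (T≢h lp τ∈ (≡-sym eq))
    ... | inj₁ (inj₂ f) = ⊥-elim (T≁K lp τ∈ h∈K f)
    ... | inj₂ (inj₁ refl) = ⊥-elim (h∉ps₀ w∈)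
    ... | inj₂ (inj₂ f) = ⊥-elim (¬Xw (K-adj-ps h∈K (~sym f) w∈))

    ∉T : ∀ {w w′} → Next w w′ ps → ¬ X w′ → w ∉ preds ps
    ∉T nx ¬X w∈ = ¬X (T-next lp w∈ nx)

    τ-next : ∀ {w w′} → w ≢ c → Next w w′ ps → ¬ X w′ → τ ~ w
    τ-next w≢c nx ¬X = τ-dominates (∈ps₀ lp (next-∈ˡ nx)) w≢c (∉T nx ¬X)

    -- Were z not the first vertex after the root, the path could be rerouted through z and τ so that it has room for a detour through K.
    module Locate {z : V} (Rz : R z) (z∈ : z ∈ ps) (¬Xz : ¬ X z) (z~T : ∀ {t} → t ∈ preds ps → z ~ t) where

      z∉T : z ∉ preds ps
      z∉T z∈T = irrefl G (z~T z∈T)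

      z-next : ∀ {w} → Next z w ps → ¬ X w
      z-next nx Xw = z∉T (next-pred nx Xw)

      e∈T : e ∈ preds ps
      e∈T = last∈preds p

      z≢ : ∀ {t} → t ∈ preds ps → z ≢ t
      z≢ t∈ refl = z∉T t∈

      -- As the segment avoids X, its first vertex is either `z` or is followed by a vertex outside
      -- X; in the latter case it is not in T, and `τ` dominates it.
      τ~head : ∀ {s ss} → Path s z ss → Avoids X? ss → (∀ {t u} → Next t u ss → Next t u ps) → s ≢ c → τ ~ s
      τ~head [-] av embed s≢c = ~sym (z~T τ∈)
      τ~head (f ∷ σ) (_ ∷ av) embed s≢c with uncons σ
      ... | _ , refl = τ-next s≢c (embed here) (All.head av)

      Conclusion : Set
      Conclusion = First z ps × ¬ c ~ τ

      from-root : ∀ {y as zs} → Path c y as → y ≡ c → ps ≡ (as ++ z ∷ []) ++ zs → First z ps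
      from-root [-] refl eq = _ , eq
      from-root {as = as} {zs} (e ∷ α) refl eq = ⊥-elim (Uniqueₚ.Unique[x∷xs]⇒x∉xs (subst Unique eq (unique-ps lp))
        (∈-++⁺ˡ {ys = zs} (∈-++⁺ˡ {ys = z ∷ []} (end∈ α))))

      -- `τ` dominates the predecessor `y` of `z` unless `y` is the root. So refuting τ ~ y yields
      -- both halves of the conclusion.
      before-z : ∀ {y as zs} → Path c y as → ps ≡ (as ++ z ∷ []) ++ zs → (τ ~ y → ⊥) → Conclusion
      before-z {y} {as} {zs} α eq bad with y ≟ c
      ... | yes refl = from-root α refl eq , λ c~τ → bad (~sym c~τ)
      ... | no y≢c = ⊥-elim (bad (τ-next y≢c (subst (Next y z) (≡-sym eq) (next-++ˡ zs (next-join α [-]))) ¬Xz))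

      perm : ∀ {xs ys} → xs ↭ ys → ps ≡ ys → xs ↭ ps
      perm r eq = ↭-trans r (↭-reflexive (≡-sym eq))

      not-last-X : ∀ {x} → X x → x ≢ e
      not-last-X Xx refl = T∩X lp e∈T Xx

      no-consecutive : ∀ {x y} → X x → Next x y ps → ¬ X y
      no-consecutive Xx nx Xy = T∩X lp (next-pred nx Xy) Xx

      module _ (τ≡e : τ ≡ e) {w as bs} (α : Path c z as) (zw : z ~ w) (β : Path w e bs) (eq : ps ≡ as ++ bs) where

        -- X occurs on both sides of `z`. Then the last vertex is not adjacent to `s` by
        -- `last≁succ`, although it is `τ` and dominates `s`.
        last-between : ∀ {x s xs ys t x′ us vs} → X x → Path c x xs → x ~ s → Path s z ys → Avoids X? ys → as ≡ xs ++ ys →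
                       X x′ → Path w t us → t ~ x′ → Path x′ e vs → bs ≡ us ++ vs → ⊥
        last-between {x} {s} {xs} {ys} {us = us} {vs} Xx μ f σ av refl Xx′ ρ g ε refl =
          last≁succ {bs = ys ++ us} lp μ (σ ⟨ zw ⟩ ρ) ε eq′ Xx Xx′ (subst (_~ s) τ≡e
            (τ~head σ av (λ nx → subst (Next _ _) (≡-sym eq) (next-++ˡ (us ++ vs) (next-++ʳ xs nx)))
              (next⇒≢c lp (subst (Next x s) (≡-sym eq) (next-++ˡ (us ++ vs) (next-join μ σ))))))
          where
          eq′ : ps ≡ xs ++ (ys ++ us) ++ vs
          eq′ = trans eq (trans (Listₚ.++-assoc xs ys (us ++ vs)) (cong (xs ++_) (≡-sym (Listₚ.++-assoc ys us vs))))

        -- X occurs only before `z`. With `x′` the previous vertex of X: c ... x′, K, x ... y, τ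
        -- back to w, z, t back to the successor of x′.
        last-after : ∀ {x s xs ys} → X x → Path c x xs → x ~ s → Path s z ys → Avoids X? ys → as ≡ xs ++ ys → Avoids X? bs → ⊥
        last-after {x} {s} {xs} {ys} Xx μ f σ av refl avb with unsnoc μ | unsnoc (f ∷ σ)
        ... | inj₁ (refl , _) | _ = X⇒≢c Xx refl
        ... | inj₂ _ | inj₁ (refl , _) = ¬Xz Xx
        ... | inj₂ (t , xs′ , μ′ , tx , refl) | inj₂ (y , πs , π , yz , eqπ) = go (last-in X? μ′ (T∩X lp t∈T))
          where
          eq₁ : ps ≡ (xs′ ++ πs ++ z ∷ []) ++ bs
          eq₁ = trans eq (cong (_++ bs) (trans (Listₚ.++-assoc xs′ (x ∷ []) ys) (cong (xs′ ++_) eqπ)))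
          t∈T : t ∈ preds ps
          t∈T = next-pred (subst (Next t x) (≡-sym eq) (next-++ˡ bs (next-++ˡ ys (next-join μ′ [-])))) Xx
          y≢c : y ≢ c
          y≢c refl = proj₂ (proj₂ (unique-++⁻ xs′ (subst Unique (trans eq₁ (Listₚ.++-assoc xs′ (πs ++ z ∷ []) bs)) (unique-ps lp))))
                     (start∈ μ′) (∈-++⁺ˡ {ys = bs} (∈-++⁺ˡ {ys = z ∷ []} (end∈ π)))
          y~τ : y ~ τ
          y~τ = ~sym (τ-next y≢c (subst (Next y z) (≡-sym eq₁) (next-++ˡ bs (next-++ʳ xs′ (next-join π [-])))) ¬Xz)
          go : LastIn X? c t xs′ → ⊥
          go (none avx) = X-single lp λ {v} v∈ Xv → case ∈-++⁻ _ (subst (v ∈_) eq v∈) of λ where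
            (inj₂ v∈bs) → ⊥-elim (All.lookup avb v∈bs Xv)
            (inj₁ v∈as) → case ∈-++⁻ (xs′ ++ x ∷ []) v∈as of λ where
              (inj₂ v∈ys) → ⊥-elim (All.lookup av v∈ys Xv)
              (inj₁ v∈xs) → case ∈-++⁻ xs′ v∈xs of λ where
                (inj₁ v∈xs′) → ⊥-elim (All.lookup avx v∈xs′ Xv)
                (inj₂ (here eq)) → eq
          go (at {x′} {s′} {κs} {θs} Xx′ κ g θ _ refl) =
            no-detour ⌊ κ ⌋ Xx′ Xx (⌊ π ⌋ ⟪ subst (y ~_) τ≡e y~τ ⟫ ⌊ β ⌋ʳ ⟪ ~sym zw ⟫ ⌊ [-] ⌋ ⟪ z~T t∈T ⟫ ⌊ θ ⌋ʳ) ps↭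
              (perm (solve 5 (λ κ θ π z b → (κ ⊕ (π ⊕ (b ⊕ (z ⊕ θ))) , ((κ ⊕ θ) ⊕ (π ⊕ z)) ⊕ b)) ↭-refl κs θs πs (z ∷ []) bs) eq₁)

        -- X occurs only after `z`. If τ ~ y: c ... y, τ back to x₂, K, x back to z, t₂ back to s.
        last-before : ∀ {y as′} → Path c y as′ → y ~ z → as ≡ as′ ++ z ∷ [] →
                      ∀ {t x us vs} → Path w t us → t ~ x → X x → Path x e vs → bs ≡ us ++ vs → Avoids X? as → Avoids X? us → Conclusion
        last-before α′ yz refl ρ g Xx [-] refl ava avu = ⊥-elim (not-last-X Xx refl)
        last-before {y} {as′} α′ yz refl {x = x} {us} ρ g Xx (_∷_ {w = s} {xs = vs} k ε) refl ava avu = go (first-in X? ε ¬Xs)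
          where
          ¬Xs : ¬ X s
          ¬Xs = no-consecutive Xx (subst (Next x s) (≡-sym eq) (next-++ʳ (as′ ++ z ∷ []) (next-++ʳ us (next-join [-] ε))))
          go : FirstIn X? s e vs → Conclusion
          go (none avv) = ⊥-elim (X-single lp λ {v} v∈ Xv → case ∈-++⁻ (as′ ++ z ∷ []) (subst (v ∈_) eq v∈) of λ where
            (inj₁ v∈as) → ⊥-elim (All.lookup ava v∈as Xv)
            (inj₂ v∈bs) → case ∈-++⁻ us v∈bs of λ where
              (inj₁ v∈us) → ⊥-elim (All.lookup avu v∈us Xv)
              (inj₂ (here eq)) → eq
              (inj₂ (there v∈vs)) → ⊥-elim (All.lookup avv v∈vs Xv))
          go (at {t₂} {x₂} {us₂} {vs₂} ρ₂ _ g₂ Xx₂ ε₂ refl) = before-z α′ eq λ τ~y →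
            no-detour (⌊ α′ ⌋ ⟪ ~sym (subst (_~ y) τ≡e τ~y) ⟫ ⌊ ε₂ ⌋ʳ) Xx₂ Xx
              (⌊ zw ∷ (ρ ⟨ g ⟩ [-]) ⌋ʳ ⟪ z~T t₂∈T ⟫ ⌊ ρ₂ ⌋ʳ) ps↭
              (perm (solve 6 (λ a z u x u₂ v₂ → ((a ⊕ v₂) ⊕ ((z ⊕ (u ⊕ x)) ⊕ u₂) , (a ⊕ z) ⊕ (u ⊕ (x ⊕ (u₂ ⊕ v₂))))) ↭-refl
                 as′ (z ∷ []) us (x ∷ []) us₂ vs₂) eq)
            where
            t₂∈T : t₂ ∈ preds ps
            t₂∈T = next-pred (subst (Next t₂ x₂) (≡-sym eq) (next-++ʳ (as′ ++ z ∷ []) (next-++ʳ us (there (next-join ρ₂ ε₂))))) Xx₂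

        source-last : Conclusion
        source-last with last-in X? α ¬Xz | first-in X? β (z-next (subst (Next z w) (≡-sym eq) (next-join α β))) | unsnoc α
        ... | at Xx μ f σ av eqa | at ρ _ g Xx′ ε eqb | _ = ⊥-elim (last-between Xx μ f σ av eqa Xx′ ρ g ε eqb)
        ... | at Xx μ f σ av eqa | none avb | _ = ⊥-elim (last-after Xx μ f σ av eqa avb)
        ... | none _ | _ | inj₁ (refl , _) = ⊥-elim (c∉R Rz)
        ... | none ava | at ρ avu g Xx ε eqb | inj₂ (_ , _ , α′ , yz , eqa) = last-before α′ yz eqa ρ g Xx ε eqb ava avu
        ... | none ava | none avb | _ = ⊥-elim (X-single lp {z} λ {v} v∈ Xv → case ∈-++⁻ as (subst (v ∈_) eq v∈) of λ where
            (inj₁ v∈as) → ⊥-elim (All.lookup ava v∈as Xv)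
            (inj₂ v∈bs) → ⊥-elim (All.lookup avb v∈bs Xv))

      module _ {x xs ys} (θ : Path c τ xs) (τx : τ ~ x) (Xx : X x) (ω : Path x e ys) (eq : ps ≡ xs ++ ys) where

        module _ {w ds bs} (δ : Path x z ds) (zw : z ~ w) (β : Path w e bs) (eqy : ys ≡ ds ++ bs) where

          eq₀ : ps ≡ xs ++ (ds ++ bs)
          eq₀ = trans eq (cong (xs ++_) eqy)

          c∉ys : c ∉ ds ++ bs
          c∉ys = proj₂ (proj₂ (unique-++⁻ xs (subst Unique eq₀ (unique-ps lp)))) (start∈ θ)

          module _ {xb s ms ss} (Xb : X xb) (M : Path x xb ms) (f : xb ~ s) (σ : Path s z ss) (av : Avoids X? ss) (eqd : ds ≡ ms ++ ss) where

            eq₁ : ps ≡ xs ++ ((ms ++ ss) ++ bs)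
            eq₁ = trans eq₀ (cong (λ l → xs ++ (l ++ bs)) eqd)

            τ~s : τ ~ s
            τ~s = τ~head σ av (λ nx → subst (Next _ _) (≡-sym eq₁) (next-++ʳ xs (next-++ˡ bs (next-++ʳ ms nx))))
                    (next⇒≢c lp (subst (Next xb s) (≡-sym eq₁) (next-++ʳ xs (next-++ˡ bs (next-join M σ)))))

            -- If x ~ t: c ... τ, s ... t, x ... xb, K, x′ ... e. Otherwise `x` has used up its one
            -- missing vertex and is adjacent to `e`: c ... τ, s ... e, x ... xb, K.
            after-between : ∀ {t x′ us vs} → Path w t us → t ~ x′ → X x′ → Path x′ e vs → bs ≡ us ++ vs → ⊥
            after-between {t} {x′} {us} {vs} ρ g Xx′ ε refl with dec G x t
            ... | yes k = no-detour (⌊ θ ⌋ ⟪ τ~s ⟫ ⌊ σ ⟨ zw ⟩ ρ ⌋ ⟪ ~sym k ⟫ ⌊ M ⌋) Xb Xx′ ⌊ ε ⌋ ps↭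
                    (perm (solve 5 (λ x m s u v → ((x ⊕ ((s ⊕ u) ⊕ m)) ⊕ v , x ⊕ ((m ⊕ s) ⊕ (u ⊕ v)))) ↭-refl xs ms ss us vs) eq₁)
            ... | no ¬k = no-exit (⌊ θ ⌋ ⟪ τ~s ⟫ ⌊ σ ⟨ zw ⟩ ρ ⟨ g ⟩ ε ⌋ ⟪ ~sym (misses-once Xx t∈T ¬k e∈T (e≢t)) ⟫ ⌊ M ⌋) Xb ps↭
                    (perm (solve 5 (λ x m s u v → (x ⊕ ((s ⊕ (u ⊕ v)) ⊕ m) , x ⊕ ((m ⊕ s) ⊕ (u ⊕ v)))) ↭-refl xs ms ss us vs) eq₁)
              where
              nx : Next t x′ ps
              nx = subst (Next t x′) (≡-sym eq₁) (next-++ʳ xs (next-++ʳ (ms ++ ss) (next-join ρ ε)))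
              t∈T : t ∈ preds ps
              t∈T = next-pred nx Xx′
              e≢t : e ≢ t
              e≢t refl = next≢end p (unique-ps lp) nx refl

            -- x misses the last vertex, so every other neighbour of K is adjacent to it.
            after-rotate : Avoids X? bs → ¬ x ~ e → xb ≡ x → ⊥
            after-rotate avb ¬k refl with another-X (X⇒R Xx) (X⇒≢h Xx)
            ... | x₁ , Xx₁ , x₁≢x with ∈-++⁻ xs (subst (x₁ ∈_) eq₁ (∈ps lp (proj₁ Xx₁)))
            ...   | inj₂ x₁∈ with ∈-++⁻ (ms ++ ss) x₁∈
            ...     | inj₂ x₁∈bs = All.lookup avb x₁∈bs Xx₁
            ...     | inj₁ x₁∈ds with ∈-++⁻ ms x₁∈ds
            ...       | inj₂ x₁∈ss = All.lookup av x₁∈ss Xx₁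
            ...       | inj₁ x₁∈ms = x₁≢x (closed-path M (proj₁ (unique-++⁻ ms (proj₁ (unique-++⁻ (ms ++ ss) (proj₁ (proj₂ (unique-++⁻ xs (subst Unique eq₁ (unique-ps lp))))))))) x₁∈ms)
            after-rotate avb ¬k refl | x₁ , Xx₁ , x₁≢x | inj₁ x₁∈xs with cut-before θ x₁∈xs | unsnoc δ
            ... | inj₁ eqc | _ = X⇒≢c Xx₁ eqc
            ... | inj₂ _ | inj₁ (refl , _) = ¬Xz Xx
            ... | inj₂ (_ , _ , _ , _ , _ , [-] , _) | inj₂ _ = T∩X lp τ∈ Xx₁
            ... | inj₂ (t₁ , ξs , _ , ξ , g , _∷_ {xs = ζs} k ζ , refl) | inj₂ (y , πs , π , yz , refl) =
              no-detour (⌊ ξ ⌋ ⟪ ~sym (z~T t₁∈T) ⟫ ⌊ zw ∷ β ⌋ ⟪ ~sym (missed-once Xx Xx₁ x₁≢x e∈T ¬k) ⟫ ⌊ [-] ⌋) Xx₁ Xx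
                (⌊ π ⌋ ⟪ ~sym τ~y ⟫ ⌊ ζ ⌋ʳ) ps↭
                (perm (solve 6 (λ ξ x ζ π z b → ((ξ ⊕ ((z ⊕ b) ⊕ x)) ⊕ (π ⊕ ζ) , (ξ ⊕ (x ⊕ ζ)) ⊕ ((π ⊕ z) ⊕ b))) ↭-refl
                   ξs (x₁ ∷ []) ζs πs (z ∷ []) bs) eq₀)
              where
              t₁∈T : t₁ ∈ preds ps
              t₁∈T = next-pred (subst (Next t₁ x₁) (≡-sym eq₀) (next-++ˡ _ (next-join ξ (k ∷ ζ)))) Xx₁
              τ~y : τ ~ y
              τ~y = τ-next (λ { refl → c∉ys (∈-++⁺ˡ (∈-++⁺ˡ (end∈ π))) })
                      (subst (Next y z) (≡-sym eq₀) (next-++ʳ (ξs ++ x₁ ∷ ζs) (next-++ˡ bs (next-join π [-])))) ¬Xz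

            after-last : Avoids X? bs → ⊥
            after-last avb with dec G x e | xb ≟ x
            ... | yes k | _ = no-exit (⌊ θ ⌋ ⟪ τ~s ⟫ ⌊ σ ⟨ zw ⟩ β ⌋ ⟪ ~sym k ⟫ ⌊ M ⌋) Xb ps↭
                    (perm (solve 4 (λ x m s b → (x ⊕ ((s ⊕ b) ⊕ m) , x ⊕ ((m ⊕ s) ⊕ b))) ↭-refl xs ms ss bs) eq₁)
            ... | no ¬k | no xb≢x = no-exit (⌊ θ ⌋ ⟪ τ~s ⟫ ⌊ σ ⟨ zw ⟩ β ⌋ ⟪ ~sym (missed-once Xx Xb xb≢x e∈T ¬k) ⟫ ⌊ M ⌋ʳ) Xx ps↭
                    (perm (solve 4 (λ x m s b → (x ⊕ ((s ⊕ b) ⊕ m) , x ⊕ ((m ⊕ s) ⊕ b))) ↭-refl xs ms ss bs) eq₁)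
            ... | no ¬k | yes eqb = after-rotate avb ¬k eqb

          source-before-z : ⊥
          source-before-z with last-in X? δ ¬Xz
          ... | none av = All.lookup av (start∈ δ) Xx
          ... | at Xb M f σ av eqd with first-in X? β (z-next (subst (Next z w) (≡-sym eq₀) (next-++ʳ xs (next-join δ β))))
          ...   | at ρ _ g Xx′ ε eqb = after-between Xb M f σ av eqd ρ g Xx′ ε eqb
          ...   | none avb = after-last Xb M f σ av eqd avb

        module _ {w as bs} (α : Path c z as) (zw : z ~ w) (β : Path w τ bs) (eqx : xs ≡ as ++ bs) where

          eq₂ : ps ≡ (as ++ bs) ++ ys
          eq₂ = trans eq (cong (_++ ys) eqx)

          -- Whether or not X meets the path between `z` and `τ`, an edge from `τ` to the
          -- predecessor of `z` would make a detour through K possible.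
          z-first : ∀ {y as′} → Path c y as′ → as ≡ as′ ++ z ∷ [] → Avoids X? as → Conclusion
          z-first {y} {as′} α′ refl ava with first-in X? β (z-next (subst (Next z w) (≡-sym eq₂) (next-++ˡ ys (next-join α β))))
          ... | at {xs = us} {vs} ρ _ g Xx₁ ε refl = before-z α′ (trans eq₂ (Listₚ.++-assoc (as′ ++ z ∷ []) (us ++ vs) ys)) λ τ~y →
                  no-detour (⌊ α′ ⌋ ⟪ ~sym τ~y ⟫ ⌊ ε ⌋ʳ) Xx₁ Xx (⌊ ω ⌋ ⟪ ~sym (z~T e∈T) ⟫ ⌊ zw ∷ ρ ⌋) ps↭
                    (perm (solve 5 (λ a z u v y → ((a ⊕ v) ⊕ (y ⊕ (z ⊕ u)) , ((a ⊕ z) ⊕ (u ⊕ v)) ⊕ y)) ↭-refl as′ (z ∷ []) us vs ys) eq₂)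
          ... | none avb = go ω refl
            where
            go : ∀ {zs} → Path x e zs → zs ≡ ys → Conclusion
            go [-] _ = ⊥-elim (not-last-X Xx refl)
            go (_∷_ {w = s} {xs = vs} k ε) eqz = go′ (first-in X? ε ¬Xs)
              where
              eq₃ : ps ≡ ((as′ ++ z ∷ []) ++ bs) ++ x ∷ vs
              eq₃ = trans eq₂ (cong (((as′ ++ z ∷ []) ++ bs) ++_) (≡-sym eqz))
              ¬Xs : ¬ X s
              ¬Xs = no-consecutive Xx (subst (Next x s) (≡-sym eq₃) (next-++ʳ ((as′ ++ z ∷ []) ++ bs) (next-join [-] ε)))
              go′ : FirstIn X? s e vs → Conclusion
              go′ (none avv) = ⊥-elim (X-single lp λ {v} v∈ Xv → case ∈-++⁻ ((as′ ++ z ∷ []) ++ bs) (subst (v ∈_) eq₃ v∈) of λ where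
                (inj₂ (here eq)) → eq
                (inj₂ (there v∈vs)) → ⊥-elim (All.lookup avv v∈vs Xv)
                (inj₁ v∈xs) → case ∈-++⁻ (as′ ++ z ∷ []) v∈xs of λ where
                  (inj₁ v∈as) → ⊥-elim (All.lookup ava v∈as Xv)
                  (inj₂ v∈bs) → ⊥-elim (All.lookup avb v∈bs Xv))
              go′ (at {xs = us₂} {vs₂} ρ₂ _ g₂ Xx₂ ε₂ refl) =
                before-z α′ (trans eq₃ (Listₚ.++-assoc (as′ ++ z ∷ []) bs (x ∷ us₂ ++ vs₂))) λ τ~y →
                no-detour (⌊ α′ ⌋ ⟪ ~sym τ~y ⟫ ⌊ β ⌋ʳ ⟪ ~sym zw ⟫ ⌊ [-] ⌋ ⟪ z~T e∈T ⟫ ⌊ ε₂ ⌋ʳ) Xx₂ Xx ⌊ k ∷ ρ₂ ⌋ ps↭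
                  (perm (solve 6 (λ a z b x u v → ((a ⊕ (b ⊕ (z ⊕ v))) ⊕ (x ⊕ u) , ((a ⊕ z) ⊕ b) ⊕ (x ⊕ (u ⊕ v)))) ↭-refl
                    as′ (z ∷ []) bs (x ∷ []) us₂ vs₂) eq₃)

          source-after-z : Conclusion
          source-after-z with last-in X? α ¬Xz | unsnoc α
          -- Reroute: c ... xb, K, x ... e, z back to s, τ back to w.
          ... | at {xb} {s} {ms} {ss} Xb μ f σ av refl | _ =
                ⊥-elim (no-detour ⌊ μ ⌋ Xb Xx (⌊ ω ⌋ ⟪ ~sym (z~T e∈T) ⟫ ⌊ σ ⌋ʳ ⟪ ~sym τ~s′ ⟫ ⌊ β ⌋ʳ) ps↭
                  (perm (solve 4 (λ m s b y → (m ⊕ (y ⊕ (s ⊕ b)) , ((m ⊕ s) ⊕ b) ⊕ y)) ↭-refl ms ss bs ys) eq₂))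
            where
            τ~s′ : τ ~ s
            τ~s′ = τ~head σ av (λ nx → subst (Next _ _) (≡-sym eq₂) (next-++ˡ ys (next-++ˡ bs (next-++ʳ ms nx))))
                    (next⇒≢c lp (subst (Next xb s) (≡-sym eq₂) (next-++ˡ ys (next-++ˡ bs (next-join μ σ)))))
          ... | none _ | inj₁ (refl , _) = ⊥-elim (c∉R Rz)
          ... | none ava | inj₂ (_ , _ , α′ , yz , eqa) = z-first α′ eqa ava

      locate : Conclusion
      locate with preds⇒Pos p τ∈
      ... | last τ≡e with cut-after p z∈
      ...   | inj₁ z≡e = ⊥-elim (z≢ e∈T z≡e)
      ...   | inj₂ (_ , _ , _ , α , zw , β , eq) = source-last τ≡e α zw β eq
      locate | pred {xs = xs} θ τx Xx ω eq with ∈-++⁻ xs (subst (z ∈_) eq z∈)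
      ... | inj₁ z∈xs with cut-after θ z∈xs
      ...   | inj₁ z≡τ = ⊥-elim (z≢ τ∈ z≡τ)
      ...   | inj₂ (_ , _ , _ , α , zw , β , eqx) = source-after-z θ τx Xx ω eq α zw β eqx
      locate | pred θ τx Xx ω eq | inj₂ z∈ys with cut-after ω z∈ys
      ...   | inj₁ z≡e = ⊥-elim (z≢ e∈T z≡e)
      ...   | inj₂ (_ , _ , _ , δ , zw , β , eqy) = ⊥-elim (source-before-z θ τx Xx ω eq δ zw β eqy)

  last-nbr∈ : ∀ {e ps v} → LP e ps → R v → e ~ v → v ∈ ps₀
  last-nbr∈ {v = v} (p , ps↭) Rv f with v ∈? ps₀
  ... | yes v∈ = v∈
  ... | no v∉ = ⊥-elim (tooLong (⌊ p ⌋ ⟪ f ⟫ ⌊ [-] ⌋) ps↭ (Permₚ.++-comm _ (v ∷ [])) ([] ∷ [])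
                  (λ { (here refl) → Rv , v∉ }) (s≤s z≤n))

  module _ {e ps} (lp : LP e ps) (c∉T : c ∉ preds ps) where

    private p = proj₁ lp
    open Source (source lp c∉T)

    τ≢c : τ ≢ c
    τ≢c = T≢c lp c∉T τ∈

    -- `z` is adjacent to the last vertex, so it is on the path; and it is not in X, since no vertex
    -- of X is adjacent to all of T.
    loc : ∀ {z} → R z → (∀ {t} → t ∈ preds ps → z ~ t) → First z ps × ¬ c ~ τ
    loc Rz z~T = Locate.locate lp c∉T Rz (∈ps lp (last-nbr∈ lp Rz (~sym (z~T (last∈preds p)))))
                   (λ Xz → X-misses-T lp Xz z~T) z~T

    -- Joining `τ` to `h` can only yield an arrow from `τ`, for a middle vertex that misses `τ`
    -- would lie in X.
    source-h : ∃[ z ] R z × (∀ {t} → t ∈ preds ps → z ~ t)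
    source-h with pair (T⇒R lp τ∈ τ≢c) Rh (T≢h lp τ∈) (T≁K lp τ∈ h∈K)
    ... | dom₂ d with other-T lp crit τ
    ...   | t , t∈ , t≢τ , t≢c with d (T⇒R lp t∈ t≢c)
    ...     | inj₁ (inj₁ eq) = ⊥-elim (t≢τ eq)
    ...     | inj₁ (inj₂ f) = ⊥-elim (T-indep lp τ∈ t∈ (t≢τ ∘ ≡-sym) f)
    ...     | inj₂ (inj₁ eq) = ⊥-elim (T≢h lp t∈ eq)
    ...     | inj₂ (inj₂ f) = ⊥-elim (T≁K lp t∈ h∈K (~sym f))
    source-h | arrow′ {z} a with Arrow.hits a
    ... | inj₁ Ah = ⊥-elim (h∉ps₀ (A⊆ps₀ Ah))
    ... | inj₂ Az with Arrow.link a
    ...   | inj₁ refl = ⊥-elim (h∉ps₀ (A⊆ps₀ Az))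
    ...   | inj₂ h~z = ⊥-elim (Arrow.z≁y a (X~τ lp c∉T (K-adj-ps h∈K h~z (A⊆ps₀ Az))))
    source-h | arrow {z} a = z , Rz , all
      where
      open Arrow a
      τ~z : τ ~ z
      τ~z with link
      ... | inj₂ f = f
      ... | inj₁ refl with other-T lp crit τ
      ...   | t , t∈ , t≢τ , t≢c with dom (T⇒R lp t∈ t≢c) (T≢h lp t∈)
      ...     | inj₁ (inj₁ eq) = ⊥-elim (t≢τ eq)
      ...     | inj₁ (inj₂ f) = ⊥-elim (T-indep lp τ∈ t∈ (t≢τ ∘ ≡-sym) f)
      ...     | inj₂ (inj₁ eq) = ⊥-elim (t≢τ eq)
      ...     | inj₂ (inj₂ f) = ⊥-elim (T-indep lp τ∈ t∈ (t≢τ ∘ ≡-sym) f)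
      all : ∀ {t} → t ∈ preds ps → z ~ t
      all {t} t∈ with t ≟ τ
      ... | yes refl = ~sym τ~z
      ... | no t≢τ with dom (T⇒R lp t∈ (T≢c lp c∉T t∈)) (T≢h lp t∈)
      ...   | inj₁ (inj₁ eq) = ⊥-elim (t≢τ eq)
      ...   | inj₁ (inj₂ f) = ⊥-elim (T-indep lp τ∈ t∈ (t≢τ ∘ ≡-sym) f)
      ...   | inj₂ (inj₁ refl) = ⊥-elim (T-indep lp τ∈ t∈ (t≢τ ∘ ≡-sym) τ~z)
      ...   | inj₂ (inj₂ f) = f

    c≁τ : ¬ c ~ τ
    c≁τ with source-h
    ... | z , Rz , z~T = proj₂ (loc Rz z~T)

    record Owner (t : V) : Set where
      field
        x : V
        arr : Arrow τ t x
        own : Own lp x t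
        Ax : A x

    owner : ∀ {t} → t ∈ preds ps → t ≢ τ → Owner t
    owner t∈ t≢τ with unowned-arrow lp crit τ∈ τ≢c τ-unowned t∈ (T≢c lp c∉T t∈) (t≢τ ∘ ≡-sym)
    ... | x , a , o , _ with Arrow.hits a
    ...   | inj₁ (_ , c~τ) = ⊥-elim (c≁τ c~τ)
    ...   | inj₂ Ax = record { x = x ; arr = a ; own = o ; Ax = Ax }

    -- The arrow from `τ` gives each owned vertex an owner in A, and no vertex has two owners.
    X⊆A : ∀ {x} → X x → A x
    X⊆A {x} Xx with X-owns lp c∉T Xx
    ... | s , o with owner (Own.t∈T o) (λ { refl → τ-unowned o })
    ...   | w with Owner.x w ≟ x
    ...     | yes eq = subst A eq (Owner.Ax w)
    ...     | no ≢x = ⊥-elim (Own.x≁t (Owner.own w) (missed-once lp c∉T Xx (Own.Xx (Owner.own w)) ≢x (Own.t∈T o) (Own.x≁t o)))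

    c≁T : ∀ {t} → t ∈ preds ps → ¬ c ~ t
    c≁T {t} t∈ c~t with t ≟ τ
    ... | yes refl = c≁τ c~t
    ... | no t≢τ with owner t∈ t≢τ
    ...   | w = Own.x≁t (Owner.own w) (clique (proj₁ (Owner.Ax w)) (T⇒R lp t∈ (T≢c lp c∉T t∈)) (proj₂ (Owner.Ax w)) c~t
                  λ { refl → T∩X lp t∈ (Own.Xx (Owner.own w)) })

    -- In the other outcome some `x` adjacent to `h` owns `t`. Let `x′` own a third vertex `l`. A
    -- vertex missed by both `x` and `x′` must be a neighbour of `h` and of `τ`, so it lies in X,
    -- hence in the clique A together with `x`.
    to-h-arrow : ∀ {t} → t ∈ preds ps → ∃[ z ] Arrow t h z × A z × (∀ {s} → s ∈ preds ps → z ~ s)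
    to-h-arrow {t} t∈ with h-pair lp crit t∈ (T≢c lp c∉T t∈) (c≁T t∈)
    ... | to-h a Az _ z~T = _ , a , Az , z~T
    ... | to-t {x} a Ax o h~x with unique-length> {ys = t ∷ τ ∷ []} (preds-unique ps (unique-ps lp))
                                     (ℕₚ.≤-trans (s≤s (2≤X lp crit)) (ℕₚ.≤-reflexive (≡-sym (length-T lp))))
    ...   | l , l∈ , l∉ = ⊥-elim (go (notSmall′ Ax (proj₁ (Owner.Ax w)) (inj₂ (A-clique Ax (Owner.Ax w) x≢x′))))
      where
      w = owner l∈ (λ eq → l∉ (there (here eq)))
      x′ = Owner.x w
      x≢x′ : x ≢ x′
      x≢x′ eq = l∉ (here (own-injective lp (Owner.own w) (subst (λ v → Own lp v t) eq o)))
      go : (∃[ u ] R u × ¬ Nbr u x × ¬ Nbr u x′) → ⊥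
      go (u , Ru , ¬ux , ¬ux′) with Arrow.dom a Ru (λ { refl → ¬ux′ (inj₂ (Own.rest (Owner.own w) t∈ λ eq → l∉ (here (≡-sym eq)))) })
      ... | inj₂ nb = ¬ux nb
      ... | inj₁ (inj₁ refl) = ¬ux (inj₂ (~sym h~x))
      ... | inj₁ (inj₂ h~u) with Arrow.dom (Owner.arr w) Ru (λ { refl → ¬ux (inj₂ (Own.rest o l∈ λ eq → l∉ (here eq))) })
      ...   | inj₂ nb = ¬ux′ nb
      ...   | inj₁ (inj₁ refl) = T≁K lp τ∈ h∈K (~sym h~u)
      ...   | inj₁ (inj₂ τ~u) with K-adj h∈K h~u
      ...     | inj₁ u∈K = T≁K lp τ∈ u∈K τ~u
      ...     | inj₂ Xu = ¬ux (inj₂ (A-clique Ax (X⊆A Xu) λ { refl → ¬ux (inj₁ refl) }))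

    -- By `loc` all arrows into `h` have as middle vertex the first vertex `z` after the root. A
    -- vertex missed by `z` and by an owner `x` is therefore adjacent to every vertex of T, so by
    -- `loc` it is `z` itself.
    root∉T⇒⊥ : ⊥
    root∉T⇒⊥ with to-h-arrow τ∈ | other-T lp crit τ
    ... | z , a , Az , z~T | l , l∈ , l≢τ , _ = go (notSmall′ Az (proj₁ (Owner.Ax w)) (inj₂ (A-clique Az (Owner.Ax w) z≢x)))
      where
      w = owner l∈ l≢τ
      x = Owner.x w
      z≢x : z ≢ x
      z≢x refl = Own.x≁t (Owner.own w) (z~T l∈)
      x~h : x ~ h
      x~h = proj₂ (proj₂ (arrow-X lp (T⇒∈ps₀ lp τ∈) (T∩X lp τ∈) (T≢h lp l∈) (Owner.arr w)))
      z-arrow : ∀ {t} → t ∈ preds ps → Arrow t h z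
      z-arrow {t} t∈ with to-h-arrow t∈
      ... | z′ , a′ , Az′ , z′~T = subst (Arrow t h) (first-unique (proj₁ (loc (proj₁ Az′) z′~T)) (proj₁ (loc (proj₁ Az) z~T))) a′
      go : (∃[ u ] R u × ¬ Nbr u z × ¬ Nbr u x) → ⊥
      go (u , Ru , ¬uz , ¬ux) = ¬uz (inj₁ (first-unique (proj₁ (loc Ru u~T)) (proj₁ (loc (proj₁ Az) z~T))))
        where
        u~T : ∀ {t} → t ∈ preds ps → u ~ t
        u~T t∈ with Arrow.dom (z-arrow t∈) Ru (λ { refl → ¬ux (inj₂ x~h) })
        ... | inj₁ (inj₁ refl) = ⊥-elim (¬uz (inj₂ (z~T t∈)))
        ... | inj₁ (inj₂ f) = ~sym f
        ... | inj₂ nb = ⊥-elim (¬uz nb)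

  -- The root is in T, so the path starts with a vertex of X

  module Start {e ps x₁ ys} (lp : LP e ps) (c~x₁ : c ~ x₁) (Xx₁ : X x₁) (ω : Path x₁ e ys) (eq : ps ≡ c ∷ ys) where

    private
      p = proj₁ lp
      ps↭ = proj₂ lp

    e∈T : e ∈ preds ps
    e∈T = last∈preds p

    c∈T : c ∈ preds ps
    c∈T = subst (λ l → c ∈ preds l) (≡-sym eq) (pred∈preds [-] Xx₁ ω)

    c∉ys : c ∉ ys
    c∉ys = Uniqueₚ.Unique[x∷xs]⇒x∉xs (subst Unique eq (unique-ps lp))

    e≢c : e ≢ c
    e≢c refl = c∉ys (end∈ ω)

    -- Starting the path at a vertex of A outside X leads back to the first case.
    reroute : ∀ {z} → A z → ¬ X z → ¬ x₁ ~ e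
    reroute {z} Az ¬Xz f with subst (z ∈_) eq (∈ps lp (A⊆ps₀ Az))
    ... | here refl = c∉R (proj₁ Az)
    ... | there z∈ys with cut-after ω z∈ys
    ...   | inj₁ refl = c∈T⇒ lp c∈T e∈T e≢c (proj₂ Az)
    ...   | inj₂ (w , as , bs , α , zw , β , eqy) = root∉T⇒⊥ lp′ c∉T′
      where
      q : Path c w (c ∷ reverse as ++ reverse bs)
      q = proj₂ Az ∷ (reverseᵖ α ⟨ f ⟩ reverseᵖ β)
      lp′ : LP w (c ∷ reverse as ++ reverse bs)
      lp′ = q , ↭-trans (Permₚ.++⁺ (↭-refl {x = c ∷ []}) (Permₚ.++⁺ (Permₚ.↭-reverse as) (Permₚ.↭-reverse bs)))
                  (↭-trans (↭-reflexive (≡-sym (trans eq (cong (c ∷_) eqy)))) ps↭)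
      c∉T′ : c ∉ preds (c ∷ reverse as ++ reverse bs)
      c∉T′ c∈ = ¬Xz (T-next lp′ c∈ (next-join [-] (reverseᵖ α ⟨ f ⟩ reverseᵖ β)))

  module At {e ps x₁ ys} (lp : LP e ps) (c~x₁ : c ~ x₁) (Xx₁ : X x₁) (ω : Path x₁ e ys) (eq : ps ≡ c ∷ ys) where

    open Start lp c~x₁ Xx₁ ω eq public

    private
      p = proj₁ lp
      ps↭ = proj₂ lp

    not-last-X : ∀ {x} → X x → x ≢ e
    not-last-X Xx refl = T∩X lp e∈T Xx

    no-consecutive : ∀ {x y} → X x → Next x y ps → ¬ X y
    no-consecutive Xx nx Xy = T∩X lp (next-pred nx Xy) Xx

    perm : ∀ {xs zs} → xs ↭ zs → ps ≡ zs → xs ↭ ps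
    perm r eq = ↭-trans r (↭-reflexive (≡-sym eq))

    -- An arrow in the other direction misses only `w`, which is not in T, so its middle vertex
    -- would be in X and adjacent to all of T.
    out-pair : ∀ {t w} → t ∈ preds ps → t ≢ c → w ∈ ps₀ → w ≢ c → ¬ X w → w ∉ preds ps → ¬ t ~ w →
               ∃[ x ] Arrow w t x × X x × w ~ x
    out-pair t∈ t≢c w∈ w≢c ¬Xw w∉ ¬f with pair (T⇒R lp t∈ t≢c) (ps₀⇒R w∈ w≢c) (λ { refl → w∉ t∈ }) ¬f
    ... | arrow a with arrow-T lp t∈ t≢c (λ { refl → h∉ps₀ w∈ }) a
    ...   | Xz , _ , all = ⊥-elim (X-misses-T lp Xz λ s∈ → all s∈ λ { refl → w∉ s∈ })
    out-pair t∈ t≢c w∈ w≢c ¬Xw w∉ ¬f | arrow′ a with arrow-X lp w∈ ¬Xw (T≢h lp t∈) a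
    ...   | Xz , w~z , _ = _ , a , Xz , w~z
    out-pair t∈ t≢c w∈ w≢c ¬Xw w∉ ¬f | dom₂ d with d Rh
    ... | inj₁ (inj₁ eq) = ⊥-elim (T≢h lp t∈ (≡-sym eq))
    ... | inj₁ (inj₂ f) = ⊥-elim (T≁K lp t∈ h∈K f)
    ... | inj₂ (inj₁ refl) = ⊥-elim (h∉ps₀ w∈)
    ... | inj₂ (inj₂ f) = ⊥-elim (¬Xw (K-adj-ps h∈K (~sym f) w∈))

    -- In `three` the end of the path may meet X again; only the segment between x₂ and x₃ is
    -- required to avoid it.
    data Shape : Set where
      two : ∀ {s₁ t₂ x₂ s₂ us vs} → Path s₁ t₂ us → Avoids X? us → x₁ ~ s₁ → t₂ ~ x₂ → X x₂ → x₂ ~ s₂ → Path s₂ e vs → Avoids X? vs →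
            ps ≡ c ∷ x₁ ∷ us ++ x₂ ∷ vs → Shape
      three : ∀ {s₁ t₂ x₂ s₂ t₃ x₃ us vs ws} → Path s₁ t₂ us → x₁ ~ s₁ → t₂ ~ x₂ → X x₂ → x₂ ~ s₂ →
              Path s₂ t₃ vs → Avoids X? vs → t₃ ~ x₃ → X x₃ → Path x₃ e ws → ps ≡ c ∷ x₁ ∷ us ++ x₂ ∷ vs ++ ws → Shape

    shape : Shape
    shape = go₁ ω eq
      where
      go₂ : ∀ {s₁ t₂ x₂ us vs} → Path s₁ t₂ us → Avoids X? us → x₁ ~ s₁ → t₂ ~ x₂ → X x₂ → Path x₂ e vs → ps ≡ c ∷ x₁ ∷ us ++ vs → Shape
      go₂ ρ av f g Xx₂ [-] eq = ⊥-elim (not-last-X Xx₂ refl)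
      go₂ {us = us} ρ av f g Xx₂ (k ∷ ε) eq
        with first-in X? ε (no-consecutive Xx₂ (subst (Next _ _) (≡-sym eq) (there (there (next-++ʳ us (next-join [-] ε))))))
      ... | none avv = two ρ av f g Xx₂ k ε avv eq
      ... | at ρ₂ av₂ g₂ Xx₃ ε₂ refl = three ρ f g Xx₂ k ρ₂ av₂ g₂ Xx₃ ε₂ eq
      go₁ : ∀ {zs} → Path x₁ e zs → ps ≡ c ∷ zs → Shape
      go₁ [-] eq = ⊥-elim (not-last-X Xx₁ refl)
      go₁ (f ∷ ω′) eq
        with first-in X? ω′ (no-consecutive Xx₁ (subst (Next _ _) (≡-sym eq) (there (next-join [-] ω′))))
      ... | none av = ⊥-elim (X-single lp λ {v} v∈ Xv → case subst (v ∈_) eq v∈ of λ where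
              (here refl) → ⊥-elim (X⇒≢c Xv refl)
              (there (here eq)) → eq
              (there (there v∈′)) → ⊥-elim (All.lookup av v∈′ Xv))
      ... | at ρ av g Xx₂ ε refl = go₂ ρ av f g Xx₂ ε eq

    -- The path c, x₁ ... x₂, e back to s₂ ends at s₂, so `reroute` forbids x₁ ~ s₂. But if s₂ is in
    -- T, `x₁` is adjacent to it as owner of `e`; if not, the third vertex of X makes e and s₂
    -- non-adjacent, and joining them produces x₁ ~ s₂.
    x₁-own-contra : (∀ {x} → X x → ¬ x ~ e → x ≡ x₁) → Own lp x₁ e → ∀ {z} → A z → ¬ X z →
      ∀ {s₁ t₂ x₂ s₂ t₃ x₃ us vs ws} → Path s₁ t₂ us → x₁ ~ s₁ → t₂ ~ x₂ → X x₂ → x₂ ~ s₂ →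
      Path s₂ t₃ vs → Avoids X? vs → t₃ ~ x₃ → X x₃ → Path x₃ e ws → ps ≡ c ∷ x₁ ∷ us ++ x₂ ∷ vs ++ ws → ⊥
    x₁-own-contra only o Az ¬Xz {x₂ = x₂} {s₂ = s₂} {us = us} {vs} {ws} ρ f g Xx₂ k ρ₂ av₂ g₂ Xx₃ ε eq₃ = go (s₂ ∈? preds ps)
      where
      nx : Next x₂ s₂ ps
      nx = subst (Next x₂ s₂) (≡-sym eq₃) (there (there (next-++ʳ us (next-join [-] (ρ₂ ⟨ g₂ ⟩ ε)))))
      x₂≢x₁ : x₂ ≢ x₁
      x₂≢x₁ refl = proj₂ (proj₂ (unique-++⁻ (c ∷ x₁ ∷ us) (subst Unique eq₃ (unique-ps lp)))) (there (here refl)) (here refl)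
      x₂~e : x₂ ~ e
      x₂~e = decidable-stable (dec G x₂ e) λ ¬f → x₂≢x₁ (only Xx₂ ¬f)
      q : Path x₁ s₂ (x₁ ∷ us ++ x₂ ∷ reverse (vs ++ ws))
      q = f ∷ (ρ ⟨ g ⟩ x₂~e ∷ reverseᵖ (ρ₂ ⟨ g₂ ⟩ ε))
      lp′ : LP s₂ (c ∷ x₁ ∷ us ++ x₂ ∷ reverse (vs ++ ws))
      lp′ = c~x₁ ∷ q , ↭-trans (Permₚ.++⁺ˡ (c ∷ x₁ ∷ us) (Permₚ.++⁺ˡ (x₂ ∷ []) (Permₚ.↭-reverse (vs ++ ws))))
              (↭-trans (↭-reflexive (≡-sym eq₃)) ps↭)
      s₂≢e : s₂ ≢ e
      s₂≢e refl = proj₂ (proj₂ (unique-++⁻ (c ∷ x₁ ∷ us ++ x₂ ∷ vs) (subst Unique (trans eq₃ (cong (λ l → c ∷ x₁ ∷ l) (≡-sym (Listₚ.++-assoc us (x₂ ∷ vs) ws)))) (unique-ps lp))))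
        (there (there (∈-++⁺ʳ us (there (start∈ ρ₂))))) (end∈ ε)
      e≁s₂ : ¬ e ~ s₂
      e≁s₂ = last≁succ {xs = c ∷ x₁ ∷ us ++ x₂ ∷ []} lp (c~x₁ ∷ f ∷ (ρ ⟨ g ⟩ [-])) ρ₂ ε
        (trans eq₃ (cong (λ l → c ∷ x₁ ∷ l) (≡-sym (Listₚ.++-assoc us (x₂ ∷ []) (vs ++ ws))))) Xx₂ Xx₃
      x₁≁s₂ : ¬ x₁ ~ s₂
      x₁≁s₂ = Start.reroute lp′ c~x₁ Xx₁ q refl Az ¬Xz
      go : Dec (s₂ ∈ preds ps) → ⊥
      go (yes s₂∈) = x₁≁s₂ (Own.rest o s₂∈ s₂≢e)
      go (no s₂∉) with out-pair e∈T e≢c (∈ps₀ lp (next-∈ʳ nx)) (next⇒≢c lp nx) (no-consecutive Xx₂ nx) s₂∉ e≁s₂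
      ... | x , a , Xx , s₂~x with only Xx (Arrow.z≁y a)
      ...   | refl = x₁≁s₂ (~sym s₂~x)

  module _ {e ps x₁ ys} (lp : LP e ps) (c~x₁ : c ~ x₁) (Xx₁ : X x₁) (ω : Path x₁ e ys) (eq : ps ≡ c ∷ ys) where

    open At lp c~x₁ Xx₁ ω eq

    private
      p = proj₁ lp
      ps↭ = proj₂ lp

    c≁T′ : ∀ {t} → t ∈ preds ps → t ≢ c → ¬ c ~ t
    c≁T′ = c∈T⇒ lp c∈T

    -- The middle vertex of an arrow from a vertex of T to h
    record Free : Set where
      field
        z : V
        Az : A z
        z~T : ∀ {t} → t ∈ preds ps → z ~ t

      ¬Xz : ¬ X z
      ¬Xz Xz = X-misses-T lp Xz z~T

      z∉T : z ∉ preds ps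
      z∉T z∈ = irrefl G (z~T z∈)

      z∈ys : z ∈ ys
      z∈ys with subst (z ∈_) eq (∈ps lp (A⊆ps₀ Az))
      ... | here z≡c = ⊥-elim (R⇒≢c (proj₁ Az) z≡c)
      ... | there z∈ = z∈

      x₁≁e : ¬ x₁ ~ e
      x₁≁e = reroute Az ¬Xz

      z-next : ∀ {w} → Next z w ps → ¬ X w
      z-next nx Xw = z∉T (next-pred nx Xw)

      z≢ : ∀ {t} → t ∈ preds ps → z ≢ t
      z≢ t∈ refl = z∉T t∈

      head∉T : ∀ {s ss} → Path s z ss → Avoids X? ss → (∀ {t u} → Next t u ss → Next t u ps) → s ∉ preds ps
      head∉T [-] av embed s∈ = z∉T s∈
      head∉T (f ∷ σ) (_ ∷ av) embed s∈ with uncons σ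
      ... | _ , refl = All.head av (T-next lp s∈ (embed here))

    module Shapes (F : Free) (only : ∀ {x} → X x → ¬ x ~ e → x ≡ x₁) (own₁ : Own lp x₁ e) where
      open Free F

      -- X consists of `x₁`, which already owns `e`, and of `x₂`, which is adjacent to `t₂`.
      t₂-unowned : ∀ {t₂ x₂ us vs} → Path x₁ t₂ (x₁ ∷ us) → t₂ ~ x₂ → X x₂ → Avoids X? us → Avoids X? vs → Path x₂ e (x₂ ∷ vs) →
                   ps ≡ c ∷ x₁ ∷ us ++ x₂ ∷ vs → (t₂ ∈ preds ps × t₂ ≢ c) × t₂ ≢ e × (∀ {x} → ¬ Own lp x t₂)
      t₂-unowned {t₂} {x₂} {us} {vs} ρ g Xx₂ avu avv ε eq′ = (t₂∈ , t₂≢c) , t₂≢e , unown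
        where
        t₂∈ : t₂ ∈ preds ps
        t₂∈ = subst (λ l → t₂ ∈ preds l) (≡-sym eq′) (pred∈preds (c~x₁ ∷ ρ) Xx₂ ε)
        disj = proj₂ (proj₂ (unique-++⁻ (c ∷ x₁ ∷ us) (subst Unique eq′ (unique-ps lp))))
        t₂≢c : t₂ ≢ c
        t₂≢c refl = Uniqueₚ.Unique[x∷xs]⇒x∉xs (subst Unique eq′ (unique-ps lp)) (∈-++⁺ˡ (end∈ ρ))
        t₂≢e : t₂ ≢ e
        t₂≢e refl = disj (there (end∈ ρ)) (end∈ ε)
        which : ∀ {v} → v ∈ c ∷ x₁ ∷ us ++ x₂ ∷ vs → X v → v ≡ x₁ ⊎ v ≡ x₂
        which (here refl) Xv = ⊥-elim (X⇒≢c Xv refl)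
        which (there (here eq)) Xv = inj₁ eq
        which (there (there v∈)) Xv with ∈-++⁻ us v∈
        ... | inj₁ v∈us = ⊥-elim (All.lookup avu v∈us Xv)
        ... | inj₂ (here eq) = inj₂ eq
        ... | inj₂ (there v∈vs) = ⊥-elim (All.lookup avv v∈vs Xv)
        unown : ∀ {x} → ¬ Own lp x t₂
        unown {x} o with which (subst (x ∈_) eq′ (∈ps lp (proj₁ (Own.Xx o)))) (Own.Xx o)
        ... | inj₁ refl = t₂≢e (own-injective lp o own₁)
        ... | inj₂ refl = Own.x≁t o (~sym g)

      two-neighbours : (∀ {s₁ t₂ x₂ s₂ us vs} → Path s₁ t₂ us → Avoids X? us → x₁ ~ s₁ → t₂ ~ x₂ → X x₂ → x₂ ~ s₂ → Path s₂ e vs → Avoids X? vs →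
                        ps ≡ c ∷ x₁ ∷ us ++ x₂ ∷ vs → (t₂ ∈ preds ps × t₂ ≢ c) → t₂ ≢ e → (∀ {x} → ¬ Own lp x t₂) → ⊥) → ⊥
      two-neighbours k with shape
      ... | three ρ f g Xx₂ l ρ₂ av g₂ Xx₃ ε eq₃ = x₁-own-contra only own₁ Az ¬Xz ρ f g Xx₂ l ρ₂ av g₂ Xx₃ ε eq₃
      ... | two ρ av f g Xx₂ l ε avv eq₂ with t₂-unowned (f ∷ ρ) g Xx₂ av avv (l ∷ ε) eq₂
      ...   | t₂∈ , t₂≢e , un = k ρ av f g Xx₂ l ε avv eq₂ t₂∈ t₂≢e un

    module AllOwned (own : ∀ {t} → t ∈ preds ps → t ≢ c → Owned lp t) where

      -- T minus the root has at least |X| vertices, all owned: no vertex of X can be spared.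
      few : ∀ {x} → X x → (∀ {y t} → Own lp y t → t ≢ c → ∃[ z ] z ∈ without x (Xs lp) × Own lp z t) → ⊥
      few {x} Xx f = ℕₚ.<⇒≱ (Xs-without lp Xx) (ℕₚ.≤-trans (X≤Ts lp) (count lp (Ts lp) (without x (Xs lp)) (Ts-unique lp) λ t∈ →
        case without⁻ {v = c} t∈ of λ where (t∈T , t≢c) → case own t∈T t≢c of λ where (y , o) → f o t≢c))

      X-owns₂ : ∀ {x} → X x → ∃[ t ] t ≢ c × Own lp x t
      X-owns₂ {x} Xx with Finₚ.any? (λ t → ¬? (t ≟ c) ×-dec Own? lp x t)
      ... | yes r = r
      ... | no ¬any = ⊥-elim (few Xx λ {y} {t} o t≢c → y , without⁺ (own∈ lp o) (λ { refl → ¬any (t , t≢c , o) }) , o)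

      own-of : ∀ {x t} → X x → t ∈ preds ps → ¬ x ~ t → t ≢ c × Own lp x t
      own-of {x} Xx t∈ ¬f with X-owns₂ Xx
      ... | s , s≢c , o with own-exact lp o t∈ ¬f
      ...   | refl = s≢c , o

      same-owner : ∀ {x x′ t} → X x → X x′ → t ∈ preds ps → ¬ x ~ t → ¬ x′ ~ t → x ≡ x′
      same-owner {x} {x′} {t} Xx Xx′ t∈ ¬f ¬f′ = decidable-stable (x ≟ x′) λ x≢x′ → few Xx′ λ {y} {s} o s≢c → case y ≟ x′ of λ where
        (no y≢x′) → y , without⁺ (own∈ lp o) y≢x′ , o
        (yes refl) → x , without⁺ (X⇒∈Xs lp Xx) x≢x′ ,
          subst (Own lp x) (own-exact lp o t∈ ¬f′) (proj₂ (own-of Xx t∈ ¬f))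

      X⊆A₂ : ∀ {x} → X x → A x
      X⊆A₂ Xx with X-owns₂ Xx
      ... | s , s≢c , o = X⇒R Xx , ~sym (Own.rest o c∈T (s≢c ∘ ≡-sym))

      -- u is adjacent to h and not in K, so it lies in X ⊆ A.
      common : ∀ {u s x} → A x → s ∈ preds ps → ¬ Nbr u x → h ~ u → s ~ u → ⊥
      common Ax s∈ ¬ux h~u s~u with K-adj h∈K h~u
      ... | inj₁ u∈K = T≁K lp s∈ u∈K s~u
      ... | inj₂ Xu = ¬ux (inj₂ (A-clique Ax (X⊆A₂ Xu) λ { refl → ¬ux (inj₁ refl) }))

      -- In the other outcome the owner `x` of `e` is adjacent to `h`. Let `x′` own `l`. A vertex
      -- missed by `x` and `x′` is adjacent to `h`, and the pair of `e` and `l` makes it adjacent to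
      -- one of these two; `common` excludes it.
      free : Free
      free with h-pair lp crit e∈T e≢c (c≁T′ e∈T e≢c)
      ... | to-h a Az _ z~T = record { z = _ ; Az = Az ; z~T = z~T }
      ... | to-t {x} a Ax o h~x with other-T lp crit e
      ...   | l , l∈ , l≢e , l≢c with own l∈ l≢c
      ...     | x′ , o′ = ⊥-elim (go (notSmall′ Ax (X⇒R (Own.Xx o′)) (inj₂ (A-clique Ax (X⊆A₂ (Own.Xx o′)) x≢x′))))
        where
        x≢x′ : x ≢ x′
        x≢x′ refl = l≢e (own-injective lp o′ o)
        go : (∃[ u ] R u × ¬ Nbr u x × ¬ Nbr u x′) → ⊥
        go (u , Ru , ¬ux , ¬ux′) with Arrow.dom a Ru (λ { refl → ¬ux′ (inj₂ (Own.rest o′ e∈T (l≢e ∘ ≡-sym))) })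
        ... | inj₂ nb = ¬ux nb
        ... | inj₁ (inj₁ refl) = ¬ux (inj₂ (~sym h~x))
        ... | inj₁ (inj₂ h~u) with T-pair lp crit e∈T e≢c l∈ l≢c (l≢e ∘ ≡-sym)
        ...   | inj₁ (y , a′ , o″ , _) with same-owner (Own.Xx o″) (Own.Xx o′) l∈ (Own.x≁t o″) (Own.x≁t o′)
        ...     | refl with Arrow.dom a′ Ru (λ { refl → ¬ux (inj₂ (Own.rest o l∈ l≢e)) })
        ...       | inj₂ nb = ¬ux′ nb
        ...       | inj₁ (inj₁ refl) = T≁K lp e∈T h∈K (~sym h~u)
        ...       | inj₁ (inj₂ e~u) = common Ax e∈T ¬ux h~u e~u
        go (u , Ru , ¬ux , ¬ux′) | inj₁ (inj₂ h~u) | inj₂ (y , a′ , o″ , _) with same-owner (Own.Xx o″) (Own.Xx o) e∈T (Own.x≁t o″) (Own.x≁t o)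
        ...     | refl with Arrow.dom a′ Ru (λ { refl → ¬ux′ (inj₂ (Own.rest o′ e∈T (l≢e ∘ ≡-sym))) })
        ...       | inj₂ nb = ¬ux nb
        ...       | inj₁ (inj₁ refl) = T≁K lp l∈ h∈K (~sym h~u)
        ...       | inj₁ (inj₂ l~u) = common Ax l∈ ¬ux h~u l~u

      contra : ⊥
      contra = Shapes.two-neighbours free (λ Xx ¬f → same-owner Xx Xx₁ e∈T ¬f x₁≁e) (proj₂ (own-of Xx₁ e∈T x₁≁e))
          λ ρ av f g Xx₂ l ε avv eq₂ (t₂∈ , t₂≢c) t₂≢e un → un (proj₂ (own t₂∈ t₂≢c))
        where open Free free

    module Unowned {τ} (τ∈ : τ ∈ preds ps) (τ≢c : τ ≢ c) (un : ∀ {x} → ¬ Own lp x τ) where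

      free : Free
      free with h-pair lp crit τ∈ τ≢c (c≁T′ τ∈ τ≢c)
      ... | to-h a Az _ z~T = record { z = _ ; Az = Az ; z~T = z~T }
      ... | to-t _ _ o _ = ⊥-elim (un o)

      open Free free

      -- The neighbours of K other than b must then own T minus the root and τ, one vertex each.
      module Deficient {b} (Xb : X b) (b-own : ∀ {s} → Own lp b s → s ≡ c) where

        few : ∀ {x} → X x → x ≢ b → (∀ {y t} → Own lp y t → t ≢ c → ∃[ z ] z ∈ without x (without b (Xs lp)) × Own lp z t) → ⊥
        few {x} Xx x≢b f = ℕₚ.<⇒≱ (length-without< {v = x} {xs = without b (Xs lp)} (without⁺ (X⇒∈Xs lp Xx) x≢b))
          (s≤s⁻¹ (ℕₚ.≤-trans (Xs-without lp Xb) (ℕₚ.≤-trans (X≤Ts lp)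
            (unowned-count lp τ∈ τ≢c un (without x (without b (Xs lp))) f))))

        own∈′ : ∀ {y t} → Own lp y t → t ≢ c → y ∈ without b (Xs lp)
        own∈′ o t≢c = without⁺ (own∈ lp o) λ { refl → t≢c (b-own o) }

        owns : ∀ {x} → X x → x ≢ b → ∃[ t ] t ≢ c × Own lp x t
        owns {x} Xx x≢b with Finₚ.any? (λ t → ¬? (t ≟ c) ×-dec Own? lp x t)
        ... | yes r = r
        ... | no ¬any = ⊥-elim (few Xx x≢b λ {y} {t} o t≢c → y , without⁺ (own∈′ o t≢c) (λ { refl → ¬any (t , t≢c , o) }) , o)

        own-of : ∀ {x t} → X x → x ≢ b → t ∈ preds ps → ¬ x ~ t → t ≢ c × Own lp x t
        own-of {x} Xx x≢b t∈ ¬f with owns Xx x≢b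
        ... | s , s≢c , o with own-exact lp o t∈ ¬f
        ...   | refl = s≢c , o

        ~τ : ∀ {x} → X x → x ≢ b → x ~ τ
        ~τ Xx x≢b with owns Xx x≢b
        ... | s , _ , o = Own.rest o τ∈ λ { refl → un o }

        ∈A : ∀ {x} → X x → x ≢ b → A x
        ∈A Xx x≢b with owns Xx x≢b
        ... | s , s≢c , o = X⇒R Xx , ~sym (Own.rest o c∈T (s≢c ∘ ≡-sym))

        same-owner : ∀ {x x′ t} → X x → X x′ → x ≢ b → x′ ≢ b → t ∈ preds ps → ¬ x ~ t → ¬ x′ ~ t → x ≡ x′
        same-owner {x} {x′} {t} Xx Xx′ x≢b x′≢b t∈ ¬f ¬f′ = decidable-stable (x ≟ x′) λ x≢x′ → few Xx′ x′≢b λ {y} {s} o s≢c → case y ≟ x′ of λ where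
          (no y≢x′) → y , without⁺ (own∈′ o s≢c) y≢x′ , o
          (yes refl) → x , without⁺ (without⁺ (X⇒∈Xs lp Xx) x≢b) x≢x′ ,
            subst (Own lp x) (own-exact lp o t∈ ¬f′) (proj₂ (own-of Xx x≢b t∈ ¬f))

      module Dominated (X~τ : ∀ {x} → X x → x ~ τ) where

        -- `b` owns the root and is therefore lost as an owner of the other vertices.
        module WithOwner {b} (Xb : X b) (b≁c : ¬ b ~ c) (b~T : ∀ {t} → t ∈ preds ps → t ≢ c → b ~ t) where

          open Deficient Xb (λ o → decidable-stable (_ ≟ c) λ s≢c → Own.x≁t o (b~T (Own.t∈T o) s≢c))

          x₁≢b : x₁ ≢ b
          x₁≢b refl = b≁c (~sym c~x₁)

          own₁ : Own lp x₁ e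
          own₁ = proj₂ (own-of Xx₁ x₁≢b e∈T x₁≁e)

          only : ∀ {x} → X x → ¬ x ~ e → x ≡ x₁
          only Xx ¬f = same-owner Xx Xx₁ (λ { refl → ¬f (b~T e∈T e≢c) }) x₁≢b e∈T ¬f x₁≁e

          -- Here `t₂` is `τ`. If `s₂` is not the last vertex, joining it to `τ` gives a vertex of X
          -- that misses `τ`. Otherwise the path ends with x₂, e, and `z` lies before `τ`; its
          -- successor `w` is non-adjacent to `x₁` by `reroute` and adjacent to it by the pair of
          -- `e` and `w`.
          last-two : ∀ {s₁ t₂ x₂ s₂ us vs} → Path s₁ t₂ us → Avoids X? us → x₁ ~ s₁ → t₂ ~ x₂ → X x₂ → x₂ ~ s₂ → Path s₂ e vs → Avoids X? vs →
                     ps ≡ c ∷ x₁ ∷ us ++ x₂ ∷ vs → (t₂ ∈ preds ps × t₂ ≢ c) → t₂ ≢ e → (∀ {x} → ¬ Own lp x t₂) → ⊥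
          last-two {s₁} {t₂} {x₂} {s₂} {us} {vs} ρ av f g Xx₂ l ε avv eq₂ (t₂∈ , t₂≢c) t₂≢e unown = by-end ε refl
            where
            disj : ∀ {v} → v ∈ c ∷ x₁ ∷ us → v ∉ x₂ ∷ vs
            disj = proj₂ (proj₂ (unique-++⁻ (c ∷ x₁ ∷ us) (subst Unique eq₂ (unique-ps lp))))
            τ≡t₂ : t₂ ≡ τ
            τ≡t₂ = decidable-stable (t₂ ≟ τ) λ t₂≢τ → unown (proj₁ (proj₂ (proj₂ (unowned-arrow lp crit τ∈ τ≢c un t₂∈ t₂≢c (t₂≢τ ∘ ≡-sym)))))
            x₂≢x₁ : x₂ ≢ x₁
            x₂≢x₁ refl = disj (there (here refl)) (here refl)
            x₂~e : x₂ ~ e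
            x₂~e = decidable-stable (dec G x₂ e) λ ¬f → x₂≢x₁ (only Xx₂ ¬f)
            by-end : ∀ {zs} → Path s₂ e zs → zs ≡ vs → ⊥
            by-end (k ∷ ε′) refl with uncons ε′
            ... | _ , refl = Arrow.z≁y (proj₁ (proj₂ pair₂)) (subst (proj₁ pair₂ ~_) (≡-sym τ≡t₂) (X~τ (proj₁ (proj₂ (proj₂ pair₂)))))
              where
              nx : Next x₂ s₂ ps
              nx = subst (Next x₂ s₂) (≡-sym eq₂) (there (there (next-++ʳ us here)))
              s₂∉ : s₂ ∉ preds ps
              s₂∉ s₂∈ = All.head (All.tail avv) (T-next lp s₂∈ (subst (Next s₂ _) (≡-sym eq₂) (there (there (next-++ʳ us (there here))))))
              t₂≁s₂ : ¬ t₂ ~ s₂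
              t₂≁s₂ q = no-exit (⌊ c~x₁ ∷ f ∷ ρ ⌋ ⟪ q ⟫ ⌊ ε ⌋ ⟪ ~sym x₂~e ⟫ ⌊ [-] ⌋) Xx₂ ps↭
                (perm (Permₚ.++⁺ˡ (c ∷ x₁ ∷ us) (Permₚ.++-comm vs (x₂ ∷ []))) eq₂)
              pair₂ = out-pair t₂∈ t₂≢c (∈ps₀ lp (next-∈ʳ nx)) (next⇒≢c lp nx) (All.head avv) s₂∉ t₂≁s₂
            by-end [-] refl with ∈-++⁻ us (z∈us (subst (z ∈_) eq₂ (∈ps lp (A⊆ps₀ Az))))
              where
              z∈us : z ∈ c ∷ x₁ ∷ us ++ x₂ ∷ e ∷ [] → z ∈ us ++ []
              z∈us (here z≡c) = ⊥-elim (R⇒≢c (proj₁ Az) z≡c)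
              z∈us (there (here eq)) = ⊥-elim (¬Xz (subst X (≡-sym eq) Xx₁))
              z∈us (there (there z∈)) with ∈-++⁻ us z∈
              ... | inj₁ z∈us = ∈-++⁺ˡ z∈us
              ... | inj₂ (here eq) = ⊥-elim (¬Xz (subst X (≡-sym eq) Xx₂))
              ... | inj₂ (there (here eq)) = ⊥-elim (z≢ e∈T eq)
            ... | inj₁ z∈us with cut-after ρ z∈us
            ...   | inj₁ eq = z≢ t₂∈ eq
            ...   | inj₂ (w , as , bs , α , zw , β , refl) = x₁≁w (~sym w~x₁)
              where
              eq₃ : ps ≡ c ∷ x₁ ∷ as ++ bs ++ x₂ ∷ e ∷ []
              eq₃ = trans eq₂ (cong (λ l → c ∷ x₁ ∷ l) (Listₚ.++-assoc as bs (x₂ ∷ e ∷ [])))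
              nx : Next z w ps
              nx = subst (Next z w) (≡-sym eq₃) (there (there (next-join α (β ⟨ g ⟩ l ∷ [-]))))
              q : Path x₁ w (x₁ ∷ as ++ reverse (bs ++ x₂ ∷ e ∷ []))
              q = f ∷ (α ⟨ z~T e∈T ⟩ reverseᵖ (β ⟨ g ⟩ l ∷ [-]))
              lp′ : LP w (c ∷ x₁ ∷ as ++ reverse (bs ++ x₂ ∷ e ∷ []))
              lp′ = c~x₁ ∷ q , ↭-trans (Permₚ.++⁺ˡ (c ∷ x₁ ∷ as) (Permₚ.↭-reverse (bs ++ x₂ ∷ e ∷ []))) (↭-trans (↭-reflexive (≡-sym eq₃)) ps↭)
              x₁≁w : ¬ x₁ ~ w
              x₁≁w = Start.reroute lp′ c~x₁ Xx₁ q refl Az ¬Xz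
              w≢e : w ≢ e
              w≢e refl = disj (there (there (∈-++⁺ʳ as (start∈ β)))) (there (here refl))
              w∉T : w ∉ preds ps
              w∉T w∈ = x₁≁w (Own.rest own₁ w∈ w≢e)
              e≁w : ¬ e ~ w
              e≁w k = no-detour (⌊ [-] ⌋ ⟪ proj₂ Az ⟫ ⌊ f ∷ α ⌋ʳ) Xx₁ Xx₂ (⌊ l ∷ [-] ⌋ ⟪ k ⟫ ⌊ β ⌋) ps↭
                (perm (Permₚ.++⁺ˡ (c ∷ x₁ ∷ as) (Permₚ.++-comm (x₂ ∷ e ∷ []) bs)) eq₃)
              w~x₁ : w ~ x₁
              w~x₁ = by-arrow (out-pair e∈T e≢c (∈ps₀ lp (next-∈ʳ nx)) (next⇒≢c lp nx) (z-next nx) w∉T e≁w)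
                where
                by-arrow : (∃[ x ] Arrow w e x × X x × w ~ x) → w ~ x₁
                by-arrow (x , a , Xx , w~x) = subst (w ~_) (only Xx (Arrow.z≁y a)) w~x

          contra : ⊥
          contra = Shapes.two-neighbours free only own₁ last-two

        -- Joining `τ` to the root either contradicts `away-contra` or yields a `b` in X that
        -- dominates T without the root, and so misses exactly the root.
        contra : ⊥
        contra with rootPair (T⇒R lp τ∈ τ≢c) (c≁T′ τ∈ τ≢c)
        ... | away Aa Rb link ¬τa ¬τb dom = away-contra lp τ∈ X~τ Aa Rb link ¬τa ¬τb dom
        ... | through {b} Rb link dom = WithOwner.contra Xb b≁c b~T
          where
          Xb : X b
          Xb = through-X lp c∈T τ∈ dom
          b~T : ∀ {t} → t ∈ preds ps → t ≢ c → b ~ t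
          b~T {t} t∈ t≢c with t ≟ τ
          ... | yes refl = X~τ Xb
          ... | no t≢τ with through-T lp c∈T τ∈ dom t∈ t≢c t≢τ
          ...   | inj₁ refl = ⊥-elim (T∩X lp t∈ Xb)
          ...   | inj₂ f = f
          b≁c : ¬ b ~ c
          b≁c f = X-misses-T lp Xb λ {t} t∈ → case t ≟ c of λ where
            (yes refl) → f
            (no t≢c) → b~T t∈ t≢c

  -- The root is in T and some vertex of X misses the unowned vertex

  module Undominated {e ps x₁ ys} (lp : LP e ps) (c~x₁ : c ~ x₁) (Xx₁ : X x₁) (ω : Path x₁ e ys) (eq : ps ≡ c ∷ ys)
                     {τ} (τ∈ : τ ∈ preds ps) (τ≢c : τ ≢ c) (un : ∀ {x} → ¬ Own lp x τ)
                     {x₀} (Xx₀ : X x₀) (x₀≁τ : ¬ x₀ ~ τ) where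

    open At lp c~x₁ Xx₁ ω eq
    open Unowned lp c~x₁ Xx₁ ω eq τ∈ τ≢c un
    open Free free

    private
      p = proj₁ lp
      ps↭ = proj₂ lp

    -- It misses `τ`, so `τ` is all that it could own.
    x₀-owns-nothing : ∀ {s} → ¬ Own lp x₀ s
    x₀-owns-nothing o = un (subst (Own lp x₀) (≡-sym (own-exact lp o τ∈ x₀≁τ)) o)

    open Deficient Xx₀ (λ o → ⊥-elim (x₀-owns-nothing o))

    embed-tail : ∀ {t u} → Next t u ys → Next t u ps
    embed-tail nx = subst (Next _ _) (≡-sym eq) (there nx)

    -- The path c, x₁ ... z, e back to w ends at `w`, and `reroute` applies to it.
    x₁≁next : ∀ {w as bs} → Path x₁ z as → Path w e bs → ys ≡ as ++ bs → ¬ x₁ ~ w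
    x₁≁next {w} {as} {bs} α β eqy = Start.reroute lp′ c~x₁ Xx₁ q refl Az ¬Xz
      where
      q : Path x₁ w (as ++ reverse bs)
      q = α ⟨ z~T e∈T ⟩ reverseᵖ β
      lp′ : LP w (c ∷ as ++ reverse bs)
      lp′ = c~x₁ ∷ q , ↭-trans (Permₚ.++⁺ˡ (c ∷ as) (Permₚ.↭-reverse bs))
              (↭-trans (↭-reflexive (≡-sym (trans eq (cong (c ∷_) eqy)))) ps↭)

    module SourceLast (τ≡e : τ ≡ e) where

      x₁≡x₀ : x₁ ≡ x₀
      x₁≡x₀ = decidable-stable (x₁ ≟ x₀) λ x₁≢x₀ → x₁≁e (subst (x₁ ~_) τ≡e (~τ Xx₁ x₁≢x₀))

      only : ∀ {x} → X x → ¬ x ~ e → x ≡ x₁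
      only {x} Xx ¬f = decidable-stable (x ≟ x₁) λ x≢x₁ → ¬f (subst (x ~_) τ≡e (~τ Xx λ x≡x₀ → x≢x₁ (trans x≡x₀ (≡-sym x₁≡x₀))))

      module _ {w as bs} (α : Path x₁ z as) (zw : z ~ w) (β : Path w e bs) (eqy : ys ≡ as ++ bs)
               {xb s ms ss} (Xb : X xb) (M : Path x₁ xb ms) (f : xb ~ s) (σ : Path s z ss) (av : Avoids X? ss) (eqa : as ≡ ms ++ ss) where

        eq₁ : ps ≡ (c ∷ ms) ++ (ss ++ bs)
        eq₁ = trans eq (cong (c ∷_) (trans eqy (trans (cong (_++ bs) eqa) (Listₚ.++-assoc ms ss bs))))

        x₁≁w : ¬ x₁ ~ w
        x₁≁w = x₁≁next α β eqy

        disj : ∀ {v} → v ∈ ss → v ∉ bs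
        disj = proj₂ (proj₂ (unique-++⁻ ss (proj₁ (proj₂ (unique-++⁻ (c ∷ ms) (subst Unique eq₁ (unique-ps lp)))))))

        nx : Next xb s ps
        nx = subst (Next xb s) (≡-sym eq₁) (there (next-join M (σ ⟨ zw ⟩ β)))

        s∉T : s ∉ preds ps
        s∉T = head∉T σ av λ nx → subst (Next _ _) (≡-sym eq₁) (next-++ʳ (c ∷ ms) (next-++ˡ bs nx))

        s-arrow : ¬ e ~ s → Arrow s e x₁ × s ~ x₁
        s-arrow e≁s = to-x₁ (out-pair e∈T e≢c (∈ps₀ lp (next-∈ʳ nx)) (next⇒≢c lp nx) (All.lookup av (start∈ σ)) s∉T e≁s)
          where
          to-x₁ : (∃[ x ] Arrow s e x × X x × s ~ x) → Arrow s e x₁ × s ~ x₁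
          to-x₁ (x , a , Xx , s~x) with only Xx (Arrow.z≁y a)
          ... | refl = a , s~x

        -- Reroute: c ... xb, K, x′ ... e, z back to s, w ... t. The edge from `s` to `w` comes from
        -- the arrow at `s`: its middle vertex `x₁` does not dominate `w`.
        between : ∀ {t x′ us vs} → Path w t us → t ~ x′ → X x′ → Path x′ e vs → bs ≡ us ++ vs → ⊥
        between {t} {x′} {us} {vs} ρ g Xx′ ε refl =
          no-detour ⌊ c~x₁ ∷ M ⌋ Xb Xx′ (⌊ ε ⌋ ⟪ ~sym (z~T e∈T) ⟫ ⌊ σ ⌋ʳ ⟪ s~w ⟫ ⌊ ρ ⌋) ps↭
            (perm (solve 4 (λ m s u v → (m ⊕ (v ⊕ (s ⊕ u)) , m ⊕ (s ⊕ (u ⊕ v)))) ↭-refl (c ∷ ms) ss us vs) eq₁)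
          where
          e≁s : ¬ e ~ s
          e≁s = last≁succ {bs = ss ++ us} lp (c~x₁ ∷ M) (σ ⟨ zw ⟩ ρ) ε
            (trans eq₁ (cong (λ l → c ∷ ms ++ l) (≡-sym (Listₚ.++-assoc ss us vs)))) Xb Xx′
          w≢e : w ≢ e
          w≢e refl = proj₂ (proj₂ (unique-++⁻ us (proj₁ (proj₂ (unique-++⁻ ss (proj₁ (proj₂ (unique-++⁻ (c ∷ ms) (subst Unique eq₁ (unique-ps lp)))))))))) (start∈ ρ) (end∈ ε)
          w∈ps : w ∈ ps
          w∈ps = subst (w ∈_) (≡-sym eq₁) (∈-++⁺ʳ (c ∷ ms) (∈-++⁺ʳ ss (start∈ β)))
          Rw : R w
          Rw = ps₀⇒R (∈ps₀ lp w∈ps) λ { refl → proj₂ (proj₂ (unique-++⁻ (c ∷ ms) (subst Unique eq₁ (unique-ps lp)))) (here refl) (∈-++⁺ʳ ss (start∈ β)) }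
          s~w : s ~ w
          s~w = go (Arrow.dom (proj₁ (s-arrow e≁s)) Rw w≢e)
            where
            ¬Xw : ¬ X w
            ¬Xw = z-next (subst (Next z w) (≡-sym eq₁) (next-++ʳ (c ∷ ms) (next-join σ β)))
            go : Nbr w s ⊎ Nbr w x₁ → s ~ w
            go (inj₁ (inj₁ w≡s)) = ⊥-elim (disj (start∈ σ) (subst (_∈ bs) w≡s (start∈ β)))
            go (inj₁ (inj₂ k)) = k
            go (inj₂ (inj₁ w≡x₁)) = ⊥-elim (¬Xw (subst X (≡-sym w≡x₁) Xx₁))
            go (inj₂ (inj₂ k)) = ⊥-elim (x₁≁w k)

        -- Reroute: c, xb, K, x₁ ... t, z back to s, e back to w. It may start with `xb` because the
        -- owners lie in A.
        beyond : Avoids X? bs → ⊥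
        beyond avb with unsnoc M
        ... | inj₁ (refl , refl) = X-single lp {x₁} λ {v} v∈ Xv → case subst (v ∈_) eq₁ v∈ of λ where
              (here refl) → ⊥-elim (X⇒≢c Xv refl)
              (there (here eq)) → eq
              (there (there v∈′)) → case ∈-++⁻ ss v∈′ of λ where
                (inj₁ v∈ss) → ⊥-elim (All.lookup av v∈ss Xv)
                (inj₂ v∈bs) → ⊥-elim (All.lookup avb v∈bs Xv)
        ... | inj₂ (t , ms′ , M′ , g , refl) =
              no-detour (⌊ [-] ⌋ ⟪ proj₂ (∈A Xb xb≢x₀) ⟫ ⌊ [-] ⌋) Xb Xx₁ (⌊ M′ ⌋ ⟪ ~sym (z~T t∈T) ⟫ ⌊ σ ⌋ʳ ⟪ ~sym e~s ⟫ ⌊ β ⌋ʳ) ps↭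
                (perm (solve 5 (λ c m x s b → ((c ⊕ x) ⊕ (m ⊕ (s ⊕ b)) , (c ⊕ (m ⊕ x)) ⊕ (s ⊕ b))) ↭-refl (c ∷ []) ms′ (xb ∷ []) ss bs) eq₁)
          where
          t∈T : t ∈ preds ps
          t∈T = next-pred (subst (Next t xb) (≡-sym eq₁) (there (next-++ˡ (ss ++ bs) (next-join M′ [-])))) Xb
          xb≢x₁ : xb ≢ x₁
          xb≢x₁ refl with unique-++⁻ ms′ (proj₁ (unique-++⁻ (ms′ ++ xb ∷ []) (proj₁ (proj₂ (unique-++⁻ (c ∷ []) (subst Unique eq₁ (unique-ps lp)))))))
          ... | _ , _ , d = d (start∈ M′) (here refl)
          xb≢x₀ : xb ≢ x₀
          xb≢x₀ eq = xb≢x₁ (trans eq (≡-sym x₁≡x₀))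
          xb~e : xb ~ e
          xb~e = decidable-stable (dec G xb e) λ ¬k → xb≢x₁ (only Xb ¬k)
          q : Path x₁ s (ms ++ reverse (ss ++ bs))
          q = M ⟨ xb~e ⟩ reverseᵖ (σ ⟨ zw ⟩ β)
          lp′ : LP s (c ∷ ms ++ reverse (ss ++ bs))
          lp′ = c~x₁ ∷ q , ↭-trans (Permₚ.++⁺ˡ (c ∷ ms) (Permₚ.↭-reverse (ss ++ bs))) (↭-trans (↭-reflexive (≡-sym eq₁)) ps↭)
          e~s : e ~ s
          e~s = decidable-stable (dec G e s) λ e≁s → Start.reroute lp′ c~x₁ Xx₁ q refl Az ¬Xz (~sym (proj₂ (s-arrow e≁s)))

      contra : ⊥
      contra with cut-after ω z∈ys
      ... | inj₁ z≡e = z≢ e∈T z≡e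
      ... | inj₂ (w , as , bs , α , zw , β , eqy) = split (last-in X? α ¬Xz) (first-in X? β ¬Xw)
        where
        ¬Xw : ¬ X w
        ¬Xw = z-next (embed-tail (subst (Next z w) (≡-sym eqy) (next-join α β)))
        split : LastIn X? x₁ z as → FirstIn X? w e bs → ⊥
        split (none av) _ = All.lookup av (start∈ α) Xx₁
        split (at Xb M f σ av eqa) (at ρ _ g Xx′ ε eqb) = between α zw β eqy Xb M f σ av eqa ρ g Xx′ ε eqb
        split (at Xb M f σ av eqa) (none avb) = beyond α zw β eqy Xb M f σ av eqa avb

    -- `x₁` misses `e`, so it is not `x₀`. With only two vertices in X, `x₀` is the second one,
    -- whose predecessor is `τ`.
    x₀~last : τ ≢ e → x₀ ~ e → ⊥
    x₀~last τ≢e x₀~e = Shapes.two-neighbours lp c~x₁ Xx₁ ω eq free only (proj₂ (own-of Xx₁ x₁≢x₀ e∈T x₁≁e)) last-two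
      where
      x₁≢x₀ : x₁ ≢ x₀
      x₁≢x₀ refl = x₁≁e x₀~e
      only : ∀ {x} → X x → ¬ x ~ e → x ≡ x₁
      only Xx ¬f = same-owner Xx Xx₁ (λ { refl → ¬f x₀~e }) x₁≢x₀ e∈T ¬f x₁≁e
      last-two : ∀ {s₁ t₂ x₂ s₂ us vs} → Path s₁ t₂ us → Avoids X? us → x₁ ~ s₁ → t₂ ~ x₂ → X x₂ → x₂ ~ s₂ → Path s₂ e vs → Avoids X? vs →
                 ps ≡ c ∷ x₁ ∷ us ++ x₂ ∷ vs → (t₂ ∈ preds ps × t₂ ≢ c) → t₂ ≢ e → (∀ {x} → ¬ Own lp x t₂) → ⊥
      last-two {t₂ = t₂} {x₂} {us = us} {vs} ρ av f g Xx₂ l ε avv eq₂ (t₂∈ , t₂≢c) t₂≢e unown = which (subst (x₀ ∈_) eq₂ (∈ps lp (proj₁ Xx₀)))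
        where
        t₂≡τ : t₂ ≡ τ
        t₂≡τ = decidable-stable (t₂ ≟ τ) λ t₂≢τ → unown (proj₁ (proj₂ (proj₂ (unowned-arrow lp crit τ∈ τ≢c un t₂∈ t₂≢c (t₂≢τ ∘ ≡-sym)))))
        which : x₀ ∈ c ∷ x₁ ∷ us ++ x₂ ∷ vs → ⊥
        which (here eq) = X⇒≢c Xx₀ eq
        which (there (here eq)) = x₁≢x₀ (≡-sym eq)
        which (there (there x₀∈)) with ∈-++⁻ us x₀∈
        ... | inj₁ x₀∈us = All.lookup av x₀∈us Xx₀
        ... | inj₂ (there x₀∈vs) = All.lookup avv x₀∈vs Xx₀
        ... | inj₂ (here eq) = x₀≁τ (subst (_~ τ) (≡-sym eq) (subst (x₂ ~_) t₂≡τ (~sym g)))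

    root-tail : ∀ {v rs ws} → Path c v rs → v ≢ c → rs ++ ws ≡ c ∷ ys → ∃[ qs ] Path x₁ v qs × rs ≡ c ∷ qs
    root-tail [-] v≢c _ = ⊥-elim (v≢c refl)
    root-tail (f ∷ q) v≢c eq with starts-++ q ω (trans (Listₚ.∷-injectiveʳ eq) (≡-sym (Listₚ.++-identityʳ ys)))
    ... | refl = _ , q , refl

    module Inner (τ≢e : τ ≢ e) (x₀≁e : ¬ x₀ ~ e) where

      -- Joining `τ` to `w` gives a vertex of X that misses `τ`, which can only be `x₀`. It misses
      -- `e` as well, so `w` must dominate `e`.
      τ-or-e : ∀ {w} → w ∈ ps₀ → w ≢ c → ¬ X w → w ∉ preds ps → ¬ e ~ w → τ ~ w
      τ-or-e {w} w∈ w≢c ¬Xw w∉ e≁w = decidable-stable (dec G τ w) λ ¬f → go (out-pair τ∈ τ≢c w∈ w≢c ¬Xw w∉ ¬f)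
        where
        go : (∃[ x ] Arrow w τ x × X x × w ~ x) → ⊥
        go (x , a , Xx , w~x) with Arrow.dom a (T⇒R lp e∈T e≢c) (τ≢e ∘ ≡-sym)
        ... | inj₁ (inj₁ refl) = w∉ e∈T
        ... | inj₁ (inj₂ f) = e≁w (~sym f)
        ... | inj₂ (inj₁ refl) = not-last-X Xx refl
        ... | inj₂ (inj₂ f) with x ≟ x₀
        ...   | yes refl = x₀≁e f
        ...   | no x≢x₀ = Arrow.z≁y a (~τ Xx x≢x₀)

      module _ {x xs zs} (θ : Path c τ xs) (τx : τ ~ x) (Xx : X x) (ω′ : Path x e zs) (eq′ : ps ≡ xs ++ zs) where

        x≢x₀ : x ≢ x₀
        x≢x₀ refl = x₀≁τ (~sym τx)

        eq₂ : ∀ as bs → xs ≡ as ++ bs → ps ≡ (as ++ bs) ++ zs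
        eq₂ as bs eqx = trans eq′ (cong (_++ zs) eqx)

        -- Reroute: c ... xb, K, x ... e, z back to s, τ back to w. Here τ ~ s, because `last≁succ`
        -- excludes e ~ s.
        z-before : ∀ {w as bs} → Path c z as → z ~ w → Path w τ bs → xs ≡ as ++ bs → ⊥
        z-before {w} {as} {bs} α zw β eqx with last-in X? α ¬Xz
        ... | none av with root-tail α (R⇒≢c (proj₁ Az)) (trans (≡-sym (trans (eq₂ as bs eqx) (Listₚ.++-assoc as bs zs))) eq)
        ...   | qs , α′ , refl = All.lookup av (there (start∈ α′)) Xx₁
        z-before {w} {as} {bs} α zw β eqx | at {xb} {s} {ms} {ss} Xb μ f σ av refl =
          no-detour ⌊ μ ⌋ Xb Xx (⌊ ω′ ⌋ ⟪ ~sym (z~T e∈T) ⟫ ⌊ σ ⌋ʳ ⟪ ~sym τ~s ⟫ ⌊ β ⌋ʳ) ps↭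
            (perm (solve 4 (λ m s b y → (m ⊕ (y ⊕ (s ⊕ b)) , ((m ⊕ s) ⊕ b) ⊕ y)) ↭-refl ms ss bs zs) (eq₂ (ms ++ ss) bs eqx))
          where
          nx : Next xb s ps
          nx = subst (Next xb s) (≡-sym (eq₂ (ms ++ ss) bs eqx)) (next-++ˡ zs (next-++ˡ bs (next-join μ σ)))
          eq₃ : ps ≡ ms ++ (ss ++ bs) ++ zs
          eq₃ = trans (eq₂ (ms ++ ss) bs eqx) (trans (cong (_++ zs) (Listₚ.++-assoc ms ss bs)) (Listₚ.++-assoc ms (ss ++ bs) zs))
          τ~s : τ ~ s
          τ~s = τ-or-e (∈ps₀ lp (next-∈ʳ nx)) (next⇒≢c lp nx) (All.lookup av (start∈ σ))
                  (head∉T σ av λ nx → subst (Next _ _) (≡-sym (eq₂ (ms ++ ss) bs eqx)) (next-++ˡ zs (next-++ˡ bs (next-++ʳ ms nx))))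
                  (last≁succ lp μ (σ ⟨ zw ⟩ β) ω′ eq₃ Xb Xx)

        module _ {w ds bs} (δ : Path x z ds) (zw : z ~ w) (β : Path w e bs) (eqz : zs ≡ ds ++ bs)
                 {xb s ms ss} (Xb : X xb) (M : Path x xb ms) (f : xb ~ s) (σ : Path s z ss) (av : Avoids X? ss) (eqd : ds ≡ ms ++ ss) where

          eq₄ : ps ≡ xs ++ ((ms ++ ss) ++ bs)
          eq₄ = trans eq′ (cong (xs ++_) (trans eqz (cong (_++ bs) eqd)))

          nx : Next xb s ps
          nx = subst (Next xb s) (≡-sym eq₄) (next-++ʳ xs (next-++ˡ bs (next-join M σ)))

          τ-or-e-s : ¬ e ~ s → τ ~ s
          τ-or-e-s = τ-or-e (∈ps₀ lp (next-∈ʳ nx)) (next⇒≢c lp nx) (All.lookup av (start∈ σ))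
            (head∉T σ av λ nx → subst (Next _ _) (≡-sym eq₄) (next-++ʳ xs (next-++ˡ bs (next-++ʳ ms nx))))

          e≁s : ∀ {t x′ us vs} → Path w t us → Path x′ e vs → ps ≡ xs ++ ((ms ++ ss) ++ (us ++ vs)) → X x′ → ¬ e ~ s
          e≁s {us = us} {vs} ρ ε eq₅ Xx′ = last≁succ {xs = xs ++ ms} {bs = ss ++ us} {ys = vs} lp (θ ⟨ τx ⟩ M) (σ ⟨ zw ⟩ ρ) ε eq₆ Xb Xx′
            where
            eq₆ : ps ≡ (xs ++ ms) ++ (ss ++ us) ++ vs
            eq₆ = trans eq₅ (≡-sym (trans (Listₚ.++-assoc xs ms ((ss ++ us) ++ vs)) (cong (xs ++_)
                    (trans (cong (ms ++_) (Listₚ.++-assoc ss us vs)) (≡-sym (Listₚ.++-assoc ms ss (us ++ vs)))))))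

          between : ∀ {t x′ us vs} → Path w t us → t ~ x′ → X x′ → Path x′ e vs → bs ≡ us ++ vs → ⊥
          between {t} {x′} {us} {vs} ρ g Xx′ ε refl with dec G x t
          ... | yes k = no-detour (⌊ θ ⌋ ⟪ τ~s ⟫ ⌊ σ ⟨ zw ⟩ ρ ⌋ ⟪ ~sym k ⟫ ⌊ M ⌋) Xb Xx′ ⌊ ε ⌋ ps↭
                  (perm (solve 5 (λ x m s u v → ((x ⊕ ((s ⊕ u) ⊕ m)) ⊕ v , x ⊕ ((m ⊕ s) ⊕ (u ⊕ v)))) ↭-refl xs ms ss us vs) eq₄)
            where
            τ~s : τ ~ s
            τ~s = τ-or-e-s (e≁s ρ ε eq₄ Xx′)
          ... | no ¬k = no-exit (⌊ θ ⌋ ⟪ τ~s ⟫ ⌊ σ ⟨ zw ⟩ ρ ⟨ g ⟩ ε ⌋ ⟪ ~sym x~e ⟫ ⌊ M ⌋) Xb ps↭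
                  (perm (solve 5 (λ x m s u v → (x ⊕ ((s ⊕ (u ⊕ v)) ⊕ m) , x ⊕ ((m ⊕ s) ⊕ (u ⊕ v)))) ↭-refl xs ms ss us vs) eq₄)
            where
            nxt : Next t x′ ps
            nxt = subst (Next t x′) (≡-sym eq₄) (next-++ʳ xs (next-++ʳ (ms ++ ss) (next-join ρ ε)))
            t∈T : t ∈ preds ps
            t∈T = next-pred nxt Xx′
            x~e : x ~ e
            x~e = Own.rest (proj₂ (own-of Xx x≢x₀ t∈T ¬k)) e∈T λ { refl → next≢end p (unique-ps lp) nxt refl }
            τ~s : τ ~ s
            τ~s = τ-or-e-s (e≁s ρ ε eq₄ Xx′)

          -- Reroute: c, x ... xb, K, x₁ ... τ, and then s ... e if τ ~ s, or z back to s and e back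
          -- to w if e ~ s.
          beyond : ⊥
          beyond with root-tail θ τ≢c (trans (≡-sym eq′) eq) | dec G τ s
          ... | qs , θ′ , refl | yes τ~s =
                no-detour (⌊ [-] ⌋ ⟪ proj₂ (∈A Xx x≢x₀) ⟫ ⌊ M ⌋) Xb Xx₁ (⌊ θ′ ⌋ ⟪ τ~s ⟫ ⌊ σ ⟨ zw ⟩ β ⌋) ps↭
                  (perm (solve 5 (λ c q m s b → ((c ⊕ m) ⊕ (q ⊕ (s ⊕ b)) , (c ⊕ q) ⊕ ((m ⊕ s) ⊕ b))) ↭-refl (c ∷ []) qs ms ss bs) eq₄)
          ... | qs , θ′ , refl | no τ≁s =
                no-detour (⌊ [-] ⌋ ⟪ proj₂ (∈A Xx x≢x₀) ⟫ ⌊ M ⌋) Xb Xx₁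
                  (⌊ θ′ ⌋ ⟪ ~sym (z~T τ∈) ⟫ ⌊ σ ⌋ʳ ⟪ ~sym (decidable-stable (dec G e s) (τ≁s ∘ τ-or-e-s)) ⟫ ⌊ β ⌋ʳ) ps↭
                  (perm (solve 5 (λ c q m s b → ((c ⊕ m) ⊕ (q ⊕ (s ⊕ b)) , (c ⊕ q) ⊕ ((m ⊕ s) ⊕ b))) ↭-refl (c ∷ []) qs ms ss bs) eq₄)

        inner : ⊥
        inner with ∈-++⁻ xs (subst (z ∈_) eq′ (∈ps lp (A⊆ps₀ Az)))
        ... | inj₁ z∈xs with cut-after θ z∈xs
        ...   | inj₁ z≡τ = z≢ τ∈ z≡τ
        ...   | inj₂ (_ , _ , _ , α , zw , β , eqx) = z-before α zw β eqx
        inner | inj₂ z∈zs with cut-after ω′ z∈zs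
        ... | inj₁ z≡e = z≢ e∈T z≡e
        ... | inj₂ (w , ds , bs , δ , zw , β , eqz) = split (last-in X? δ ¬Xz) (first-in X? β ¬Xw)
          where
          ¬Xw : ¬ X w
          ¬Xw = z-next (subst (Next z w) (≡-sym (trans eq′ (cong (xs ++_) eqz))) (next-++ʳ xs (next-join δ β)))
          split : LastIn X? x z ds → FirstIn X? w e bs → ⊥
          split (none av) _ = All.lookup av (start∈ δ) Xx
          split (at Xb M f σ av eqd) (at ρ _ g Xx′ ε eqb) = between δ zw β eqz Xb M f σ av eqd ρ g Xx′ ε eqb
          split (at Xb M f σ av eqd) (none _) = beyond δ zw β eqz Xb M f σ av eqd

    contra : ⊥
    contra with τ ≟ e | dec G x₀ e
    ... | yes τ≡e | _ = SourceLast.contra τ≡e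
    ... | no τ≢e | yes f = x₀~last τ≢e f
    ... | no τ≢e | no ¬f with preds⇒Pos p τ∈
    ...   | last τ≡e = τ≢e τ≡e
    ...   | pred θ τx Xx ω′ eq′ = Inner.inner τ≢e ¬f θ τx Xx ω′ eq′

  root∈T⇒⊥ : ∀ {e ps x₁ ys} → LP e ps → c ~ x₁ → X x₁ → Path x₁ e ys → ps ≡ c ∷ ys → ⊥
  root∈T⇒⊥ lp c~x₁ Xx₁ ω eq with ownership lp
  ... | all-owned own = AllOwned.contra lp c~x₁ Xx₁ ω eq own
  ... | unowned {τ} τ∈ τ≢c un with Finₚ.any? (λ x → X? x ×-dec ¬? (dec G x τ))
  ...   | yes (x₀ , Xx₀ , x₀≁τ) = Undominated.contra lp c~x₁ Xx₁ ω eq τ∈ τ≢c un Xx₀ x₀≁τ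
  ...   | no ¬any = Unowned.Dominated.contra lp c~x₁ Xx₁ ω eq τ∈ τ≢c un
                      λ {x} Xx → decidable-stable (dec G x τ) λ ¬f → ¬any (x , Xx , ¬f)

  no-longest₃ : ∀ {e ps} → LP e ps → ⊥
  no-longest₃ {e} {ps} lp@(p , _) = split (c ∈? preds ps)
    where
    root-first : Pos c e ps c → ⊥
    root-first (pred [-] g Xx ω eq) = root∈T⇒⊥ lp g Xx ω eq
    root-first (pred (_ ∷ q) g Xx ω refl) = Uniqueₚ.Unique[x∷xs]⇒x∉xs (unique-ps lp) (∈-++⁺ˡ (end∈ q))
    root-first (last refl) with other-T lp crit c
    ... | t , t∈ , t≢c , _ = t≢c (closed-path p (unique-ps lp) (preds-⊆ ps t∈))
    split : Dec (c ∈ preds ps) → ⊥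
    split (no c∉T) = root∉T⇒⊥ lp c∉T
    split (yes c∈T) = root-first (preds⇒Pos p c∈T)

-- Connected dominating sets as lists of vertices

elems : ∀ {n} → Subset n → List (Fin n)
elems [] = []
elems (Subset.inside ∷ S) = zero ∷ map suc (elems S)
elems (Subset.outside ∷ S) = map suc (elems S)

length-elems : ∀ {n} (S : Subset n) → length (elems S) ≡ ∣ S ∣
length-elems [] = refl
length-elems (Subset.inside ∷ S) = cong suc (trans (Listₚ.length-map suc (elems S)) (length-elems S))
length-elems (Subset.outside ∷ S) = trans (Listₚ.length-map suc (elems S)) (length-elems S)

∈-elems⁺ : ∀ {n} {S : Subset n} {v} → v ∈ₛ S → v ∈ elems S
∈-elems⁺ {S = Subset.inside ∷ S} Vec.here = here refl
∈-elems⁺ {S = Subset.inside ∷ S} (Vec.there v∈) = there (∈-map⁺ suc (∈-elems⁺ v∈))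
∈-elems⁺ {S = Subset.outside ∷ S} (Vec.there v∈) = ∈-map⁺ suc (∈-elems⁺ v∈)

∈-elems⁻ : ∀ {n} {S : Subset n} {v} → v ∈ elems S → v ∈ₛ S
∈-elems⁻ {S = Subset.inside ∷ S} (here refl) = Vec.here
∈-elems⁻ {S = Subset.inside ∷ S} (there v∈) with ∈-map⁻ suc v∈
... | _ , w∈ , refl = Vec.there (∈-elems⁻ w∈)
∈-elems⁻ {S = Subset.outside ∷ S} v∈ with ∈-map⁻ suc v∈
... | _ , w∈ , refl = Vec.there (∈-elems⁻ w∈)

elems-unique : ∀ {n} (S : Subset n) → Unique (elems S)
elems-unique [] = []
elems-unique (Subset.inside ∷ S) = All.tabulate (λ w∈ → case ∈-map⁻ suc w∈ of λ where (_ , _ , refl) ()) ∷ Uniqueₚ.map⁺ Finₚ.suc-injective (elems-unique S)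
elems-unique (Subset.outside ∷ S) = Uniqueₚ.map⁺ Finₚ.suc-injective (elems-unique S)

module _ {n : ℕ} where

  open import Data.List.Membership.DecPropositional (Finₚ._≟_ {n}) using (_∈?_)

  subset : List (Fin n) → Subset n
  subset D = Vec.tabulate (λ v → Dec.does (v ∈? D))

  ∈-subset⁺ : ∀ {D v} → v ∈ D → v ∈ₛ subset D
  ∈-subset⁺ {D} {v} v∈ = Vecₚ.lookup⇒[]= v _ (trans (Vecₚ.lookup∘tabulate _ v) (does-true (v ∈? D)))
    where
    does-true : (d : Dec (v ∈ D)) → Dec.does d ≡ Subset.inside
    does-true (yes _) = refl
    does-true (no v∉) = ⊥-elim (v∉ v∈)

  ∈-subset⁻ : ∀ {D v} → v ∈ₛ subset D → v ∈ D
  ∈-subset⁻ {D} {v} v∈ = from (v ∈? D) (trans (≡-sym (Vecₚ.lookup∘tabulate _ v)) (Vecₚ.[]=⇒lookup v∈))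
    where
    from : (d : Dec (v ∈ D)) → Dec.does d ≡ Subset.inside → v ∈ D
    from (yes v∈) _ = v∈
    from (no _) ()

  ∣subset∣≤length : ∀ D → ∣ subset D ∣ ≤ length D
  ∣subset∣≤length D = ℕₚ.≤-trans (ℕₚ.≤-reflexive (≡-sym (length-elems (subset D))))
    (unique-⊆⇒length≤ (elems-unique (subset D)) (λ v∈ → ∈-subset⁻ {D} (∈-elems⁻ {S = subset D} v∈)))

  Dom : Rel n → List (Fin n) → Fin n → Set
  Dom R D v = v ∈ D ⊎ ∃[ u ] (u ∈ D × R u v)

  record CDS (R : Rel n) (D : List (Fin n)) : Set where
    field
      dom : ∀ v → Dom R D v
      conn : ConnectedOn R (_∈ D)

  IsCDS⇒CDS : ∀ {R : Rel n} {S} → IsCDS R S → CDS R (elems S)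
  IsCDS⇒CDS {R} {S} (dom , conn) = record
    { dom = λ v → case v ∈? elems S of λ where
        (yes v∈) → inj₁ v∈
        (no v∉) → case dom v (v∉ ∘ ∈-elems⁺) of λ where (u , u∈ , e) → inj₂ (u , ∈-elems⁺ u∈ , e)
    ; conn = λ u v u∈ v∈ → walk-map ∈-elems⁺ (conn u v (∈-elems⁻ u∈) (∈-elems⁻ v∈)) }

  CDS⇒IsCDS : ∀ {R : Rel n} {D} → CDS R D → IsCDS R (subset D)
  CDS⇒IsCDS cds =
    (λ v v∉ → case CDS.dom cds v of λ where
      (inj₁ v∈) → ⊥-elim (v∉ (∈-subset⁺ v∈))
      (inj₂ (u , u∈ , e)) → u , ∈-subset⁺ u∈ , e) ,
    (λ u v u∈ v∈ → walk-map ∈-subset⁺ (CDS.conn cds u v (∈-subset⁻ u∈) (∈-subset⁻ v∈)))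

record Critical {n : ℕ} (k : ℕ) (G : Graph n) : Set where
  field
    connected : ∀ u v → WalkIn (Adj G) (λ _ → ⊤) u v
    lower : ∀ {D} → CDS (Adj G) D → k ≤ length D
    optimum : ∃[ D ] CDS (Adj G) D × Unique D × length D ≡ k
    improve : ∀ {u v} → u ≢ v → ¬ Adj G u v → ∃[ D ] CDS (addEdge (Adj G) u v) D × length D < k

critical : ∀ {n k} {G : Graph n} → IsCritical k G → Critical k G
critical (conn , ((S , cds , size) , low) , imp) = record
  { connected = λ u v → conn u v tt tt
  ; lower = λ {D} cds → ℕₚ.≤-trans (low (subset D) (CDS⇒IsCDS cds)) (∣subset∣≤length D)
  ; optimum = elems S , IsCDS⇒CDS cds , elems-unique S , trans (length-elems S) size
  ; improve = λ u≢v ¬e → case imp _ _ u≢v ¬e of λ where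
      (j , j<k , (S′ , cds′ , size′) , _) → elems S′ , IsCDS⇒CDS cds′ ,
        ℕₚ.≤-trans (s≤s (ℕₚ.≤-reflexive (trans (length-elems S′) size′))) j<k }

-- Parts of a graph attached at cut vertices

module Regions {n : ℕ} (G : Graph n) where

  V = Fin n
  infix 4 _~_
  _~_ = Adj G

  ~sym : ∀ {u v} → u ~ v → v ~ u
  ~sym = Graph.sym G

  open import Data.List.Membership.DecPropositional (Finₚ._≟_ {n}) using (_∈?_) public
  open Paths _~_ ~sym public
  _≟_ = Finₚ._≟_ {n}

  -- A set of vertices M attached to the rest of the graph at the vertices of Bd only. The map π retracts the graph onto M ∪ Bd,
  -- and every b ∈ Bd separates a part Q of the graph from M and the rest of Bd.
  record Piece (Bd : List V) (M : V → Set) : Set₁ where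
    field
      M? : Decidable M
      Bd∉M : ∀ {b} → b ∈ Bd → ¬ M b
      closed : ∀ {u w} → M u → u ~ w → M w ⊎ w ∈ Bd
      π : V → V
      π-fix : ∀ {v} → M v ⊎ v ∈ Bd → π v ≡ v
      π-out : ∀ {v} → ¬ M v → π v ∈ Bd
      π-adj : ∀ {u w} → u ~ w → π u ≡ π w ⊎ π u ~ π w
      separates : ∀ {b} → b ∈ Bd → Σ[ Q ∈ (V → Set) ] Decidable Q × (∀ {v} → Q v → ¬ M v × v ∉ Bd) ×
                  (∀ {u w} → Q u → u ~ w → w ≢ b → Q w) × (∃[ q ] Q q) × (∃[ r ] (M r ⊎ r ∈ Bd) × r ≢ b)

  addEdge-sym : ∀ {u v x y} → addEdge _~_ u v x y → addEdge _~_ u v y x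
  addEdge-sym (inj₁ e) = inj₁ (~sym e)
  addEdge-sym (inj₂ (inj₁ (p , q))) = inj₂ (inj₂ (q , p))
  addEdge-sym (inj₂ (inj₂ (p , q))) = inj₂ (inj₁ (q , p))

  record Completes (R : Rel n) (Bd : List V) (M : V → Set) (T : List V) : Set where
    field
      within : ∀ {v} → v ∈ T → M v
      conn : ConnectedOn R (_∈ Bd ++ T)
      dom : ∀ {v} → M v → Dom R (Bd ++ T) v

  module PieceFacts {Bd M} (P : Piece Bd M) where

    open Piece P

    MB : V → Set
    MB v = M v ⊎ v ∈ Bd

    module Local (R′ : Rel n) (sup : ∀ {x y} → x ~ y → R′ x y) (R′-sym : ∀ {x y} → R′ x y → R′ y x)
                 (sub : ∀ {x y} → R′ x y → x ~ y ⊎ (MB x × MB y)) where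

      -- A set avoiding `b` would have to be connected across `b` to dominate both Q and the rest;
      -- the added edges do not touch Q.
      Bd⊆CDS : ∀ {D} → CDS R′ D → ∀ {b} → b ∈ Bd → b ∈ D
      Bd⊆CDS {D} cds {b} b∈ with separates b∈
      ... | Q , Q? , Q-out , Q-closed , (q , Qq) , (r , MBr , r≢b) = decidable-stable (b ∈? D) λ b∉ →
            absurd b∉ (CDS.dom cds q) (CDS.dom cds r)
        where
        ¬QMB : ∀ {v} → Q v → ¬ MB v
        ¬QMB Qv (inj₁ m) = proj₁ (Q-out Qv) m
        ¬QMB Qv (inj₂ v∈) = proj₂ (Q-out Qv) v∈
        Q-step : ∀ {u w} → Q u → R′ u w → w ≢ b → Q w
        Q-step Qu e w≢b with sub e
        ... | inj₁ f = Q-closed Qu f w≢b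
        ... | inj₂ (m , _) = ⊥-elim (¬QMB Qu m)
        Q-back : ∀ {u w} → Q w → R′ u w → u ≢ b → Q u
        Q-back Qw e u≢b = Q-step Qw (R′-sym e) u≢b
        absurd : b ∉ D → Dom R′ D q → Dom R′ D r → ⊥
        absurd b∉ dq dr = ¬QMB (r-in dr) MBr
          where
          ∈D⇒≢b : ∀ {v} → v ∈ D → v ≢ b
          ∈D⇒≢b v∈ refl = b∉ v∈
          enter : Dom R′ D q → ∃[ u ] u ∈ D × Q u
          enter (inj₁ q∈) = q , q∈ , Qq
          enter (inj₂ (u , u∈ , e)) = u , u∈ , Q-back Qq e (∈D⇒≢b u∈)
          d = enter dq
          all-Q : ∀ {v} → v ∈ D → Q v
          all-Q v∈ = walk-end (walk-closed (CDS.conn cds _ _ (proj₁ (proj₂ d)) v∈) (proj₂ (proj₂ d)) λ _ y∈ e Qx → Q-step Qx e (∈D⇒≢b y∈))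
          r-in : Dom R′ D r → Q r
          r-in (inj₁ r∈) = all-Q r∈
          r-in (inj₂ (u , u∈ , e)) = Q-step (all-Q u∈) e r≢b

      -- The retraction π turns walks in D into walks in Bd and D ∩ M; the added edges have both
      -- ends where π is the identity.
      restrict : ∀ {D} → CDS R′ D → Completes R′ Bd M (filter M? D)
      restrict {D} cds = record { within = λ v∈ → proj₂ (∈-filter⁻ M? {xs = D} v∈) ; conn = conn ; dom = dom }
        where
        π∈ : ∀ {v} → v ∈ D → π v ∈ Bd ++ filter M? D
        π∈ {v} v∈ with M? v
        ... | yes m = ∈-++⁺ʳ Bd (subst (_∈ filter M? D) (≡-sym (π-fix (inj₁ m))) (∈-filter⁺ M? v∈ m))
        ... | no ¬m = ∈-++⁺ˡ (π-out ¬m)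
        π-step : ∀ {x y} → R′ x y → π x ≡ π y ⊎ R′ (π x) (π y)
        π-step e with sub e
        ... | inj₁ f = map₂ sup (π-adj f)
        ... | inj₂ (mx , my) = inj₂ (subst (λ z → R′ z _) (≡-sym (π-fix mx)) (subst (R′ _) (≡-sym (π-fix my)) e))
        back : ∀ {v} → v ∈ Bd ++ filter M? D → v ∈ D × MB v
        back v∈ with ∈-++⁻ Bd v∈
        ... | inj₁ b∈ = Bd⊆CDS cds b∈ , inj₂ b∈
        ... | inj₂ f∈ with ∈-filter⁻ M? {xs = D} f∈
        ...   | v∈D , m = v∈D , inj₁ m
        conn : ConnectedOn R′ (_∈ Bd ++ filter M? D)
        conn u v u∈ v∈ with back u∈ | back v∈
        ... | u∈D , mu | v∈D , mv = subst₂ (WalkIn R′ _) (π-fix mu) (π-fix mv)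
              (walk-image π π∈ (λ _ _ → π-step) (CDS.conn cds u v u∈D v∈D))
        dom : ∀ {v} → M v → Dom R′ (Bd ++ filter M? D) v
        dom {v} m with CDS.dom cds v
        ... | inj₁ v∈ = inj₁ (∈-++⁺ʳ Bd (∈-filter⁺ M? v∈ m))
        ... | inj₂ (u , u∈ , e) = inj₂ (u , u∈′ (sub e) , e)
          where
          u∈′ : u ~ v ⊎ (MB u × MB v) → u ∈ Bd ++ filter M? D
          in-MB : MB u → u ∈ Bd ++ filter M? D
          in-MB (inj₁ mu) = ∈-++⁺ʳ Bd (∈-filter⁺ M? u∈ mu)
          in-MB (inj₂ b∈) = ∈-++⁺ˡ b∈
          u∈′ (inj₁ f) = in-MB (closed m (~sym f))
          u∈′ (inj₂ (mu , _)) = in-MB mu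

      -- Outside M a walk in D uses only edges of G until it reaches Bd, and the completion `T`
      -- connects Bd.
      replace : ∀ {D T} {b} → b ∈ Bd → CDS R′ D → Completes _~_ Bd M T → CDS _~_ (filter (¬? ∘ M?) D ++ T)
      replace {D} {T} {b₀} b₀∈ cds comp = record { dom = dom ; conn = λ u v u∈ v∈ →
          case to-Bd u∈ , to-Bd v∈ of λ where
            ((b , b∈ , w) , (b′ , b′∈ , w′)) → w ◅◅ walk-map C⊆ (Completes.conn comp b b′ (∈-++⁺ˡ b∈) (∈-++⁺ˡ b′∈)) ◅◅ walk-reverse ~sym w′ }
        where
        E : List V
        E = filter (¬? ∘ M?) D
        Bd⊆E : ∀ {b} → b ∈ Bd → b ∈ E
        Bd⊆E b∈ = ∈-filter⁺ (¬? ∘ M?) (Bd⊆CDS cds b∈) (Bd∉M b∈)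
        C⊆ : ∀ {v} → v ∈ Bd ++ T → v ∈ E ++ T
        C⊆ v∈ with ∈-++⁻ Bd v∈
        ... | inj₁ b∈ = ∈-++⁺ˡ (Bd⊆E b∈)
        ... | inj₂ t∈ = ∈-++⁺ʳ E t∈
        exit : ∀ {u v} → WalkIn R′ (_∈ D) u v → ¬ M u → v ∈ Bd → ∃[ b ] b ∈ Bd × WalkIn _~_ (_∈ E) u b
        exit [ u∈ ] ¬m v∈ = _ , v∈ , [ ∈-filter⁺ (¬? ∘ M?) u∈ ¬m ]
        exit {u} (step {w = w} u∈ e wk) ¬m v∈ with u ∈? Bd
        ... | yes b∈ = u , b∈ , [ Bd⊆E b∈ ]
        ... | no u∉ with sub e
        ...   | inj₂ (inj₁ m , _) = ⊥-elim (¬m m)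
        ...   | inj₂ (inj₂ b∈ , _) = ⊥-elim (u∉ b∈)
        ...   | inj₁ f with exit wk (λ mw → [ ¬m , u∉ ]′ (closed mw (~sym f))) v∈
        ...     | b , b∈ , wk′ = b , b∈ , step (∈-filter⁺ (¬? ∘ M?) u∈ ¬m) f wk′
        to-Bd : ∀ {u} → u ∈ E ++ T → ∃[ b ] b ∈ Bd × WalkIn _~_ (_∈ E ++ T) u b
        to-Bd {u} u∈ with ∈-++⁻ E u∈
        ... | inj₂ t∈ = b₀ , b₀∈ , walk-map C⊆ (Completes.conn comp u b₀ (∈-++⁺ʳ Bd t∈) (∈-++⁺ˡ b₀∈))
        ... | inj₁ e∈ with ∈-filter⁻ (¬? ∘ M?) {xs = D} e∈
        ...   | u∈D , ¬m with exit (CDS.conn cds u b₀ u∈D (Bd⊆CDS cds b₀∈)) ¬m b₀∈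
        ...     | b , b∈ , wk = b , b∈ , walk-map ∈-++⁺ˡ wk
        dom : ∀ v → Dom _~_ (E ++ T) v
        dom v with M? v
        ... | yes m with Completes.dom comp m
        ...   | inj₁ v∈ = inj₁ (C⊆ v∈)
        ...   | inj₂ (u , u∈ , f) = inj₂ (u , C⊆ u∈ , f)
        dom v | no ¬m with v ∈? Bd
        ... | yes b∈ = inj₁ (∈-++⁺ˡ (Bd⊆E b∈))
        ... | no v∉ with CDS.dom cds v
        ...   | inj₁ v∈ = inj₁ (∈-++⁺ˡ (∈-filter⁺ (¬? ∘ M?) v∈ ¬m))
        ...   | inj₂ (u , u∈ , e) with sub e
        ...     | inj₂ (_ , inj₁ m) = ⊥-elim (¬m m)
        ...     | inj₂ (_ , inj₂ b∈) = ⊥-elim (v∉ b∈)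
        ...     | inj₁ f = inj₂ (u , ∈-++⁺ˡ (∈-filter⁺ (¬? ∘ M?) u∈ (λ mu → [ ¬m , v∉ ]′ (closed mu f))) , f)

    module _ {k} (crit : Critical k G) {b} (b∈ : b ∈ Bd) where

      module Orig = Local _~_ id ~sym inj₁
      open Critical crit

      sub-add : ∀ {u v} → MB u → MB v → ∀ {x y} → addEdge _~_ u v x y → x ~ y ⊎ (MB x × MB y)
      sub-add mu mv (inj₁ e) = inj₁ e
      sub-add mu mv (inj₂ (inj₁ (refl , refl))) = inj₂ (mu , mv)
      sub-add mu mv (inj₂ (inj₂ (refl , refl))) = inj₂ (mv , mu)

      -- Take a set of fewer than k vertices for G + uv. Its part outside M together with `T` is a
      -- connected dominating set of G, so it has at least k vertices; hence the part inside M is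
      -- smaller than `T`.
      shrink : ∀ {u v T} → MB u → MB v → u ≢ v → ¬ u ~ v → Completes _~_ Bd M T →
               ∃[ T′ ] Completes (addEdge _~_ u v) Bd M T′ × length T′ < length T
      shrink {u} {v} {T} mu mv u≢v ¬e comp with improve u≢v ¬e
      ... | D , cds , small = filter M? D , L.restrict cds , ℕₚ.+-cancelʳ-< _ (length (filter M? D)) (length T) (ℕₚ.≤-trans (ℕₚ.≤-trans (s≤s (ℕₚ.≤-reflexive (≡-sym (length-filter-¬ M? D)))) small)
            (ℕₚ.≤-trans (lower (L.replace b∈ cds comp)) (ℕₚ.≤-reflexive (trans (Listₚ.length-++ (filter (¬? ∘ M?) D)) (ℕₚ.+-comm _ (length T))))))
        where
        module L = Local (addEdge _~_ u v) inj₁ addEdge-sym (sub-add mu mv)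

  record Region (c : V) (R : V → Set) : Set where
    field
      R? : Decidable R
      c∉R : ¬ R c
      closed : ∀ {u w} → R u → u ~ w → w ≢ c → R w
      nonempty : ∃[ r ] R r
      outside : ∃[ q ] q ≢ c × ¬ R q

    R⇒≢c : ∀ {v} → R v → v ≢ c
    R⇒≢c r refl = c∉R r

  region-piece : ∀ {c R} → Region c R → Piece (c ∷ []) R
  region-piece {c} {R} reg = record
    { M? = R?
    ; Bd∉M = λ { (here refl) → c∉R }
    ; closed = λ {u} {w} r e → case w ≟ c of λ where
        (yes eq) → inj₂ (here eq)
        (no w≢c) → inj₁ (closed r e w≢c)
    ; π = π
    ; π-fix = λ { {v} (inj₁ r) → π-in r ; {v} (inj₂ (here refl)) → π-out c∉R }
    ; π-out = λ ¬r → here (π-out ¬r)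
    ; π-adj = π-adj
    ; separates = λ { (here refl) → (λ v → v ≢ c × ¬ R v) , (λ v → ¬? (v ≟ c) ×-dec ¬? (R? v)) ,
        (λ { (v≢c , ¬r) → ¬r , λ { (here eq) → v≢c eq } }) ,
        (λ { (u≢c , ¬ru) e w≢c → w≢c , λ rw → ¬ru (closed rw (~sym e) u≢c) }) ,
        outside , (proj₁ nonempty , inj₁ (proj₂ nonempty) , R⇒≢c (proj₂ nonempty)) }
    }
    where
    open Region reg
    π : V → V
    π v with R? v
    ... | yes _ = v
    ... | no _ = c
    π-in : ∀ {v} → R v → π v ≡ v
    π-in {v} r with R? v
    ... | yes _ = refl
    ... | no ¬r = ⊥-elim (¬r r)
    π-out : ∀ {v} → ¬ R v → π v ≡ c
    π-out {v} ¬r with R? v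
    ... | yes r = ⊥-elim (¬r r)
    ... | no _ = refl
    π-adj : ∀ {u w} → u ~ w → π u ≡ π w ⊎ π u ~ π w
    π-adj {u} {w} e with R? u | R? w
    ... | yes _ | yes _ = inj₂ e
    ... | no _ | no _ = inj₁ refl
    ... | yes ru | no ¬rw with w ≟ c
    ...   | yes refl = inj₂ e
    ...   | no w≢c = ⊥-elim (¬rw (closed ru e w≢c))
    π-adj {u} {w} e | no ¬ru | yes rw with u ≟ c
    ...   | yes refl = inj₂ e
    ...   | no u≢c = ⊥-elim (¬ru (closed rw (~sym e) u≢c))

  HamFrom : V → (V → Set) → Set
  HamFrom c R = ∃[ e ] ∃[ ps ] Path c e ps × Unique ps × (∀ {v} → v ∈ ps → v ≡ c ⊎ R v) × (∀ {v} → v ≡ c ⊎ R v → v ∈ ps)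

  -- A path that is not longest gives way to a longer one, at most n times. So a path that misses a
  -- vertex may be treated as longest without a search.
  spanning : (B : RootedBlock G) → (∀ (L : Block.Longest G B) → ⊥) → ¬ HamFrom (RootedBlock.root B) (RootedBlock.R B) → ⊥
  spanning B no-longest ¬ham = extend n [-] ([] ∷ []) (λ { (here eq) → inj₁ eq }) (ℕₚ.m≤n+m n 1)
    where
    open RootedBlock B renaming (root to c)
    extend : ∀ fuel {e ps} → Path c e ps → Unique ps → (∀ {v} → v ∈ ps → v ≡ c ⊎ R v) → n ≤ length ps + fuel → ⊥
    extend fuel {e} {ps} p u sub bound with Finₚ.any? (λ v → R? v ×-dec ¬? (v ∈? ps))
    ... | no ¬any = ¬ham (e , ps , p , u , sub , λ where
            (inj₁ refl) → start∈ p
            {v} (inj₂ r) → decidable-stable (v ∈? ps) λ v∉ → ¬any (v , r , v∉))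
    extend zero {ps = ps} p u sub bound | yes (h , _ , h∉) =
      ℕₚ.<⇒≱ (s≤s (ℕₚ.≤-trans bound (ℕₚ.≤-reflexive (ℕₚ.+-identityʳ _))))
        (ℕₚ.≤-trans (unique-⊆⇒length≤ {xs = h ∷ ps} (All.tabulate (λ v∈ h≡v → h∉ (subst (_∈ ps) (≡-sym h≡v) v∈)) ∷ u) (λ {v} _ → ∈-allFin v))
                    (ℕₚ.≤-reflexive (Listₚ.length-tabulate {n = n} id)))
    extend (suc fuel) {e} {ps} p u sub bound | yes (h , Rh , h∉) = no-longest record
      { ps₀ = ps ; end₀ = e ; path₀ = p ; unique₀ = u ; in₀ = sub ; h = h ; Rh = Rh ; h∉ps₀ = h∉
      ; longest = λ {e′} {qs} q uq subq → ℕₚ.≮⇒≥ λ lt → extend fuel q uq subq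
          (ℕₚ.≤-trans bound (ℕₚ.≤-trans (ℕₚ.≤-reflexive (ℕₚ.+-suc (length ps) fuel)) (ℕₚ.+-monoˡ-≤ fuel lt))) }

  -- Ends with at most three further vertices

  module _ {k} (crit : Critical k G) where

    open Critical crit

    record End (c : V) (R : V → Set) : Set where
      field
        region : Region c R
        no-cut : ∀ {v} → R v → ¬ IsCutVertex G v
      open Region region public

    Comp : V → (V → Set) → List V → Set
    Comp c R T = Completes _~_ (c ∷ []) R T

    -- In `pair`, a single further vertex is represented by `s` and `t` being equal.
    data Small (R′ : Rel n) (c : V) (R : V → Set) : Set where
      none : (∀ {w} → R w → R′ c w) → Small R′ c R
      pair : ∀ {s t} → R s → R t → R′ c s → t ≡ s ⊎ R′ s t ⊎ R′ c t →
             (∀ {w} → R w → (w ≡ s ⊎ w ≡ t) ⊎ (R′ c w ⊎ R′ s w ⊎ R′ t w)) → Small R′ c R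

    first-step : ∀ {R′ : Rel n} {P : V → Set} {a b} → WalkIn R′ P a b → a ≢ b → ∃[ w ] P w × w ≢ a × R′ a w
    first-step [ _ ] a≢b = ⊥-elim (a≢b refl)
    first-step {a = a} (step {w = w} p e wk) a≢b with w ≟ a
    ... | yes refl = first-step wk a≢b
    ... | no w≢a = w , walk-start wk , w≢a , e

    module Decode {R′ : Rel n} (R′-sym : ∀ {x y} → R′ x y → R′ y x) {c : V} {R : V → Set} (c∉R : ¬ R c) where

      one : ∀ {s} → Completes R′ (c ∷ []) R (s ∷ []) → R s × R′ c s × (∀ {w} → R w → w ≡ s ⊎ R′ c w ⊎ R′ s w)
      one {s} comp = Rs , cs , dom
        where
        open Completes comp hiding (dom)
        Rs : R s
        Rs = within (here refl)
        cs : R′ c s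
        cs with first-step (conn c s (here refl) (there (here refl))) (λ { refl → c∉R Rs })
        ... | _ , here refl , w≢c , _ = ⊥-elim (w≢c refl)
        ... | _ , there (here refl) , _ , e = e
        dom : ∀ {w} → R w → w ≡ s ⊎ R′ c w ⊎ R′ s w
        dom Rw with Completes.dom comp Rw
        ... | inj₁ (here refl) = ⊥-elim (c∉R Rw)
        ... | inj₁ (there (here eq)) = inj₁ eq
        ... | inj₂ (_ , here refl , e) = inj₂ (inj₁ e)
        ... | inj₂ (_ , there (here refl) , e) = inj₂ (inj₂ e)

      decode : ∀ {T} → Completes R′ (c ∷ []) R T → length T ≤ 2 → Small R′ c R
      decode {[]} comp _ = none λ Rw → case Completes.dom comp Rw of λ where
        (inj₁ (here refl)) → ⊥-elim (c∉R Rw)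
        (inj₂ (_ , here refl , e)) → e
      decode {s ∷ []} comp _ with one comp
      ... | Rs , cs , dom = pair Rs Rs cs (inj₁ refl) λ Rw → case dom Rw of λ where
        (inj₁ eq) → inj₁ (inj₁ eq)
        (inj₂ (inj₁ e)) → inj₂ (inj₁ e)
        (inj₂ (inj₂ e)) → inj₂ (inj₂ (inj₁ e))
      decode {s ∷ t ∷ []} comp _ = go (first-step (conn c s (here refl) (there (here refl))) (λ { refl → c∉R Rs }))
        where
        open Completes comp hiding (dom)
        Rs : R s
        Rs = within (here refl)
        Rt : R t
        Rt = within (there (here refl))
        dom : ∀ {w} → R w → (w ≡ s ⊎ w ≡ t) ⊎ (R′ c w ⊎ R′ s w ⊎ R′ t w)
        dom Rw with Completes.dom comp Rw
        ... | inj₁ (here refl) = ⊥-elim (c∉R Rw)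
        ... | inj₁ (there (here eq)) = inj₁ (inj₁ eq)
        ... | inj₁ (there (there (here eq))) = inj₁ (inj₂ eq)
        ... | inj₂ (_ , here refl , e) = inj₂ (inj₁ e)
        ... | inj₂ (_ , there (here refl) , e) = inj₂ (inj₂ (inj₁ e))
        ... | inj₂ (_ , there (there (here refl)) , e) = inj₂ (inj₂ (inj₂ e))
        dom-swap : ∀ {w} → (w ≡ s ⊎ w ≡ t) ⊎ (R′ c w ⊎ R′ s w ⊎ R′ t w) → (w ≡ t ⊎ w ≡ s) ⊎ (R′ c w ⊎ R′ t w ⊎ R′ s w)
        dom-swap (inj₁ (inj₁ eq)) = inj₁ (inj₂ eq)
        dom-swap (inj₁ (inj₂ eq)) = inj₁ (inj₁ eq)
        dom-swap (inj₂ (inj₁ e)) = inj₂ (inj₁ e)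
        dom-swap (inj₂ (inj₂ (inj₁ e))) = inj₂ (inj₂ (inj₂ e))
        dom-swap (inj₂ (inj₂ (inj₂ e))) = inj₂ (inj₂ (inj₁ e))
        link : ∀ {x y} → y ∈ c ∷ s ∷ t ∷ [] → R y → (∀ {w} → w ∈ c ∷ s ∷ t ∷ [] → w ≢ y → w ≡ c ⊎ w ≡ x) → y ≡ x ⊎ R′ x y ⊎ R′ c y
        link {x} {y} y∈ Ry only with first-step (conn y c y∈ (here refl)) (λ { refl → c∉R Ry })
        ... | w , w∈ , w≢y , e with only w∈ w≢y
        ...   | inj₁ refl = inj₂ (inj₂ (R′-sym e))
        ...   | inj₂ refl = inj₂ (inj₁ (R′-sym e))
        go : (∃[ w ] w ∈ c ∷ s ∷ t ∷ [] × w ≢ c × R′ c w) → Small R′ c R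
        go (_ , here refl , w≢c , _) = ⊥-elim (w≢c refl)
        go (_ , there (here refl) , _ , cs) = pair Rs Rt cs
          (link {s} {t} (there (there (here refl))) Rt λ where
            (here eq) _ → inj₁ eq
            (there (here eq)) _ → inj₂ eq
            (there (there (here eq))) ne → ⊥-elim (ne eq)) dom
        go (_ , there (there (here refl)) , _ , ct) = pair Rt Rs ct
          (link {t} {s} (there (here refl)) Rs λ where
            (here eq) _ → inj₁ eq
            (there (here eq)) ne → ⊥-elim (ne eq)
            (there (there (here eq))) _ → inj₂ eq) (λ Rw → dom-swap (dom Rw))
      decode {_ ∷ _ ∷ _ ∷ _} comp (s≤s (s≤s ()))

    module EndHam {c R} (E : End c R) (T₀ : List V) (comp₀ : Comp c R T₀)
                  (minimal : ∀ {T} → Comp c R T → length T < length T₀ → ⊥) where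

      open End E

      piece = region-piece region
      module PF = PieceFacts piece

      better : ∀ {u v} → R u ⊎ u ≡ c → R v ⊎ v ≡ c → u ≢ v → ¬ u ~ v → ∃[ T ] Completes (addEdge _~_ u v) (c ∷ []) R T × length T < length T₀
      better mu mv u≢v ¬e = PF.shrink crit (here refl) (map₂ here mu) (map₂ here mv) u≢v ¬e comp₀

      -- The root belongs to every completion, so it does what an edge between two of its neighbours
      -- would do: it dominates both, and walks can pass through it.
      clique : ∀ {a b} → R a → R b → c ~ a → c ~ b → a ≢ b → a ~ b
      clique {a} {b} Ra Rb ca cb a≢b = decidable-stable (dec G a b) go
        where
        detour : ∀ {T u v} → WalkIn (addEdge _~_ a b) (_∈ c ∷ T) u v → WalkIn _~_ (_∈ c ∷ T) u v
        detour [ p ] = [ p ]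
        detour (step p (inj₁ e) w) = step p e (detour w)
        detour (step p (inj₂ (inj₁ (refl , refl))) w) = step p (~sym ca) (step (here refl) cb (detour w))
        detour (step p (inj₂ (inj₂ (refl , refl))) w) = step p (~sym cb) (step (here refl) ca (detour w))
        go : ¬ ¬ a ~ b
        go ¬e with better (inj₁ Ra) (inj₁ Rb) a≢b ¬e
        ... | T , comp , small = minimal (record
          { within = Completes.within comp
          ; conn = λ u v u∈ v∈ → detour (Completes.conn comp u v u∈ v∈)
          ; dom = λ Rv → case Completes.dom comp Rv of λ where
              (inj₁ v∈) → inj₁ v∈
              (inj₂ (u , u∈ , inj₁ e)) → inj₂ (u , u∈ , e)
              (inj₂ (u , u∈ , inj₂ (inj₁ (refl , refl)))) → inj₂ (c , here refl , cb)
              (inj₂ (u , u∈ , inj₂ (inj₂ (refl , refl)))) → inj₂ (c , here refl , ca) }) small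

      B : RootedBlock G
      B = record
        { root = c ; R = R ; R? = R? ; root∉R = c∉R ; closed = closed ; clique = clique
        ; connected = λ h → connected h c
        ; nonseparating = λ {h} {x} Rh Rx h≢x → decidable-stable (walk? G (λ v → ¬? (v ≟ x)) h c) λ ¬w →
            no-cut Rx (h , c , h≢x , (λ { refl → c∉R Rx }) , ¬w) }

      open Criticality G B
      module Bl = Block G B
      open Bl using (A; A-clique)

      completes-pair : ∀ {s t} → A s → R t → t ≡ s ⊎ s ~ t → (∀ {u} → R u → Nbr u s ⊎ Nbr u t) → Comp c R (s ∷ t ∷ [])
      completes-pair {s} {t} (Rs , cs) Rt link dom = record
        { within = λ { (here refl) → Rs ; (there (here refl)) → Rt }
        ; conn = λ u v u∈ v∈ → walk-reverse ~sym (from-c u∈) ◅◅ from-c v∈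
        ; dom = λ Ru → case dom Ru of λ where
            (inj₁ (inj₁ refl)) → inj₁ (there (here refl))
            (inj₁ (inj₂ e)) → inj₂ (s , there (here refl) , e)
            (inj₂ (inj₁ refl)) → inj₁ (there (there (here refl)))
            (inj₂ (inj₂ e)) → inj₂ (t , there (there (here refl)) , e) }
        where
        from-c : ∀ {v} → v ∈ c ∷ s ∷ t ∷ [] → WalkIn _~_ (_∈ c ∷ s ∷ t ∷ []) c v
        from-c (here refl) = [ here refl ]
        from-c (there (here refl)) = step (here refl) cs [ there (here refl) ]
        from-c (there (there (here refl))) = [ via-s , (λ e → step (here refl) cs (step (there (here refl)) e [ there (there (here refl)) ])) ]′ link
          where
          via-s : t ≡ s → WalkIn _~_ (_∈ c ∷ s ∷ t ∷ []) c t
          via-s t≡s = subst (WalkIn _~_ (_∈ c ∷ s ∷ t ∷ []) c) (≡-sym t≡s) (step (here refl) cs [ there (here refl) ])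

      c-edge : ∀ {x y w} → R x → R y → addEdge _~_ x y c w → c ~ w
      c-edge Rx Ry (inj₁ e) = e
      c-edge Rx Ry (inj₂ (inj₁ (refl , _))) = ⊥-elim (c∉R Rx)
      c-edge Rx Ry (inj₂ (inj₂ (refl , _))) = ⊥-elim (c∉R Ry)

      nbr-A : ∀ {s w} → A s → R w → c ~ w → Nbr w s
      nbr-A {s} {w} As Rw cw with w ≟ s
      ... | yes eq = inj₁ eq
      ... | no w≢s = inj₂ (A-clique As (Rw , cw) (≢-sym w≢s))

      nbr-add : ∀ {x y s w} → addEdge _~_ x y s w → Nbr w s ⊎ ((s ≡ x × w ≡ y) ⊎ (s ≡ y × w ≡ x))
      nbr-add (inj₁ e) = inj₁ (inj₂ e)
      nbr-add (inj₂ new) = inj₂ new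

      -- The smaller completion is one vertex `s`. By minimality it does not complete in G, so `s`
      -- is an end of the new edge and the other end is the only vertex it misses.
      crit₂ : length T₀ ≤ 2 → Critical₂
      crit₂ T₀≤2 {x} {y} Rx Ry x≢y ¬e with better (inj₁ Rx) (inj₁ Ry) x≢y ¬e
      ... | _ ∷ _ ∷ _ , comp , small = ⊥-elim (ℕₚ.<⇒≱ (ℕₚ.≤-trans small T₀≤2) (s≤s (s≤s z≤n)))
      ... | [] , comp , small = ⊥-elim (minimal (record
              { within = λ () ; conn = λ { u v (here refl) (here refl) → [ here refl ] ; u v (there ()) _ ; u v (here _) (there ()) }
              ; dom = λ Ru → case Completes.dom comp Ru of λ where
                  (inj₁ u∈) → inj₁ u∈
                  (inj₂ (_ , here refl , e)) → inj₂ (c , here refl , c-edge Rx Ry e) }) small)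
      ... | s ∷ [] , comp , small with Decode.one addEdge-sym c∉R comp
      ...   | Rs , cs′ , dom = go (Nbr? x s) (Nbr? y s)
        where
        As : A s
        As = Rs , c-edge Rx Ry cs′
        dom′ : ∀ {w} → R w → Nbr w s ⊎ ((s ≡ x × w ≡ y) ⊎ (s ≡ y × w ≡ x))
        dom′ Rw with dom Rw
        ... | inj₁ eq = inj₁ (inj₁ eq)
        ... | inj₂ (inj₁ e) = inj₁ (nbr-A As Rw (c-edge Rx Ry e))
        ... | inj₂ (inj₂ e) = nbr-add e
        go : Dec (Nbr x s) → Dec (Nbr y s) → (A x × (∀ {u} → R u → u ≢ y → Nbr u x)) ⊎ (A y × (∀ {u} → R u → u ≢ x → Nbr u y))
        go (no ¬xs) _ with dom′ Rx
        ... | inj₁ nb = ⊥-elim (¬xs nb)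
        ... | inj₂ (inj₁ (refl , _)) = ⊥-elim (¬xs (inj₁ refl))
        ... | inj₂ (inj₂ (refl , _)) = inj₂ (As , λ {u} Ru u≢x → case dom′ Ru of λ where
                (inj₁ nb) → nb
                (inj₂ (inj₁ (_ , u≡y))) → inj₁ u≡y
                (inj₂ (inj₂ (_ , u≡x))) → ⊥-elim (u≢x u≡x))
        go (yes xs) (no ¬ys) with dom′ Ry
        ... | inj₁ nb = ⊥-elim (¬ys nb)
        ... | inj₂ (inj₂ (refl , _)) = ⊥-elim (¬ys (inj₁ refl))
        ... | inj₂ (inj₁ (refl , _)) = inj₁ (As , λ {u} Ru u≢y → case dom′ Ru of λ where
                (inj₁ nb) → nb
                (inj₂ (inj₁ (_ , u≡y))) → ⊥-elim (u≢y u≡y)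
                (inj₂ (inj₂ (_ , u≡x))) → inj₁ u≡x)
        go (yes xs) (yes ys) = ⊥-elim (minimal (record
            { within = λ { (here refl) → Rs }
            ; conn = λ u v u∈ v∈ → walk-reverse ~sym (from-c u∈) ◅◅ from-c v∈
            ; dom = λ Ru → case dom-all Ru of λ where
                (inj₁ refl) → inj₁ (there (here refl))
                (inj₂ e) → inj₂ (s , there (here refl) , e) }) small)
          where
          dom-all : ∀ {u} → R u → Nbr u s
          dom-all Ru with dom′ Ru
          ... | inj₁ nb = nb
          ... | inj₂ (inj₁ (_ , refl)) = ys
          ... | inj₂ (inj₂ (_ , refl)) = xs
          from-c : ∀ {v} → v ∈ c ∷ s ∷ [] → WalkIn _~_ (_∈ c ∷ s ∷ []) c v
          from-c (here refl) = [ here refl ]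
          from-c (there (here refl)) = step (here refl) (proj₂ As) [ there (here refl) ]

      module Three (three : length T₀ ≡ 3) where

        not-small : ∀ {s t} → A s → R t → t ≡ s ⊎ s ~ t → ¬ (∀ {u} → R u → Nbr u s ⊎ Nbr u t)
        not-small As Rt link dom = minimal (completes-pair As Rt link dom) (ℕₚ.≤-reflexive (≡-sym three))

        few : ∀ (T : List V) → length T < length T₀ → length T ≤ 2
        few T small = s≤s⁻¹ (ℕₚ.≤-trans small (ℕₚ.≤-reflexive three))

        -- By minimality the two chosen vertices do not complete in G. So the new edge is needed,
        -- either to link them or to dominate one of its ends.
        pair₃ : ∀ {x y} → R x → R y → x ≢ y → ¬ x ~ y → Pair x y
        pair₃ {x} {y} Rx Ry x≢y ¬e with better (inj₁ Rx) (inj₁ Ry) x≢y ¬e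
        ... | T , comp , small with Decode.decode addEdge-sym c∉R comp (few T small)
        ...   | none dom = ⊥-elim (minimal {[]} (record
                { within = λ () ; conn = λ { u v (here refl) (here refl) → [ here refl ] ; u v (there ()) _ ; u v (here _) (there ()) }
                ; dom = λ Ru → inj₂ (c , here refl , c-edge Rx Ry (dom Ru)) }) (ℕₚ.≤-trans (s≤s z≤n) (ℕₚ.≤-reflexive (≡-sym three))))
        ...   | pair {s} {t} Rs Rt cs′ link dom = split link
          where
          As : A s
          As = Rs , c-edge Rx Ry cs′
          New : V → V → Set
          New u w = (u ≡ x × w ≡ y) ⊎ (u ≡ y × w ≡ x)
          dom′ : ∀ {w} → R w → (Nbr w s ⊎ Nbr w t) ⊎ (New s w ⊎ New t w)
          dom′ Rw with dom Rw
          ... | inj₁ (inj₁ eq) = inj₁ (inj₁ (inj₁ eq))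
          ... | inj₁ (inj₂ eq) = inj₁ (inj₂ (inj₁ eq))
          ... | inj₂ (inj₁ e) = inj₁ (inj₁ (nbr-A As Rw (c-edge Rx Ry e)))
          ... | inj₂ (inj₂ (inj₁ e)) = [ (λ nb → inj₁ (inj₁ nb)) , (λ new → inj₂ (inj₁ new)) ]′ (nbr-add e)
          ... | inj₂ (inj₂ (inj₂ e)) = [ (λ nb → inj₁ (inj₂ nb)) , (λ new → inj₂ (inj₂ new)) ]′ (nbr-add e)
          new-end : ∀ {u w} → New u w → w ≡ x ⊎ w ≡ y
          new-end (inj₁ (_ , eq)) = inj₂ eq
          new-end (inj₂ (_ , eq)) = inj₁ eq
          end : ∀ {w} → R w → (Nbr w s ⊎ Nbr w t) ⊎ (w ≡ x ⊎ w ≡ y)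
          end Rw with dom′ Rw
          ... | inj₁ nb = inj₁ nb
          ... | inj₂ (inj₁ new) = inj₂ (new-end new)
          ... | inj₂ (inj₂ new) = inj₂ (new-end new)
          swapped : t ≡ s ⊎ s ~ t → s ≡ t ⊎ t ~ s
          swapped (inj₁ eq) = inj₁ (≡-sym eq)
          swapped (inj₂ e) = inj₂ (~sym e)
          D? : ∀ w → Dec (Nbr w s ⊎ Nbr w t)
          D? w = Nbr? w s ⊎-dec Nbr? w t
          new-pair : New s t → Pair x y
          new-pair (inj₁ (refl , refl)) = dom₂ λ Ru → case end Ru of λ where
            (inj₁ nb) → nb
            (inj₂ (inj₁ eq)) → inj₁ (inj₁ eq)
            (inj₂ (inj₂ eq)) → inj₂ (inj₁ eq)
          new-pair (inj₂ (refl , refl)) = dom₂ λ Ru → case end Ru of λ where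
            (inj₁ (inj₁ nb)) → inj₂ nb
            (inj₁ (inj₂ nb)) → inj₁ nb
            (inj₂ (inj₁ eq)) → inj₁ (inj₁ eq)
            (inj₂ (inj₂ eq)) → inj₂ (inj₁ eq)
          -- The set {s , t} = {a , z} misses only b, for {a , b} = {x , y}.
          mk : ∀ {a b z} → R z → z ≡ a ⊎ a ~ z → A a ⊎ A z → ¬ Nbr b z →
               (∀ {u} → Nbr u s ⊎ Nbr u t → Nbr u a ⊎ Nbr u z) → (∀ {w} → w ≡ x ⊎ w ≡ y → w ≡ a ⊎ w ≡ b) → Arrow a b z
          mk {a} {b} Rz link hits ¬bz re ends = record
            { Rz = Rz ; link = link ; hits = hits ; z≢y = λ { refl → ¬bz (inj₁ refl) } ; z≁y = λ e → ¬bz (inj₂ e)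
            ; dom = λ Ru u≢b → case end Ru of λ where
                (inj₁ nb) → re nb
                (inj₂ eq) → case ends eq of λ where
                  (inj₁ u≡a) → inj₁ (inj₁ u≡a)
                  (inj₂ u≡b) → ⊥-elim (u≢b u≡b) }
          linked-pair : t ≡ s ⊎ s ~ t → Pair x y
          linked-pair lk with D? x | D? y
          ... | yes dx | yes dy = ⊥-elim (not-small As Rt lk λ Ru → case end Ru of λ where
                  (inj₁ nb) → nb
                  (inj₂ (inj₁ refl)) → dx
                  (inj₂ (inj₂ refl)) → dy)
          ... | _ | no ¬dy with dom′ Ry
          ...   | inj₁ nb = ⊥-elim (¬dy nb)
          ...   | inj₂ (inj₁ (inj₂ (refl , _))) = ⊥-elim (¬dy (inj₁ (inj₁ refl)))
          ...   | inj₂ (inj₂ (inj₂ (refl , _))) = ⊥-elim (¬dy (inj₂ (inj₁ refl)))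
          ...   | inj₂ (inj₁ (inj₁ (refl , _))) = arrow (mk Rt lk (inj₁ As) (¬dy ∘ inj₂) id id)
          ...   | inj₂ (inj₂ (inj₁ (refl , _))) = arrow (mk Rs (swapped lk) (inj₂ As) (¬dy ∘ inj₁) swap id)
          linked-pair lk | no ¬dx | yes _ with dom′ Rx
          ...   | inj₁ nb = ⊥-elim (¬dx nb)
          ...   | inj₂ (inj₁ (inj₁ (refl , _))) = ⊥-elim (¬dx (inj₁ (inj₁ refl)))
          ...   | inj₂ (inj₂ (inj₁ (refl , _))) = ⊥-elim (¬dx (inj₂ (inj₁ refl)))
          ...   | inj₂ (inj₁ (inj₂ (refl , _))) = arrow′ (mk Rt lk (inj₁ As) (¬dx ∘ inj₂) id swap)
          ...   | inj₂ (inj₂ (inj₂ (refl , _))) = arrow′ (mk Rs (swapped lk) (inj₂ As) (¬dx ∘ inj₁) swap swap)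
          split : t ≡ s ⊎ addEdge _~_ x y s t ⊎ addEdge _~_ x y c t → Pair x y
          split (inj₁ eq) = linked-pair (inj₁ eq)
          split (inj₂ (inj₁ (inj₁ e))) = linked-pair (inj₂ e)
          split (inj₂ (inj₁ (inj₂ new))) = new-pair new
          split (inj₂ (inj₂ e)) = linked-pair (nbr-A As Rt (c-edge Rx Ry e))

        -- If `v` is chosen, the new edge may link it to the root, which is `through`. If not, it
        -- can only dominate `v`, which is then missed in G: `away`.
        root-pair₃ : ∀ {v} → R v → ¬ c ~ v → RootPair v
        root-pair₃ {v} Rv c≁v with better (inj₂ refl) (inj₁ Rv) (λ { refl → c∉R Rv }) c≁v
        ... | T , comp , small with Decode.decode addEdge-sym c∉R comp (few T small)
        ...   | none dom = through Rv (inj₁ refl) λ Ru c≁u → inj₁ (inj₁ (v-edge (dom Ru) c≁u))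
          where
          v-edge : ∀ {u} → addEdge _~_ c v c u → ¬ c ~ u → u ≡ v
          v-edge (inj₁ e) c≁u = ⊥-elim (c≁u e)
          v-edge (inj₂ (inj₁ (_ , eq))) _ = eq
          v-edge (inj₂ (inj₂ (eq , _))) _ = ⊥-elim (c∉R (subst R (≡-sym eq) Rv))
        ...   | pair {s} {t} Rs Rt cs′ link dom = split (s ≟ v) (t ≟ v)
          where
          c-add : ∀ {u} → addEdge _~_ c v c u → u ≡ v ⊎ c ~ u
          c-add (inj₁ e) = inj₂ e
          c-add (inj₂ (inj₁ (_ , eq))) = inj₁ eq
          c-add (inj₂ (inj₂ (eq , _))) = ⊥-elim (c∉R (subst R (≡-sym eq) Rv))
          R-add : ∀ {a u} → R a → R u → addEdge _~_ c v a u → a ~ u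
          R-add Ra Ru (inj₁ e) = e
          R-add Ra Ru (inj₂ (inj₁ (refl , _))) = ⊥-elim (c∉R Ra)
          R-add Ra Ru (inj₂ (inj₂ (_ , refl))) = ⊥-elim (c∉R Ru)
          dom′ : ∀ {u} → R u → (Nbr u s ⊎ Nbr u t) ⊎ (u ≡ v ⊎ c ~ u)
          dom′ Ru with dom Ru
          ... | inj₁ (inj₁ eq) = inj₁ (inj₁ (inj₁ eq))
          ... | inj₁ (inj₂ eq) = inj₁ (inj₂ (inj₁ eq))
          ... | inj₂ (inj₁ e) = inj₂ (c-add e)
          ... | inj₂ (inj₂ (inj₁ e)) = inj₁ (inj₁ (inj₂ (R-add Rs Ru e)))
          ... | inj₂ (inj₂ (inj₂ e)) = inj₁ (inj₂ (inj₂ (R-add Rt Ru e)))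
          split : Dec (s ≡ v) → Dec (t ≡ v) → RootPair v
          split (yes refl) _ = through Rt lk λ Ru c≁u → case dom′ Ru of λ where
              (inj₁ nb) → nb
              (inj₂ (inj₁ eq)) → inj₁ (inj₁ eq)
              (inj₂ (inj₂ e)) → ⊥-elim (c≁u e)
            where
            lk : t ≡ s ⊎ s ~ t ⊎ c ~ t
            lk = [ inj₁ , [ (λ e → inj₂ (inj₁ (R-add Rs Rt e))) , (λ e → [ inj₁ , (λ f → inj₂ (inj₂ f)) ]′ (c-add e)) ]′ ]′ link
          split (no s≢v) (yes refl) = through Rs (inj₂ (inj₂ cs)) λ Ru c≁u → case dom′ Ru of λ where
              (inj₁ (inj₁ nb)) → inj₂ nb
              (inj₁ (inj₂ nb)) → inj₁ nb
              (inj₂ (inj₁ eq)) → inj₁ (inj₁ eq)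
              (inj₂ (inj₂ e)) → ⊥-elim (c≁u e)
            where
            cs : c ~ s
            cs = [ (λ eq → ⊥-elim (s≢v eq)) , id ]′ (c-add cs′)
          split (no s≢v) (no t≢v) = away As Rt lk (λ nb → missed (inj₁ nb)) (λ nb → missed (inj₂ nb)) λ Ru u≢v → case dom′ Ru of λ where
              (inj₁ nb) → nb
              (inj₂ (inj₁ eq)) → ⊥-elim (u≢v eq)
              (inj₂ (inj₂ e)) → inj₁ (nbr-A As Ru e)
            where
            As : A s
            As = Rs , [ (λ eq → ⊥-elim (s≢v eq)) , id ]′ (c-add cs′)
            lk : t ≡ s ⊎ s ~ t
            lk = [ inj₁ , [ (λ e → inj₂ (R-add Rs Rt e)) , (λ e → [ (λ eq → ⊥-elim (t≢v eq)) , nbr-A As Rt ]′ (c-add e)) ]′ ]′ link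
            missed : ¬ (Nbr v s ⊎ Nbr v t)
            missed nb = not-small As Rt lk λ Ru → case dom′ Ru of λ where
              (inj₁ nb′) → nb′
              (inj₂ (inj₁ refl)) → nb
              (inj₂ (inj₂ e)) → inj₁ (nbr-A As Ru e)

        crit₃ : Critical₃
        crit₃ = record { pair = pair₃ ; rootPair = root-pair₃ ; notSmall = not-small }

      no-longest : length T₀ ≤ 3 → Block.Longest G B → ⊥
      no-longest T₀≤3 L with length T₀ ℕₚ.≟ 3
      ... | yes three = ThreeMore.no-longest₃ G B L (Three.crit₃ three) (Block.Longest.path₀ L , ↭-refl)
      ... | no ¬three = LongFacts.no-longest₂ G B L (crit₂ (s≤s⁻¹ (ℕₚ.≤∧≢⇒< T₀≤3 ¬three))) (Block.Longest.path₀ L , ↭-refl)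

    -- By induction a smaller completion already gives the path, so the present one may be taken as
    -- minimal.
    end-path : ∀ {c R} → End c R → ∀ m {T} → Comp c R T → length T < m → length T ≤ 3 → ¬ ¬ HamFrom c R
    end-path E (suc m) {T} comp lt T≤3 ¬ham = spanning EH.B (EH.no-longest T≤3) ¬ham
      where
      smaller : ∀ {T′} → Comp _ _ T′ → length T′ < length T → ⊥
      smaller comp′ small = end-path E m comp′ (ℕₚ.≤-trans small (s≤s⁻¹ lt)) (ℕₚ.≤-trans (ℕₚ.<⇒≤ small) T≤3) ¬ham
      module EH = EndHam E T comp smaller

-- Ends with at most one further vertex

module Ends {n : ℕ} (G : Graph n) {k} (crit : Critical k G) (4≤k : 4 ≤ k) where

  open Regions G
  open Critical crit

  -- An end that needs at most one further vertex: R is a clique in which at most w is not adjacent to c.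
  record Tight (c : V) (R : V → Set) : Set where
    field
      w : V
      Rw : R w
      others : ∀ {u} → R u → u ≢ w → c ~ u
      cliq : ∀ {u v} → R u → R v → u ≢ v → u ~ v
      X : List V
      comp : Comp crit c R X
      X≤1 : length X ≤ 1
      loose : X ≡ [] ⊎ ¬ c ~ w

  -- Any edge added in R and the root leaves an empty completion, so the root dominates R by itself.
  -- If some `w` is not adjacent to the root, the pair of root and `w` is therefore the only one
  -- missing; if there is no such `w`, nothing can be missing.
  tight : ∀ {c R} → Region c R → ∀ {T} → Comp crit c R T → length T ≤ 1 → Tight c R
  tight {c} {R} reg {T} comp T≤1 with Finₚ.any? (λ u → Region.R? reg u ×-dec ¬? (dec G c u))
  ... | no ¬any = record
      { w = proj₁ nonempty ; Rw = proj₂ nonempty ; others = λ Ru _ → c~R Ru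
      ; cliq = λ {u} {v} Ru Rv u≢v → decidable-stable (dec G u v) λ ¬e → case shrink crit (here refl) (inj₁ Ru) (inj₁ Rv) u≢v ¬e comp[] of λ where
          (_ , _ , ())
      ; X = [] ; comp = comp[] ; X≤1 = z≤n ; loose = inj₁ refl }
    where
    open Region reg
    open PieceFacts (region-piece reg)
    c~R : ∀ {u} → R u → c ~ u
    c~R {u} Ru = decidable-stable (dec G c u) λ ¬e → ¬any (u , Ru , ¬e)
    comp[] : Comp crit c R []
    comp[] = record { within = λ () ; conn = λ { u v (here refl) (here refl) → [ here refl ] ; u v (there ()) _ ; u v (here _) (there ()) }
                    ; dom = λ Ru → inj₂ (c , here refl , c~R Ru) }
  ... | yes (w , Rw , c≁w) = record
      { w = w ; Rw = Rw
      ; others = λ {u} Ru u≢w → decidable-stable (dec G c u) λ ¬e →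
          [ u≢w ∘ ≡-sym , c≁w ]′ (c-new (only-root (inj₂ (here refl)) (inj₁ Ru) (λ { refl → c∉R Ru }) ¬e))
      ; cliq = λ {u} {v} Ru Rv u≢v → decidable-stable (dec G u v) λ ¬e → c≁w (R-new Ru Rv (only-root (inj₁ Ru) (inj₁ Rv) u≢v ¬e))
      ; X = T ; comp = comp ; X≤1 = T≤1 ; loose = inj₂ c≁w }
    where
    open Region reg
    open PieceFacts (region-piece reg)
    only-root : ∀ {u v} → MB u → MB v → u ≢ v → ¬ u ~ v → addEdge _~_ u v c w
    only-root mu mv u≢v ¬e with shrink crit (here refl) mu mv u≢v ¬e comp
    ... | _ ∷ _ , _ , small = ⊥-elim (ℕₚ.<⇒≱ small (ℕₚ.≤-trans T≤1 (s≤s z≤n)))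
    ... | [] , comp′ , _ with Completes.dom comp′ Rw
    ...   | inj₁ (here refl) = ⊥-elim (c∉R Rw)
    ...   | inj₂ (_ , here refl , e) = e
    c-new : ∀ {u} → addEdge _~_ c u c w → w ≡ u ⊎ c ~ w
    c-new (inj₁ e) = inj₂ e
    c-new (inj₂ (inj₁ (_ , eq))) = inj₁ eq
    c-new (inj₂ (inj₂ (_ , eq))) = ⊥-elim (c∉R (subst R eq Rw))
    R-new : ∀ {u v} → R u → R v → addEdge _~_ u v c w → c ~ w
    R-new Ru Rv (inj₁ e) = e
    R-new Ru Rv (inj₂ (inj₁ (refl , _))) = ⊥-elim (c∉R Ru)
    R-new Ru Rv (inj₂ (inj₂ (refl , _))) = ⊥-elim (c∉R Rv)

  record TwoEnds : Set₁ where
    field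
      {c₁ c₂} : V
      {R₁ R₂} : V → Set
      reg₁ : Region c₁ R₁
      reg₂ : Region c₂ R₂
      t₁ : Tight c₁ R₁
      t₂ : Tight c₂ R₂
      disjoint : ∀ {v} → R₁ v → ¬ R₂ v
      c₁∉R₂ : ¬ R₂ c₁
      c₂∉R₁ : ¬ R₁ c₂

  swap-ends : TwoEnds → TwoEnds
  swap-ends E = record { reg₁ = reg₂ ; reg₂ = reg₁ ; t₁ = t₂ ; t₂ = t₁ ; disjoint = λ r₂ r₁ → disjoint r₁ r₂ ; c₁∉R₂ = c₂∉R₁ ; c₂∉R₁ = c₁∉R₂ }
    where open TwoEnds E

  leave : ∀ {c R a b} {P : V → Set} → Region c R → WalkIn _~_ P a b → R a → ¬ R b → ∃[ y ] P y × R y × y ~ c × P c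
  leave reg [ _ ] Ra ¬Rb = ⊥-elim (¬Rb Ra)
  leave {c} reg (step {w = w} p e wk) Ra ¬Rb with w ≟ c
  ... | yes refl = _ , p , Ra , e , walk-start wk
  ... | no w≢c = leave reg wk (Region.closed reg Ra e w≢c) ¬Rb

  enter⇒c : ∀ {c R u v} → Region c R → R u → u ~ v → ¬ R v → v ≡ c
  enter⇒c {c} {v = v} reg Ru e ¬Rv = decidable-stable (v ≟ c) λ v≢c → ¬Rv (Region.closed reg Ru e v≢c)

  module Two (E : TwoEnds) where
    open TwoEnds E public
    open Region reg₁ public using () renaming (R? to R₁?; c∉R to c₁∉R₁)
    open Region reg₂ public using () renaming (R? to R₂?; c∉R to c₂∉R₂)
    open Tight t₁ public using () renaming (w to w₁; Rw to Rw₁; X to X₁; comp to comp₁; X≤1 to X₁≤1; loose to loose₁; others to others₁; cliq to cliq₁)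
    open Tight t₂ public using () renaming (w to w₂; Rw to Rw₂; X to X₂; comp to comp₂; X≤1 to X₂≤1; loose to loose₂)

    Mid : V → Set
    Mid v = ¬ R₁ v × ¬ R₂ v

    bound : ∀ E → c₁ ∈ E → c₂ ∈ E → (∀ {u} → u ∈ E → WalkIn _~_ (_∈ E) u c₁) → (∀ {v} → Mid v → Dom _~_ E v) →
            k ≤ length E + (length X₁ + length X₂)
    bound E c₁∈ c₂∈ conn dom = ℕₚ.≤-trans (lower cds) (ℕₚ.≤-reflexive (trans (Listₚ.length-++ E) (cong (length E +_) (Listₚ.length-++ X₁))))
      where
      D′ = E ++ X₁ ++ X₂
      in₁ : ∀ {v} → v ∈ c₁ ∷ X₁ → v ∈ D′
      in₁ (here refl) = ∈-++⁺ˡ c₁∈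
      in₁ (there v∈) = ∈-++⁺ʳ E (∈-++⁺ˡ v∈)
      in₂ : ∀ {v} → v ∈ c₂ ∷ X₂ → v ∈ D′
      in₂ (here refl) = ∈-++⁺ˡ c₂∈
      in₂ (there v∈) = ∈-++⁺ʳ E (∈-++⁺ʳ X₁ v∈)
      to-c₁ : ∀ {u} → u ∈ D′ → WalkIn _~_ (_∈ D′) u c₁
      to-c₁ u∈ with ∈-++⁻ E u∈
      ... | inj₁ u∈E = walk-map ∈-++⁺ˡ (conn u∈E)
      ... | inj₂ u∈X with ∈-++⁻ X₁ u∈X
      ...   | inj₁ u∈X₁ = walk-map in₁ (Completes.conn comp₁ _ c₁ (there u∈X₁) (here refl))
      ...   | inj₂ u∈X₂ = walk-map in₂ (Completes.conn comp₂ _ c₂ (there u∈X₂) (here refl)) ◅◅ walk-map ∈-++⁺ˡ (conn c₂∈)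
      cds : CDS _~_ D′
      cds = record
        { conn = λ u v u∈ v∈ → to-c₁ u∈ ◅◅ walk-reverse ~sym (to-c₁ v∈)
        ; dom = dom′ }
        where
        dom′ : ∀ v → Dom _~_ D′ v
        dom′ v with R₁? v | R₂? v
        ... | yes r | _ = case Completes.dom comp₁ r of λ where
              (inj₁ v∈) → inj₁ (in₁ v∈)
              (inj₂ (u , u∈ , e)) → inj₂ (u , in₁ u∈ , e)
        ... | no _ | yes r = case Completes.dom comp₂ r of λ where
              (inj₁ v∈) → inj₁ (in₂ v∈)
              (inj₂ (u , u∈ , e)) → inj₂ (u , in₂ u∈ , e)
        ... | no ¬r₁ | no ¬r₂ = case dom (¬r₁ , ¬r₂) of λ where
              (inj₁ v∈) → inj₁ (∈-++⁺ˡ v∈)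
              (inj₂ (u , u∈ , e)) → inj₂ (u , ∈-++⁺ˡ u∈ , e)

    collapse : V → V
    collapse v with R₁? v | R₂? v
    ... | yes _ | _ = c₁
    ... | no _ | yes _ = c₂
    ... | no _ | no _ = v

    collapse-mid : ∀ {v} → Mid v → collapse v ≡ v
    collapse-mid {v} (¬r₁ , ¬r₂) with R₁? v | R₂? v
    ... | yes r | _ = ⊥-elim (¬r₁ r)
    ... | no _ | yes r = ⊥-elim (¬r₂ r)
    ... | no _ | no _ = refl

    collapse-∈ : ∀ v → Mid (collapse v)
    collapse-∈ v with R₁? v | R₂? v
    ... | yes _ | _ = c₁∉R₁ , c₁∉R₂
    ... | no _ | yes _ = c₂∉R₁ , c₂∉R₂
    ... | no ¬r₁ | no ¬r₂ = ¬r₁ , ¬r₂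

    collapse-adj : ∀ {u v} → u ~ v → collapse u ≡ collapse v ⊎ collapse u ~ collapse v
    collapse-adj {u} {v} e with R₁? u | R₁? v
    ... | yes _ | yes _ = inj₁ refl
    ... | yes r | no ¬r with enter⇒c reg₁ r e ¬r
    ...   | refl with R₂? v
    ...     | yes r₂ = ⊥-elim (c₁∉R₂ r₂)
    ...     | no _ = inj₁ refl
    collapse-adj {u} {v} e | no ¬r | yes r with enter⇒c reg₁ r (~sym e) ¬r
    ... | refl with R₂? u
    ...   | yes r₂ = ⊥-elim (c₁∉R₂ r₂)
    ...   | no _ = inj₁ refl
    collapse-adj {u} {v} e | no ¬ru | no ¬rv with R₂? u | R₂? v
    ... | yes _ | yes _ = inj₁ refl
    ... | no _ | no _ = inj₂ e
    ... | yes r | no ¬r with enter⇒c reg₂ r e ¬r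
    ...   | refl = inj₁ refl
    collapse-adj {u} {v} e | no ¬ru | no ¬rv | no ¬r | yes r with enter⇒c reg₂ r (~sym e) ¬r
    ... | refl = inj₁ refl

    mid₁ : Mid c₁
    mid₁ = c₁∉R₁ , c₁∉R₂

    mid₂ : Mid c₂
    mid₂ = c₂∉R₁ , c₂∉R₂

    mid-walk : WalkIn _~_ Mid c₂ c₁
    mid-walk = subst₂ (WalkIn _~_ Mid) (collapse-mid mid₂) (collapse-mid mid₁)
      (walk-image collapse (λ {v} _ → collapse-∈ v) (λ _ _ → collapse-adj) (connected c₂ c₁))

    R′ : Rel n
    R′ = addEdge _~_ w₁ w₂

    w₁≢w₂ : w₁ ≢ w₂
    w₁≢w₂ eq = disjoint Rw₁ (subst R₂ (≡-sym eq) Rw₂)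

    w₁≁w₂ : ¬ w₁ ~ w₂
    w₁≁w₂ e = disjoint (Region.closed reg₁ Rw₁ e λ eq → c₁∉R₂ (subst R₂ eq Rw₂)) Rw₂

    mid-edge : ∀ {u v} → Mid u → R′ u v → u ~ v
    mid-edge m (inj₁ e) = e
    mid-edge (¬r , _) (inj₂ (inj₁ (refl , _))) = ⊥-elim (¬r Rw₁)
    mid-edge (_ , ¬r) (inj₂ (inj₂ (refl , _))) = ⊥-elim (¬r Rw₂)

    R′-sym : ∀ {u v} → R′ u v → R′ v u
    R′-sym = addEdge-sym

    module With (D : List V) (cds : CDS R′ D) (D<k : length D < k) where

      open CDS cds

      D₁ D′ D₂ N : List V
      D₁ = filter R₁? D
      D′ = filter (¬? ∘ R₁?) D
      D₂ = filter R₂? D′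
      N = filter (¬? ∘ R₂?) D′

      length-D : length D ≡ length D₁ + (length D₂ + length N)
      length-D = trans (length-filter-¬ R₁? D) (cong (length D₁ +_) (length-filter-¬ R₂? D′))

      N⁺ : ∀ {v} → v ∈ D → Mid v → v ∈ N
      N⁺ v∈ (¬r₁ , ¬r₂) = ∈-filter⁺ (¬? ∘ R₂?) (∈-filter⁺ (¬? ∘ R₁?) v∈ ¬r₁) ¬r₂

      N⁻ : ∀ {v} → v ∈ N → v ∈ D × Mid v
      N⁻ v∈ with ∈-filter⁻ (¬? ∘ R₂?) {xs = D′} v∈
      ... | v∈′ , ¬r₂ with ∈-filter⁻ (¬? ∘ R₁?) {xs = D} v∈′
      ...   | v∈D , ¬r₁ = v∈D , ¬r₁ , ¬r₂

      D₁⁺ : ∀ {v} → v ∈ D → R₁ v → v ∈ D₁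
      D₁⁺ = ∈-filter⁺ R₁?

      D₂⁺ : ∀ {v} → v ∈ D → R₂ v → v ∈ D₂
      D₂⁺ v∈ r = ∈-filter⁺ R₂? (∈-filter⁺ (¬? ∘ R₁?) v∈ (λ r₁ → disjoint r₁ r)) r

      -- The accounting of all cases: the part of D in the two ends is exchanged for X₁, X₂ and `i`
      -- vertices of the middle. It must not be smaller than its replacement.
      finish : ∀ i → k ≤ (i + length N) + (length X₁ + length X₂) → i + (length X₁ + length X₂) ≤ length D₁ + length D₂ → ⊥
      finish i k≤ small = ℕₚ.<⇒≱ D<k (ℕₚ.≤-trans k≤ (begin
        (i + length N) + x ≡⟨ ℕₚ.+-assoc i (length N) x ⟩
        i + (length N + x) ≡⟨ cong (i +_) (ℕₚ.+-comm (length N) x) ⟩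
        i + (x + length N) ≡⟨ ≡-sym (ℕₚ.+-assoc i x (length N)) ⟩
        (i + x) + length N ≤⟨ ℕₚ.+-monoˡ-≤ (length N) small ⟩
        (length D₁ + length D₂) + length N ≡⟨ ℕₚ.+-assoc (length D₁) (length D₂) (length N) ⟩
        length D₁ + (length D₂ + length N) ≡⟨ ≡-sym length-D ⟩
        length D ∎))
        where
        open ℕₚ.≤-Reasoning
        x = length X₁ + length X₂

      -- Unless X is empty, `w` is not adjacent to `c`, so it differs from `y` and both count.
      large : ∀ {c R} (t : Tight c R) {L y} → Tight.w t ∈ L → y ∈ L → y ~ c → suc (length (Tight.X t)) ≤ length L
      large t {L} {y} w∈ y∈ e with Tight.loose t
      ... | inj₁ eq = ℕₚ.≤-trans (ℕₚ.≤-reflexive (cong (suc ∘ length) eq)) (unique-⊆⇒length≤ {xs = y ∷ []} ([] ∷ []) λ { (here refl) → y∈ })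
      ... | inj₂ c≁w = ℕₚ.≤-trans (s≤s (Tight.X≤1 t)) (unique-⊆⇒length≤ {xs = y ∷ Tight.w t ∷ []}
              (((λ { refl → c≁w (~sym e) }) ∷ []) ∷ [] ∷ []) λ { (here refl) → y∈ ; (there (here refl)) → w∈ })

      some : ∀ {L : List V} {v} → v ∈ L → 1 ≤ length L
      some {_ ∷ _} _ = s≤s z≤n

      -- A walk in D followed until it leaves the middle. It can do so only at `c₁` or `c₂`, since
      -- the new edge has no end in the middle.
      data Exit (a b : V) : Set where
        inside : WalkIn _~_ (_∈ N) a b → Exit a b
        via₁ : ∀ {y} → WalkIn _~_ (_∈ N) a c₁ → y ∈ D₁ → y ~ c₁ → Exit a b
        via₂ : ∀ {y} → WalkIn _~_ (_∈ N) a c₂ → y ∈ D₂ → y ~ c₂ → Exit a b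

      exit : ∀ {a b} → WalkIn R′ (_∈ D) a b → Mid a → Exit a b
      exit [ a∈ ] m = inside [ N⁺ a∈ m ]
      exit (step {a} {w} a∈ e wk) m with mid-edge m e | R₁? w | R₂? w
      ... | f | yes r | _ with enter⇒c reg₁ r (~sym f) (proj₁ m)
      ...   | refl = via₁ [ N⁺ a∈ m ] (D₁⁺ (walk-start wk) r) (~sym f)
      exit (step {a} {w} a∈ e wk) m | f | no _ | yes r with enter⇒c reg₂ r (~sym f) (proj₂ m)
      ...   | refl = via₂ [ N⁺ a∈ m ] (D₂⁺ (walk-start wk) r) (~sym f)
      exit (step {a} {w} a∈ e wk) m | f | no ¬r₁ | no ¬r₂ with exit wk (¬r₁ , ¬r₂)
      ... | inside q = inside (step (N⁺ a∈ m) f q)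
      ... | via₁ q y∈ g = via₁ (step (N⁺ a∈ m) f q) y∈ g
      ... | via₂ q y∈ g = via₂ (step (N⁺ a∈ m) f q) y∈ g

      data DomN (v : V) : Set where
        self : v ∈ N → DomN v
        by : ∀ {u} → u ∈ N → u ~ v → DomN v
        by₁ : ∀ {y} → v ≡ c₁ → y ∈ D₁ → y ~ c₁ → DomN v
        by₂ : ∀ {y} → v ≡ c₂ → y ∈ D₂ → y ~ c₂ → DomN v

      domN : ∀ {v} → Mid v → DomN v
      domN {v} m with dom v
      ... | inj₁ v∈ = self (N⁺ v∈ m)
      ... | inj₂ (u , u∈ , e) with mid-edge m (R′-sym e) | R₁? u | R₂? u
      ...   | f | no ¬r₁ | no ¬r₂ = by (N⁺ u∈ (¬r₁ , ¬r₂)) (~sym f)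
      ...   | f | yes r | _ with enter⇒c reg₁ r (~sym f) (proj₁ m)
      ...     | refl = by₁ refl (D₁⁺ u∈ r) (~sym f)
      domN {v} m | inj₂ (u , u∈ , e) | f | no _ | yes r with enter⇒c reg₂ r (~sym f) (proj₂ m)
      ...     | refl = by₂ refl (D₂⁺ u∈ r) (~sym f)

      Dom⇒ : ∀ {E v} → (∀ {u} → u ∈ N → u ∈ E) → c₁ ∈ E → c₂ ∈ E → DomN v → Dom _~_ E v
      Dom⇒ sub c₁∈ c₂∈ (self v∈) = inj₁ (sub v∈)
      Dom⇒ sub c₁∈ c₂∈ (by u∈ e) = inj₂ (_ , sub u∈ , e)
      Dom⇒ sub c₁∈ c₂∈ (by₁ refl _ _) = inj₁ c₁∈
      Dom⇒ sub c₁∈ c₂∈ (by₂ refl _ _) = inj₁ c₂∈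

      -- The middle is the common cut vertex alone, so this vertex with X₁ and X₂ would show γc ≤ 3.
      tiny : c₁ ≡ c₂ → (∀ {v} → v ∉ N) → ⊥
      tiny eq N-empty = ℕₚ.<⇒≱ 4≤k (ℕₚ.≤-trans (bound (c₁ ∷ []) (here refl) (here (≡-sym eq)) (λ { (here refl) → [ here refl ] })
          λ m → inj₁ (here (at-c₁ (domN m)))) (s≤s (ℕₚ.+-mono-≤ X₁≤1 X₂≤1)))
        where
        at-c₁ : ∀ {v} → DomN v → v ≡ c₁
        at-c₁ (self v∈) = ⊥-elim (N-empty v∈)
        at-c₁ (by u∈ _) = ⊥-elim (N-empty u∈)
        at-c₁ (by₁ eq′ _ _) = eq′
        at-c₁ (by₂ eq′ _ _) = trans eq′ (≡-sym eq)

      module Crossing (w₁∈ : w₁ ∈ D) (w₂∈ : w₂ ∈ D) where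

        w₁∉N : w₁ ∉ N
        w₁∉N w∈ = proj₁ (proj₂ (N⁻ w∈)) Rw₁

        both : c₁ ∈ D → c₂ ∈ D → ⊥
        both c₁∈ c₂∈ = split (exit (conn c₁ c₂ c₁∈ c₂∈) mid₁) (exit (conn c₂ c₁ c₂∈ c₁∈) mid₂)
          where
          c₁∈N = N⁺ c₁∈ mid₁
          c₂∈N = N⁺ c₂∈ mid₂
          split-N : ∀ {u} → u ∈ N → WalkIn _~_ (_∈ N) u c₁ ⊎ WalkIn _~_ (_∈ N) u c₂
          split-N u∈ with exit (conn _ c₁ (proj₁ (N⁻ u∈)) c₁∈) (proj₂ (N⁻ u∈))
          ... | inside q = inj₁ q
          ... | via₁ q _ _ = inj₁ q
          ... | via₂ q _ _ = inj₂ q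
          joined : WalkIn _~_ (_∈ N) c₂ c₁ → ⊥
          joined q = finish 0 (bound N c₁∈N c₂∈N (λ u∈ → [ id , _◅◅ q ]′ (split-N u∈)) (λ m → Dom⇒ id c₁∈N c₂∈N (domN m)))
            (ℕₚ.+-mono-≤ (ℕₚ.≤-trans X₁≤1 (some (D₁⁺ w₁∈ Rw₁))) (ℕₚ.≤-trans X₂≤1 (some (D₂⁺ w₂∈ Rw₂))))
          Near : V → Set
          Near v = Any.Any (λ u → (u ≡ v ⊎ u ~ v) × WalkIn _~_ (_∈ N) u c₁) N
          Near? : Decidable Near
          Near? v = Any.any? (λ u → ((u ≟ v) ⊎-dec dec G u v) ×-dec walk? G (_∈? N) u c₁) N
          switch : ∀ {a} → WalkIn _~_ Mid a c₁ → ¬ Near a → ∃[ z ] ∃[ z′ ] Mid z × Mid z′ × z ~ z′ × ¬ Near z × Near z′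
          switch [ _ ] far = ⊥-elim (far (lose c₁∈N (inj₁ refl , [ c₁∈N ])))
          switch (step {w = w} m e wk) far with Near? w
          ... | yes near = _ , _ , m , walk-start wk , e , far , near
          ... | no far′ = switch wk far′
          -- N falls into a side of `c₁` and a side of `c₂`. On a walk in the middle, the step z z′
          -- into the closed neighbourhood of the first side joins the two. It costs two vertices,
          -- and each end has one to spare.
          apart : ∀ {y₁ y₂} → y₁ ∈ D₁ → y₁ ~ c₁ → y₂ ∈ D₂ → y₂ ~ c₂ → ⊥
          apart y₁∈ f₁ y₂∈ f₂ with Near? c₂
          ... | yes near with find near
          ...   | u , u∈ , inj₁ refl , q = joined q
          ...   | u , u∈ , inj₂ e , q = joined (step c₂∈N (~sym e) q)
          apart y₁∈ f₁ y₂∈ f₂ | no far with switch mid-walk far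
          ... | z , z′ , mz , mz′ , e , far-z , near-z′ with find near-z′
          ...   | u , u∈ , u-z′ , q = finish 2 (bound Z (there (there c₁∈N)) (there (there c₂∈N)) to-c₁ (λ m → Dom⇒ (there ∘ there) (there (there c₁∈N)) (there (there c₂∈N)) (domN m)))
                  (ℕₚ.≤-trans (ℕₚ.≤-reflexive (cong suc (≡-sym (ℕₚ.+-suc (length X₁) (length X₂)))))
                    (ℕₚ.+-mono-≤ (large t₁ (D₁⁺ w₁∈ Rw₁) y₁∈ f₁) (large t₂ (D₂⁺ w₂∈ Rw₂) y₂∈ f₂)))
            where
            Z = z ∷ z′ ∷ N
            wk : ∀ {a b} → WalkIn _~_ (_∈ N) a b → WalkIn _~_ (_∈ Z) a b
            wk = walk-map (there ∘ there)
            from-z′ : WalkIn _~_ (_∈ Z) z′ c₁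
            from-z′ = go u-z′
              where
              go : u ≡ z′ ⊎ u ~ z′ → WalkIn _~_ (_∈ Z) z′ c₁
              go (inj₁ eq) = subst (λ v → WalkIn _~_ (_∈ Z) v c₁) eq (wk q)
              go (inj₂ f) = step (there (here refl)) (~sym f) (wk q)
            from-z : WalkIn _~_ (_∈ Z) z c₁
            from-z = step (here refl) e from-z′
            far-side : ∀ {v} → v ∈ N → v ≡ z ⊎ v ~ z → WalkIn _~_ (_∈ N) v c₂
            far-side v∈ vz = [ (λ q′ → ⊥-elim (far-z (lose v∈ (vz , q′)))) , id ]′ (split-N v∈)
            c₂-z : WalkIn _~_ (_∈ Z) c₂ z
            c₂-z with domN mz
            ... | self z∈ = walk-reverse ~sym (wk (far-side z∈ (inj₁ refl)))
            ... | by v∈ f = walk-snoc (walk-reverse ~sym (wk (far-side v∈ (inj₂ f)))) f (here refl)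
            ... | by₁ eq _ _ = ⊥-elim (far-z (lose c₁∈N (inj₁ (≡-sym eq) , [ c₁∈N ])))
            ... | by₂ eq _ _ = subst (WalkIn _~_ (_∈ Z) c₂) (≡-sym eq) [ there (there c₂∈N) ]
            to-c₁ : ∀ {v} → v ∈ Z → WalkIn _~_ (_∈ Z) v c₁
            to-c₁ (here refl) = from-z
            to-c₁ (there (here refl)) = from-z′
            to-c₁ (there (there v∈)) with split-N v∈
            ... | inj₁ q′ = wk q′
            ... | inj₂ q′ = wk q′ ◅◅ c₂-z ◅◅ from-z
          split : Exit c₁ c₂ → Exit c₂ c₁ → ⊥
          split (inside q) _ = joined (walk-reverse ~sym q)
          split (via₂ q _ _) _ = joined (walk-reverse ~sym q)
          split _ (inside q) = joined q
          split _ (via₁ q _ _) = joined q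
          split (via₁ _ y₁∈ f₁) (via₂ _ y₂∈ f₂) = apart y₁∈ f₁ y₂∈ f₂

        -- Walks from N to `w₁` must use `c₁`, so N is connected and the first end has a vertex to
        -- spare, which pays for `c₂`. If `c₂` has no neighbour in N, one more vertex is needed,
        -- paid for by the second end.
        first : c₁ ∈ D → c₂ ∉ D → ⊥
        first c₁∈ c₂∉ = split (domN mid₂)
          where
          c₁∈N = N⁺ c₁∈ mid₁
          c₂∉N : c₂ ∉ N
          c₂∉N = c₂∉ ∘ proj₁ ∘ N⁻
          to-w₁ : ∀ {u} → u ∈ N → WalkIn _~_ (_∈ N) u c₁ × suc (length X₁) ≤ length D₁
          to-w₁ u∈ with exit (conn _ w₁ (proj₁ (N⁻ u∈)) w₁∈) (proj₂ (N⁻ u∈))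
          ... | inside q = ⊥-elim (w₁∉N (walk-end q))
          ... | via₂ q _ _ = ⊥-elim (c₂∉N (walk-end q))
          ... | via₁ q y∈ f = q , large t₁ (D₁⁺ w₁∈ Rw₁) y∈ f
          one : ∀ {u} → u ∈ N → u ~ c₂ → ⊥
          one {u} u∈ f = finish 1 (bound (c₂ ∷ N) (there c₁∈N) (here refl)
              (λ { (here refl) → step (here refl) (~sym f) (walk-map there (proj₁ (to-w₁ u∈))) ; (there v∈) → walk-map there (proj₁ (to-w₁ v∈)) })
              (λ m → Dom⇒ there (there c₁∈N) (here refl) (domN m)))
            (ℕₚ.+-mono-≤ (proj₂ (to-w₁ c₁∈N)) (ℕₚ.≤-trans X₂≤1 (some (D₂⁺ w₂∈ Rw₂))))
          c₁≢c₂ : c₁ ≢ c₂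
          c₁≢c₂ eq = c₂∉ (subst (_∈ D) eq c₁∈)
          split : DomN c₂ → ⊥
          split (self c₂∈N) = c₂∉N c₂∈N
          split (by u∈ f) = one u∈ f
          split (by₁ eq _ _) = c₁≢c₂ (≡-sym eq)
          split (by₂ {y} _ y∈ f) with first-step crit mid-walk (c₁≢c₂ ∘ ≡-sym)
          ... | z , mz , z≢c₂ , g with domN mz
          ...   | self z∈ = one z∈ (~sym g)
          ...   | by₂ eq _ _ = z≢c₂ eq
          ...   | by₁ eq _ _ = one (subst (_∈ N) (≡-sym eq) c₁∈N) (~sym g)
          ...   | by {u} u∈ e = finish 2 (bound Z (there (there c₁∈N)) (there (here refl))
                    (λ { (here refl) → z-walk ; (there (here refl)) → step (there (here refl)) g z-walk
                       ; (there (there v∈)) → wk (proj₁ (to-w₁ v∈)) })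
                    (λ m → Dom⇒ (there ∘ there) (there (there c₁∈N)) (there (here refl)) (domN m)))
                  (ℕₚ.≤-trans (ℕₚ.≤-reflexive (cong suc (≡-sym (ℕₚ.+-suc (length X₁) (length X₂)))))
                    (ℕₚ.+-mono-≤ (proj₂ (to-w₁ c₁∈N)) (large t₂ (D₂⁺ w₂∈ Rw₂) y∈ f)))
            where
            Z = z ∷ c₂ ∷ N
            wk : ∀ {a b} → WalkIn _~_ (_∈ N) a b → WalkIn _~_ (_∈ Z) a b
            wk = walk-map (there ∘ there)
            z-walk : WalkIn _~_ (_∈ Z) z c₁
            z-walk = step (here refl) (~sym e) (wk (proj₁ (to-w₁ u∈)))

        N-empty : c₁ ∉ D → c₂ ∉ D → ∀ {v} → v ∉ N
        N-empty c₁∉ c₂∉ v∈ with exit (conn _ w₁ (proj₁ (N⁻ v∈)) w₁∈) (proj₂ (N⁻ v∈))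
        ... | inside q = w₁∉N (walk-end q)
        ... | via₁ q _ _ = c₁∉ (proj₁ (N⁻ (walk-end q)))
        ... | via₂ q _ _ = c₂∉ (proj₁ (N⁻ (walk-end q)))

        -- N is empty, so the middle is {c₁ , c₂}, each dominated from its own end. The vertex that
        -- each end has to spare pays for its cut vertex.
        neither : c₁ ∉ D → c₂ ∉ D → ⊥
        neither c₁∉ c₂∉ with c₁ ≟ c₂
        ... | yes eq = tiny eq (N-empty c₁∉ c₂∉)
        ... | no c₁≢c₂ = split (domN mid₁) (domN mid₂)
          where
          at-c : ∀ {v} → DomN v → v ≡ c₁ ⊎ v ≡ c₂
          at-c (self v∈) = ⊥-elim (N-empty c₁∉ c₂∉ v∈)
          at-c (by u∈ _) = ⊥-elim (N-empty c₁∉ c₂∉ u∈)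
          at-c (by₁ eq _ _) = inj₁ eq
          at-c (by₂ eq _ _) = inj₂ eq
          c₂~c₁ : c₂ ~ c₁
          c₂~c₁ with first-step crit mid-walk (c₁≢c₂ ∘ ≡-sym)
          ... | z , mz , z≢c₂ , g with at-c (domN mz)
          ...   | inj₁ refl = g
          ...   | inj₂ eq = ⊥-elim (z≢c₂ eq)
          split : DomN c₁ → DomN c₂ → ⊥
          split (self c∈) _ = N-empty c₁∉ c₂∉ c∈
          split (by u∈ _) _ = N-empty c₁∉ c₂∉ u∈
          split (by₂ eq _ _) _ = c₁≢c₂ eq
          split _ (self c∈) = N-empty c₁∉ c₂∉ c∈
          split _ (by u∈ _) = N-empty c₁∉ c₂∉ u∈
          split _ (by₁ eq _ _) = c₁≢c₂ (≡-sym eq)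
          split (by₁ _ y₁∈ f₁) (by₂ _ y₂∈ f₂) = finish 2
            (ℕₚ.≤-trans (bound (c₁ ∷ c₂ ∷ []) (here refl) (there (here refl))
              (λ { (here refl) → [ here refl ] ; (there (here refl)) → step (there (here refl)) c₂~c₁ [ here refl ] })
              (λ m → inj₁ ([ here , (λ eq → there (here eq)) ]′ (at-c (domN m)))))
              (ℕₚ.+-monoˡ-≤ (length X₁ + length X₂) (s≤s (s≤s (z≤n {length N})))))
            (ℕₚ.≤-trans (ℕₚ.≤-reflexive (cong suc (≡-sym (ℕₚ.+-suc (length X₁) (length X₂)))))
              (ℕₚ.+-mono-≤ (large t₁ (D₁⁺ w₁∈ Rw₁) y₁∈ f₁) (large t₂ (D₂⁺ w₂∈ Rw₂) y₂∈ f₂)))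

      module OneSided (w₂∈ : w₂ ∈ D) (w₁-free : ¬ Dom _~_ D w₁) where

        -- R₁ is a clique, so any vertex of D in it would be or dominate `w₁`.
        D₁-empty : ∀ {v} → v ∈ D → ¬ R₁ v
        D₁-empty {v} v∈ r = w₁-free (case v ≟ w₁ of λ where
          (yes eq) → inj₁ (subst (_∈ D) eq v∈)
          (no v≢w₁) → inj₂ (v , v∈ , cliq₁ r Rw₁ v≢w₁))

        connG : ∀ {u v} → WalkIn R′ (_∈ D) u v → WalkIn _~_ (_∈ D) u v
        connG [ p ] = [ p ]
        connG (step p (inj₁ e) q) = step p e (connG q)
        connG (step p (inj₂ (inj₁ (refl , _))) q) = ⊥-elim (w₁-free (inj₁ p))
        connG (step p (inj₂ (inj₂ (_ , refl))) q) = ⊥-elim (w₁-free (inj₁ (walk-start q)))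

        walkN : c₂ ∈ D → ∀ {u v} → u ∈ N → v ∈ N → WalkIn _~_ (_∈ N) u v
        walkN c₂∈ {u} {v} u∈ v∈ = subst₂ (WalkIn _~_ (_∈ N)) (collapse-mid (proj₂ (N⁻ u∈))) (collapse-mid (proj₂ (N⁻ v∈)))
            (walk-image collapse col∈ (λ _ _ → collapse-adj) (connG (conn u v (proj₁ (N⁻ u∈)) (proj₁ (N⁻ v∈)))))
          where
          col∈ : ∀ {x} → x ∈ D → collapse x ∈ N
          col∈ {x} x∈ with R₁? x | R₂? x
          ... | yes r | _ = ⊥-elim (D₁-empty x∈ r)
          ... | no _ | yes _ = N⁺ c₂∈ mid₂
          ... | no ¬r₁ | no ¬r₂ = N⁺ x∈ (¬r₁ , ¬r₂)

        D₂-large : ∀ {b} → b ∈ D → ¬ R₂ b → c₂ ∈ D × suc (length X₂) ≤ length D₂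
        D₂-large b∈ ¬r with leave reg₂ (connG (conn w₂ _ w₂∈ b∈)) Rw₂ ¬r
        ... | y , y∈ , Ry , f , c₂∈ = c₂∈ , large t₂ (D₂⁺ w₂∈ Rw₂) (D₂⁺ y∈ Ry) f

        with-c₁ : c₁ ∈ D → ⊥
        with-c₁ c₁∈ with D₂-large c₁∈ c₁∉R₂
        ... | c₂∈ , big = finish 0 (bound N c₁∈N c₂∈N (λ u∈ → walkN c₂∈ u∈ c₁∈N) (λ m → Dom⇒ id c₁∈N c₂∈N (domN m)))
                (ℕₚ.≤-trans (ℕₚ.+-monoˡ-≤ (length X₂) X₁≤1) (ℕₚ.≤-trans big (ℕₚ.m≤n+m (length D₂) (length D₁))))
          where
          c₁∈N = N⁺ c₁∈ mid₁
          c₂∈N = N⁺ c₂∈ mid₂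

        -- Nothing in D could dominate a vertex of R₁ other than `w₁`, so R₁ is `w₁` alone and X₁ is
        -- empty. The vertex that the second end has to spare pays for `c₁`.
        without-c₁ : c₁ ∉ D → ⊥
        without-c₁ c₁∉ = split (domN mid₁) (c₂ ∈? D)
          where
          single : ∀ {u} → R₁ u → u ≡ w₁
          single {u} r = decidable-stable (u ≟ w₁) λ u≢w₁ → case dom u of λ where
            (inj₁ u∈) → D₁-empty u∈ r
            (inj₂ (v , v∈ , inj₂ (inj₁ (_ , refl)))) → disjoint r Rw₂
            (inj₂ (v , v∈ , inj₂ (inj₂ (_ , eq)))) → u≢w₁ eq
            (inj₂ (v , v∈ , inj₁ e)) → c₁∉ (subst (_∈ D) (enter⇒c reg₁ r (~sym e) (D₁-empty v∈)) v∈)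
          X₁-empty : length X₁ ≡ 0
          X₁-empty with loose₁
          ... | inj₁ eq = cong length eq
          ... | inj₂ c₁≁w₁ with leave reg₁ (connected w₁ c₁) Rw₁ c₁∉R₁
          ...   | y , _ , Ry , f , _ with single Ry
          ...     | refl = ⊥-elim (c₁≁w₁ (~sym f))
          split : DomN c₁ → Dec (c₂ ∈ D) → ⊥
          split (self c₁∈) _ = c₁∉ (proj₁ (N⁻ c₁∈))
          split (by₁ _ y∈ _) _ with ∈-filter⁻ R₁? {xs = D} y∈
          ... | y∈D , r = D₁-empty y∈D r
          split (by₂ eq _ _) (yes c₂∈) = c₁∉ (subst (_∈ D) (≡-sym eq) c₂∈)
          split (by₂ eq _ _) (no c₂∉) = tiny eq λ v∈ → c₂∉ (proj₁ (D₂-large (proj₁ (N⁻ v∈)) (proj₂ (proj₂ (N⁻ v∈)))))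
          split (by {u} u∈ f) _ with D₂-large (proj₁ (N⁻ u∈)) (proj₂ (proj₂ (N⁻ u∈)))
          ... | c₂∈ , big = finish 1 (bound (c₁ ∷ N) (here refl) (there c₂∈N)
                  (λ { (here refl) → [ here refl ] ; (there v∈) → walk-snoc (walk-map there (walkN c₂∈ v∈ u∈)) f (here refl) })
                  (λ m → Dom⇒ there (here refl) (there c₂∈N) (domN m)))
                (ℕₚ.≤-trans (ℕₚ.≤-reflexive (cong (λ l → suc (l + length X₂)) X₁-empty)) (ℕₚ.≤-trans big (ℕₚ.m≤n+m (length D₂) (length D₁))))
            where c₂∈N = N⁺ c₂∈ mid₂

        contra : ⊥
        contra with c₁ ∈? D
        ... | yes c₁∈ = with-c₁ c₁∈
        ... | no c₁∉ = without-c₁ c₁∉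

  swap-cds : ∀ {u v D} → CDS (addEdge _~_ u v) D → CDS (addEdge _~_ v u) D
  swap-cds cds = record
    { dom = λ v → case CDS.dom cds v of λ where
        (inj₁ v∈) → inj₁ v∈
        (inj₂ (u , u∈ , e)) → inj₂ (u , u∈ , flip e)
    ; conn = λ u v u∈ v∈ → walk-rel flip (CDS.conn cds u v u∈ v∈) }
    where
    flip : ∀ {u v x y} → addEdge _~_ u v x y → addEdge _~_ v u x y
    flip (inj₁ e) = inj₁ e
    flip (inj₂ (inj₁ p)) = inj₂ (inj₂ p)
    flip (inj₂ (inj₂ p)) = inj₂ (inj₁ p)

  -- The edge w₁ w₂ would not make a smaller connected dominating set possible.
  no-two-tight : TwoEnds → ⊥
  no-two-tight E with Critical.improve crit (Two.w₁≢w₂ E) (Two.w₁≁w₂ E)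
  ... | D , cds , D<k = go (w₁ ∈? D) (w₂ ∈? D)
    where
    open Two E
    module W = With D cds D<k
    module S = Two.With (swap-ends E) D (swap-cds cds) D<k
    Dom? : ∀ v → Dec (Dom _~_ D v)
    Dom? v = (v ∈? D) ⊎-dec Finₚ.any? (λ u → (u ∈? D) ×-dec dec G u v)
    go : Dec (w₁ ∈ D) → Dec (w₂ ∈ D) → ⊥
    go (yes w₁∈) (yes w₂∈) with c₁ ∈? D | c₂ ∈? D
    ... | yes p | yes q = W.Crossing.both w₁∈ w₂∈ p q
    ... | yes p | no q = W.Crossing.first w₁∈ w₂∈ p q
    ... | no p | yes q = S.Crossing.first w₂∈ w₁∈ q p
    ... | no p | no q = W.Crossing.neither w₁∈ w₂∈ p q
    go d₁ d₂ with Dom? w₁ | Dom? w₂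
    ... | no ¬f | _ with CDS.dom cds w₁
    ...   | inj₁ w∈ = ¬f (inj₁ w∈)
    ...   | inj₂ (u , u∈ , inj₁ e) = ¬f (inj₂ (u , u∈ , e))
    ...   | inj₂ (u , u∈ , inj₂ (inj₁ (_ , eq))) = w₁≢w₂ eq
    ...   | inj₂ (u , u∈ , inj₂ (inj₂ (eq , _))) = W.OneSided.contra (subst (_∈ D) eq u∈) ¬f
    go d₁ d₂ | yes _ | no ¬f with CDS.dom cds w₂
    ...   | inj₁ w∈ = ¬f (inj₁ w∈)
    ...   | inj₂ (u , u∈ , inj₁ e) = ¬f (inj₂ (u , u∈ , e))
    ...   | inj₂ (u , u∈ , inj₂ (inj₂ (_ , eq))) = w₁≢w₂ (≡-sym eq)
    ...   | inj₂ (u , u∈ , inj₂ (inj₁ (eq , _))) = S.OneSided.contra (subst (_∈ D) eq u∈) ¬f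
    -- Neither domination nor connectedness of D depends on the new edge, so D already serves for G.
    go d₁ d₂ | yes f₁ | yes f₂ = ℕₚ.<⇒≱ D<k (lower (record { dom = dom ; conn = λ u v u∈ v∈ → connG (CDS.conn cds u v u∈ v∈) }))
      where
      dom : ∀ v → Dom _~_ D v
      dom v with CDS.dom cds v
      ... | inj₁ v∈ = inj₁ v∈
      ... | inj₂ (u , u∈ , inj₁ e) = inj₂ (u , u∈ , e)
      ... | inj₂ (u , u∈ , inj₂ (inj₁ (_ , refl))) = f₂
      ... | inj₂ (u , u∈ , inj₂ (inj₂ (_ , refl))) = f₁
      not-both : ¬ (w₁ ∈ D × w₂ ∈ D)
      not-both (p , q) = go (yes p) (yes q)
      connG : ∀ {u v} → WalkIn R′ (_∈ D) u v → WalkIn _~_ (_∈ D) u v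
      connG [ p ] = [ p ]
      connG (step p (inj₁ e) q) = step p e (connG q)
      connG (step p (inj₂ (inj₁ (refl , refl))) q) = ⊥-elim (not-both (p , walk-start q))
      connG (step p (inj₂ (inj₂ (refl , refl))) q) = ⊥-elim (not-both (walk-start q , p))

-- The chain of blocks

module Peel {n : ℕ} (G : Graph n) {k} (crit : Critical k G) (4≤k : 4 ≤ k)
            (C : List (Fin n)) (C-unique : Unique C) (C-cut : ∀ {v} → v ∈ C → IsCutVertex G v) (cut-C : ∀ {v} → IsCutVertex G v → v ∈ C)
            (k≤ : k ≤ length C + 3) where

  open Regions G
  open Ends G crit 4≤k
  open Critical crit

  D₀ : List V
  D₀ = proj₁ optimum

  cds₀ : CDS _~_ D₀
  cds₀ = proj₁ (proj₂ optimum)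

  C⊆D₀ : ∀ {v} → v ∈ C → v ∈ D₀
  C⊆D₀ {v} v∈ with C-cut v∈
  ... | a , b , a≢v , b≢v , ¬w = decidable-stable (v ∈? D₀) λ v∉ →
        let off : ∀ {u} → u ∈ D₀ → u ≢ v
            off u∈ u≡v = v∉ (subst (_∈ D₀) u≡v u∈)
            near : ∀ x → x ≢ v → ∃[ u ] u ∈ D₀ × WalkIn _~_ (_≢ v) x u
            near x x≢v = case CDS.dom cds₀ x of λ where
              (inj₁ x∈) → x , x∈ , [ x≢v ]
              (inj₂ (u , u∈ , e)) → u , u∈ , step x≢v (~sym e) [ off u∈ ]
        in case near a a≢v , near b b≢v of λ where
          ((u , u∈ , p) , (u′ , u′∈ , p′)) → ¬w (p ◅◅ walk-map off (CDS.conn cds₀ u u′ u∈ u′∈) ◅◅ walk-reverse ~sym p′)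

  -- D₀ has k ≤ length C + 3 vertices, and C is among them.
  budget : ∀ {P₁ P₂ P₃ : V → Set} (P₁? : Decidable P₁) (P₂? : Decidable P₂) (P₃? : Decidable P₃) →
           (∀ {v} → v ∈ C → ¬ P₁ v) → (∀ {v} → v ∈ C → ¬ P₂ v) → (∀ {v} → v ∈ C → ¬ P₃ v) →
           (∀ {v} → P₁ v → ¬ P₂ v) → (∀ {v} → P₁ v → ¬ P₃ v) → (∀ {v} → P₂ v → ¬ P₃ v) →
           length (filter P₁? D₀) + (length (filter P₂? D₀) + length (filter P₃? D₀)) ≤ 3
  budget P₁? P₂? P₃? d₁ d₂ d₃ d₁₂ d₁₃ d₂₃ = ℕₚ.+-cancelˡ-≤ (length C) _ 3 (ℕₚ.≤-trans (ℕₚ.≤-reflexive len)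
      (ℕₚ.≤-trans (unique-⊆⇒length≤ unq sub) (ℕₚ.≤-trans (ℕₚ.≤-reflexive (proj₂ (proj₂ (proj₂ optimum)))) k≤)))
    where
    F₁ F₂ F₃ : List V
    F₁ = filter P₁? D₀
    F₂ = filter P₂? D₀
    F₃ = filter P₃? D₀
    len : length C + (length F₁ + (length F₂ + length F₃)) ≡ length (C ++ F₁ ++ F₂ ++ F₃)
    len = ≡-sym (trans (Listₚ.length-++ C) (cong (length C +_) (trans (Listₚ.length-++ F₁) (cong (length F₁ +_) (Listₚ.length-++ F₂)))))
    D₀-unique = proj₁ (proj₂ (proj₂ optimum))
    P-of : ∀ {P : V → Set} (P? : Decidable P) {v} → v ∈ filter P? D₀ → P v
    P-of P? v∈ = proj₂ (∈-filter⁻ P? {xs = D₀} v∈)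
    unq : Unique (C ++ F₁ ++ F₂ ++ F₃)
    unq = Uniqueₚ.++⁺ C-unique (Uniqueₚ.++⁺ (Uniqueₚ.filter⁺ P₁? D₀-unique) (Uniqueₚ.++⁺ (Uniqueₚ.filter⁺ P₂? D₀-unique) (Uniqueₚ.filter⁺ P₃? D₀-unique)
            (λ (p , q) → d₂₃ (P-of P₂? p) (P-of P₃? q)))
            (λ (p , q) → [ (λ q → d₁₂ (P-of P₁? p) (P-of P₂? q)) , (λ q → d₁₃ (P-of P₁? p) (P-of P₃? q)) ]′ (∈-++⁻ F₂ q)))
            (λ (p , q) → [ (λ q → d₁ p (P-of P₁? q)) , [ (λ q → d₂ p (P-of P₂? q)) , (λ q → d₃ p (P-of P₃? q)) ]′ ∘ ∈-++⁻ F₂ ]′ (∈-++⁻ F₁ q))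
    sub : ∀ {v} → v ∈ C ++ F₁ ++ F₂ ++ F₃ → v ∈ D₀
    sub v∈ with ∈-++⁻ C v∈
    ... | inj₁ p = C⊆D₀ p
    ... | inj₂ q with ∈-++⁻ F₁ q
    ...   | inj₁ p = proj₁ (∈-filter⁻ P₁? {xs = D₀} p)
    ...   | inj₂ q′ with ∈-++⁻ F₂ q′
    ...     | inj₁ p = proj₁ (∈-filter⁻ P₂? {xs = D₀} p)
    ...     | inj₂ p = proj₁ (∈-filter⁻ P₃? {xs = D₀} p)

  size : ∀ {R : V → Set} → Decidable R → ℕ
  size R? = length (filter R? (allFin n))

  size-strict : ∀ {P R : V → Set} (P? : Decidable P) (R? : Decidable R) {v} → (∀ {v} → P v → R v) → R v → ¬ P v → size P? < size R?
  size-strict P? R? {v} sub Rv ¬Pv = unique-⊆⇒length≤ {xs = v ∷ filter P? (allFin n)}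
    (All.tabulate (λ {x} x∈ v≡x → ¬Pv (subst _ (≡-sym v≡x) (proj₂ (∈-filter⁻ P? {xs = allFin n} x∈)))) ∷ Uniqueₚ.filter⁺ P? (Uniqueₚ.allFin⁺ n)) λ where
      (here refl) → ∈-filter⁺ R? (∈-allFin v) Rv
      (there x∈) → ∈-filter⁺ R? (∈-allFin _) (sub (proj₂ (∈-filter⁻ P? {xs = allFin n} x∈)))

  Far : V → V → V → Set
  Far c d u = u ≢ d × ¬ WalkIn _~_ (_≢ d) c u

  Far? : ∀ c d → Decidable (Far c d)
  Far? c d u = ¬? (u ≟ d) ×-dec ¬? (walk? G (λ v → ¬? (v ≟ d)) c u)

  ¬Far⇒walk : ∀ {c d u} → u ≢ d → ¬ Far c d u → WalkIn _~_ (_≢ d) c u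
  ¬Far⇒walk {c} {d} {u} u≢d ¬far = decidable-stable (walk? G (λ v → ¬? (v ≟ d)) c u) λ ¬w → ¬far (u≢d , ¬w)

  far-region : ∀ {c d} → d ∈ C → c ≢ d → Region d (Far c d)
  far-region {c} {d} d∈ c≢d = record
    { R? = Far? c d
    ; c∉R = λ { (d≢d , _) → d≢d refl }
    ; closed = λ { (u≢d , ¬w) e w≢d → w≢d , λ w → ¬w (walk-snoc w (~sym e) u≢d) }
    ; nonempty = ne
    ; outside = c , c≢d , λ { (_ , ¬w) → ¬w [ c≢d ] } }
    where
    ne : ∃[ r ] Far c d r
    ne with C-cut d∈
    ... | a , b , a≢d , b≢d , ¬w with Far? c d a | Far? c d b
    ...   | yes fa | _ = a , fa
    ...   | no _ | yes fb = b , fb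
    ...   | no ¬fa | no ¬fb = ⊥-elim (¬w (walk-reverse ~sym (¬Far⇒walk a≢d ¬fa) ◅◅ ¬Far⇒walk b≢d ¬fb))

  co-region : ∀ {c R} → Region c R → Region c (λ u → u ≢ c × ¬ R u)
  co-region {c} {R} reg = record
    { R? = λ u → ¬? (u ≟ c) ×-dec ¬? (R? u)
    ; c∉R = λ { (c≢c , _) → c≢c refl }
    ; closed = λ { (u≢c , ¬ru) e w≢c → w≢c , λ rw → ¬ru (closed rw (~sym e) u≢c) }
    ; nonempty = outside
    ; outside = proj₁ nonempty , R⇒≢c (proj₂ nonempty) , λ { (_ , ¬r) → ¬r (proj₂ nonempty) } }
    where open Region reg

  -- From outside R the vertex `c` is reached without entering R, in particular without meeting `d`.
  far⊆ : ∀ {c R d} → Region c R → R d → ∀ {u} → Far c d u → R u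
  far⊆ {c} {R} {d} reg Rd {u} (u≢d , ¬w) = decidable-stable (R? u) λ ¬ru →
      ¬w (walk-map (λ ¬r → λ { refl → ¬r Rd }) (walk-reverse ~sym (out (connected u c) ¬ru)))
    where
    open Region reg
    out : ∀ {v} → WalkIn _~_ (λ _ → ⊤) v c → ¬ R v → WalkIn _~_ (λ v → ¬ R v) v c
    out [ _ ] ¬r = [ ¬r ]
    out {v} (step {w = w} _ e wk) ¬r with v ≟ c
    ... | yes refl = [ ¬r ]
    ... | no v≢c = step ¬r e (out wk λ rw → ¬r (closed rw (~sym e) v≢c))

  has-cut : ∀ {R : V → Set} → Decidable R → Dec (Any.Any R C)
  has-cut R? = Any.any? R? C

  to-end : ∀ {c R} → Region c R → ¬ Any.Any R C → End crit c R
  to-end reg ¬any = record { region = reg ; no-cut = λ r cut → ¬any (lose (cut-C cut) r) }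

  record SubEnd (R : V → Set) : Set₁ where
    field
      {c′} : V
      {R′} : V → Set
      end : End crit c′ R′
      sub : ∀ {v} → R′ v → R v
      c′∈C : c′ ∈ C
    open End end public using () renaming (R? to R′?; region to region′)
    no-C : ∀ {v} → v ∈ C → ¬ R′ v
    no-C v∈ r = End.no-cut end r (C-cut v∈)
    extra : List V
    extra = filter R′? D₀
    completes : Comp crit c′ R′ extra
    completes = PieceFacts.Orig.restrict (region-piece region′) crit (here refl) cds₀

  -- A cut vertex `d` inside R cuts off a strictly smaller region, so the descent stops at a region
  -- without cut vertices.
  sub-end : ∀ m {c R} (reg : Region c R) → c ∈ C → size (Region.R? reg) < m → SubEnd R
  sub-end (suc m) {c} {R} reg c∈ lt with has-cut (Region.R? reg)
  ... | no ¬any = record { end = to-end reg ¬any ; sub = id ; c′∈C = c∈ }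
  ... | yes any with find any
  ...   | d , d∈ , Rd = record { end = end ; sub = far⊆ reg Rd ∘ sub ; c′∈C = c′∈C }
    where
    far = far-region d∈ (λ { refl → Region.c∉R reg Rd })
    smaller : size (Far? c d) < size (Region.R? reg)
    smaller = size-strict (Far? c d) (Region.R? reg) (far⊆ reg Rd) Rd (λ { (d≢d , _) → d≢d refl })
    open SubEnd (sub-end m far d∈ (ℕₚ.≤-trans smaller (s≤s⁻¹ lt)))

  sub-end′ : ∀ {c R} (reg : Region c R) → c ∈ C → SubEnd R
  sub-end′ reg c∈ = sub-end (suc (size (Region.R? reg))) reg c∈ ℕₚ.≤-refl

  two-ends : ∀ {R₁ R₂} → (∀ {v} → R₁ v → ¬ R₂ v) → (E₁ : SubEnd R₁) (E₂ : SubEnd R₂) →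
             length (SubEnd.extra E₁) ≤ 1 → length (SubEnd.extra E₂) ≤ 1 → ⊥
  two-ends disj E₁ E₂ l₁ l₂ = no-two-tight record
    { reg₁ = region′ E₁ ; reg₂ = region′ E₂ ; t₁ = tight (region′ E₁) (completes E₁) l₁ ; t₂ = tight (region′ E₂) (completes E₂) l₂
    ; disjoint = λ r₁ r₂ → disj (sub E₁ r₁) (sub E₂ r₂)
    ; c₁∉R₂ = no-C E₂ (c′∈C E₁) ; c₂∉R₁ = no-C E₁ (c′∈C E₂) }
    where open SubEnd

  -- No two of them use at most one further vertex each, so two of them use at least two: four
  -- against a budget of three.
  three-ends : ∀ {R₁ R₂ R₃} → (∀ {v} → R₁ v → ¬ R₂ v) → (∀ {v} → R₁ v → ¬ R₃ v) → (∀ {v} → R₂ v → ¬ R₃ v) →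
               SubEnd R₁ → SubEnd R₂ → SubEnd R₃ → ⊥
  three-ends d₁₂ d₁₃ d₂₃ E₁ E₂ E₃ = arith _ _ _ total (two-ends d₁₂ E₁ E₂) (two-ends d₁₃ E₁ E₃) (two-ends d₂₃ E₂ E₃)
    where
    open SubEnd
    total : length (extra E₁) + (length (extra E₂) + length (extra E₃)) ≤ 3
    total = budget (R′? E₁) (R′? E₂) (R′? E₃) (no-C E₁) (no-C E₂) (no-C E₃)
      (λ r₁ r₂ → d₁₂ (sub E₁ r₁) (sub E₂ r₂)) (λ r₁ r₃ → d₁₃ (sub E₁ r₁) (sub E₃ r₃)) (λ r₂ r₃ → d₂₃ (sub E₂ r₂) (sub E₃ r₃))
    arith : ∀ a b c → a + (b + c) ≤ 3 → (a ≤ 1 → b ≤ 1 → ⊥) → (a ≤ 1 → c ≤ 1 → ⊥) → (b ≤ 1 → c ≤ 1 → ⊥) → ⊥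
    arith a b c total ab ac bc with a ℕₚ.≤? 1 | b ℕₚ.≤? 1
    ... | yes a≤1 | yes b≤1 = ab a≤1 b≤1
    ... | yes a≤1 | no b≰1 = ℕₚ.<⇒≱ (ℕₚ.+-mono-≤ (ℕₚ.≰⇒> b≰1) (ℕₚ.≰⇒> (ac a≤1))) (ℕₚ.≤-trans (ℕₚ.m≤n+m (b + c) a) total)
    ... | no a≰1 | no b≰1 = ℕₚ.<⇒≱ (ℕₚ.+-mono-≤ (ℕₚ.≰⇒> a≰1) (ℕₚ.≤-trans (ℕₚ.≰⇒> b≰1) (ℕₚ.m≤m+n b c))) total
    ... | no a≰1 | yes b≤1 = ℕₚ.<⇒≱ (ℕₚ.+-mono-≤ (ℕₚ.≰⇒> a≰1) (ℕₚ.≤-trans (ℕₚ.≰⇒> (bc b≤1)) (ℕₚ.m≤n+m c b))) total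

  chain : ∀ x xs → Unique (x ∷ xs) → (∀ {u v} → u ∈ x ∷ xs → v ∈ x ∷ xs → u ≢ v → u ~ v) → ∃[ e ] Path x e (x ∷ xs)
  chain x [] u adj = x , [-]
  chain x (y ∷ xs) (x∉ ∷ u) adj with chain y xs u (λ a b → adj (there a) (there b))
  ... | e , p = e , adj (here refl) (there (here refl)) (All.lookup x∉ (here refl)) ∷ p

  -- Crossing an inner block

  Crossing : V → V → (V → Set) → Set
  Crossing c d M = ∃[ p ] ∃[ xs ] Path c p xs × p ~ d × Unique xs × (∀ {v} → v ∈ xs → v ≡ c ⊎ M v) × (∀ {v} → v ≡ c ⊎ M v → v ∈ xs)

  module Inner {c d M} (P : Piece (c ∷ d ∷ []) M) (c≢d : c ≢ d) (no-C : ∀ {v} → v ∈ C → ¬ M v)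
               (few : length (filter (Piece.M? P) D₀) ≤ 1) where

    open Piece P
    open PieceFacts P

    T₀ : List V
    T₀ = filter M? D₀

    comp₀ : Completes _~_ (c ∷ d ∷ []) M T₀
    comp₀ = Orig.restrict crit (here refl) cds₀

    ms : List V
    ms = filter M? (allFin n)

    ms⁺ : ∀ {v} → M v → v ∈ ms
    ms⁺ m = ∈-filter⁺ M? (∈-allFin _) m

    ms⁻ : ∀ {v} → v ∈ ms → M v
    ms⁻ v∈ = proj₂ (∈-filter⁻ M? {xs = allFin n} v∈)

    ms-unique : Unique ms
    ms-unique = Uniqueₚ.filter⁺ M? (Uniqueₚ.allFin⁺ n)

    M≢ : ∀ {b v} → b ∈ c ∷ d ∷ [] → M v → v ≢ b
    M≢ b∈ m refl = Bd∉M b∈ m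

    c∷ms : ∀ {xs} → Unique xs → (∀ {v} → v ∈ xs → M v) → Unique (c ∷ xs)
    c∷ms u sub = All.tabulate (λ v∈ c≡v → M≢ (here refl) (sub v∈) (≡-sym c≡v)) ∷ u

    -- An empty completion cannot be made smaller by any edge, so no edge is missing.
    clique-path : Completes _~_ (c ∷ d ∷ []) M [] → Crossing c d M
    clique-path comp = e , c ∷ ms , p , adj (MB-of (end∈ p)) (inj₂ (there (here refl))) (≢d (end∈ p)) , c∷ms ms-unique ms⁻ ,
        (λ { (here eq) → inj₁ eq ; (there v∈) → inj₂ (ms⁻ v∈) }) , λ { (inj₁ eq) → here eq ; (inj₂ m) → there (ms⁺ m) }
      where
      adj : ∀ {u v} → MB u → MB v → u ≢ v → u ~ v
      adj {u} {v} mu mv u≢v = decidable-stable (dec G u v) λ ¬e → case shrink crit (here refl) mu mv u≢v ¬e comp of λ where (_ , _ , ())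
      MB-of : ∀ {v} → v ∈ c ∷ ms → MB v
      MB-of (here eq) = inj₂ (here eq)
      MB-of (there v∈) = inj₁ (ms⁻ v∈)
      ≢d : ∀ {v} → v ∈ c ∷ ms → v ≢ d
      ≢d (here refl) = c≢d
      ≢d (there v∈) = M≢ (there (here refl)) (ms⁻ v∈)
      ch = chain c ms (c∷ms ms-unique ms⁻) (λ u∈ v∈ → adj (MB-of u∈) (MB-of v∈))
      e = proj₁ ch
      p = proj₂ ch

    shrink[] : ∀ {u v} → MB u → MB v → u ≢ v → ¬ u ~ v → Completes (addEdge _~_ u v) (c ∷ d ∷ []) M []
    shrink[] mu mv u≢v ¬e with shrink crit (here refl) mu mv u≢v ¬e comp₀
    ... | [] , comp , _ = comp
    ... | _ ∷ _ , _ , small = ⊥-elim (ℕₚ.<⇒≱ small (ℕₚ.≤-trans few (s≤s z≤n)))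

    -- {c , d} is then the only pair of non-adjacent vertices.
    nonadjacent-path : ¬ c ~ d → Crossing c d M
    nonadjacent-path c≁d = go ms refl
      where
      adj : ∀ {u v} → MB u → MB v → u ≢ v → ¬ (u ≡ c × v ≡ d) → ¬ (u ≡ d × v ≡ c) → u ~ v
      adj {u} {v} mu mv u≢v ≢cd ≢dc = decidable-stable (dec G u v) λ ¬e →
        case first-step crit (Completes.conn (shrink[] mu mv u≢v ¬e) c d (here refl) (there (here refl))) c≢d of λ where
          (_ , here refl , w≢c , _) → w≢c refl
          (_ , there (here refl) , _ , inj₁ e) → c≁d e
          (_ , there (here refl) , _ , inj₂ (inj₁ (p , q))) → ≢cd (≡-sym p , ≡-sym q)
          (_ , there (here refl) , _ , inj₂ (inj₂ (p , q))) → ≢dc (≡-sym q , ≡-sym p)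
      go : ∀ xs → xs ≡ ms → Crossing c d M
      go [] eq with first-step crit (Completes.conn comp₀ c d (here refl) (there (here refl))) c≢d
      ... | _ , here refl , w≢c , _ = ⊥-elim (w≢c refl)
      ... | _ , there (here refl) , _ , e = ⊥-elim (c≁d e)
      ... | w , there (there w∈) , _ , _ with subst (w ∈_) (≡-sym eq) (ms⁺ (Completes.within comp₀ w∈))
      ...   | ()
      go (m ∷ xs) eq with chain m xs (subst Unique (≡-sym eq) ms-unique) (λ u∈ v∈ u≢v → adj (inj₁ (m-of u∈)) (inj₁ (m-of v∈)) u≢v
                               (λ (p , _) → M≢ (here refl) (m-of u∈) p) (λ (_ , q) → M≢ (here refl) (m-of v∈) q))
        where
        m-of : ∀ {v} → v ∈ m ∷ xs → M v
        m-of v∈ = ms⁻ (subst (_ ∈_) eq v∈)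
      ... | e , p = e , c ∷ m ∷ xs , c~m ∷ p , e~d , c∷ms (subst Unique (≡-sym eq) ms-unique) m-of ,
            (λ { (here eq) → inj₁ eq ; (there v∈) → inj₂ (m-of v∈) }) , λ { (inj₁ eq) → here eq ; (inj₂ m) → there (subst (_ ∈_) (≡-sym eq) (ms⁺ m)) }
        where
        m-of : ∀ {v} → v ∈ m ∷ xs → M v
        m-of v∈ = ms⁻ (subst (_ ∈_) eq v∈)
        Mm = m-of (here refl)
        c~m : c ~ m
        c~m = adj (inj₂ (here refl)) (inj₁ Mm) (λ eq → M≢ (here refl) Mm (≡-sym eq)) (λ (_ , q) → M≢ (there (here refl)) Mm q) (λ (p , _) → c≢d p)
        Me = m-of (end∈ p)
        e~d : e ~ d
        e~d = adj (inj₁ Me) (inj₂ (there (here refl))) (M≢ (there (here refl)) Me) (λ (p , _) → M≢ (here refl) Me p) (λ (_ , q) → c≢d (≡-sym q))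

    -- {c , w} and {d , w} are then the only pairs of non-adjacent vertices.
    missing-path : c ~ d → ∀ {w} → M w → ¬ c ~ w → ¬ d ~ w → Crossing c d M
    missing-path c~d {w} Mw c≁w d≁w = hub
      where
      adj : ∀ {u v} → MB u → MB v → u ≢ v → ¬ (u ≡ w × v ∈ c ∷ d ∷ []) → ¬ (v ≡ w × u ∈ c ∷ d ∷ []) → u ~ v
      adj {u} {v} mu mv u≢v no-uw no-vw = decidable-stable (dec G u v) λ ¬e →
        case Completes.dom (shrink[] mu mv u≢v ¬e) Mw of λ where
          (inj₁ w∈) → Bd∉M w∈ Mw
          (inj₂ (_ , here refl , inj₁ e)) → c≁w e
          (inj₂ (_ , there (here refl) , inj₁ e)) → d≁w e
          (inj₂ (_ , b∈ , inj₂ (inj₁ (p , q)))) → no-vw (≡-sym q , subst (_∈ c ∷ d ∷ []) p b∈)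
          (inj₂ (_ , b∈ , inj₂ (inj₂ (p , q)))) → no-uw (≡-sym q , subst (_∈ c ∷ d ∷ []) p b∈)
      adjM : ∀ {u v} → M u → M v → u ≢ v → u ~ v
      adjM mu mv u≢v = adj (inj₁ mu) (inj₁ mv) u≢v (λ (_ , v∈) → Bd∉M v∈ mv) (λ (_ , u∈) → Bd∉M u∈ mu)
      adjB : ∀ {b v} → b ∈ c ∷ d ∷ [] → M v → v ≢ w → b ~ v
      adjB b∈ mv v≢w = adj (inj₂ b∈) (inj₁ mv) (λ eq → M≢ b∈ mv (≡-sym eq)) (λ (_ , v∈) → Bd∉M v∈ mv) (λ (eq , _) → v≢w eq)
      B≁w : ∀ {b} → b ∈ c ∷ d ∷ [] → ¬ b ~ w
      B≁w (here refl) = c≁w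
      B≁w (there (here refl)) = d≁w
      with-x : ∀ {x} → M x → x ≢ w → Crossing c d M
      with-x {x} Mx x≢w with Finₚ.any? (λ y → M? y ×-dec ¬? (y ≟ w) ×-dec ¬? (y ≟ x))
      -- Without a second vertex besides `w`, the vertex `x` would be the only neighbour of `w` and
      -- hence a cut vertex in M.
      ... | no ¬any = ⊥-elim (no-C (cut-C (w , c , x≢w ∘ ≡-sym , (λ eq → M≢ (here refl) Mx (≡-sym eq)) , no-walk)) Mx)
        where
        no-walk : ¬ WalkIn _~_ (_≢ x) w c
        no-walk wk with first-step crit wk (M≢ (here refl) Mw)
        ... | z , z≢x , z≢w , e with closed Mw e
        ...   | inj₁ Mz = ¬any (z , Mz , z≢w , z≢x)
        ...   | inj₂ z∈ = B≁w z∈ (~sym e)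
      ... | yes (y , My , y≢w , y≢x) = e , c ∷ x ∷ w ∷ y ∷ rest ,
            adjB (here refl) Mx x≢w ∷ adjM Mx Mw x≢w ∷ adjM Mw My (y≢w ∘ ≡-sym) ∷ p ,
            ~sym (adjB (there (here refl)) (in-M (end∈ p)) (≢w (end∈ p))) ,
            c∷ms unq (λ { (here refl) → Mx ; (there (here refl)) → Mw ; (there (there v∈)) → in-M v∈ }) ,
            (λ { (here eq) → inj₁ eq ; (there (here refl)) → inj₂ Mx ; (there (there (here refl))) → inj₂ Mw ; (there (there (there v∈))) → inj₂ (in-M v∈) }) ,
            (λ { (inj₁ eq) → here eq ; (inj₂ m) → there (place m) })
        where
        Other : V → Set
        Other v = v ≢ x × v ≢ w × v ≢ y
        Other? : Decidable Other
        Other? v = ¬? (v ≟ x) ×-dec ¬? (v ≟ w) ×-dec ¬? (v ≟ y)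
        rest : List V
        rest = filter Other? ms
        rest⁻ : ∀ {v} → v ∈ rest → M v × Other v
        rest⁻ v∈ with ∈-filter⁻ Other? {xs = ms} v∈
        ... | v∈ms , o = ms⁻ v∈ms , o
        in-M : ∀ {v} → v ∈ y ∷ rest → M v
        in-M (here refl) = My
        in-M (there v∈) = proj₁ (rest⁻ v∈)
        ≢w : ∀ {v} → v ∈ y ∷ rest → v ≢ w
        ≢w (here refl) = y≢w
        ≢w (there v∈) = proj₁ (proj₂ (proj₂ (rest⁻ v∈)))
        y∷rest : Unique (y ∷ rest)
        y∷rest = All.tabulate (λ v∈ y≡v → proj₂ (proj₂ (proj₂ (rest⁻ v∈))) (≡-sym y≡v)) ∷ Uniqueₚ.filter⁺ Other? ms-unique
        unq : Unique (x ∷ w ∷ y ∷ rest)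
        unq = All.tabulate (λ { (here refl) eq → x≢w eq ; (there (here refl)) eq → y≢x (≡-sym eq) ; (there (there v∈)) eq → proj₁ (proj₂ (rest⁻ v∈)) (≡-sym eq) })
              ∷ All.tabulate (λ v∈ w≡v → ≢w v∈ (≡-sym w≡v)) ∷ y∷rest
        place : ∀ {v} → M v → v ∈ x ∷ w ∷ y ∷ rest
        place {v} m with v ≟ x | v ≟ w | v ≟ y
        ... | yes eq | _ | _ = here eq
        ... | no _ | yes eq | _ = there (here eq)
        ... | no _ | no _ | yes eq = there (there (here eq))
        ... | no a | no b | no c = there (there (there (∈-filter⁺ Other? (ms⁺ m) (a , b , c))))
        ch = chain y rest y∷rest (λ u∈ v∈ → adjM (in-M u∈) (in-M v∈))
        e = proj₁ ch
        p = proj₂ ch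
      hub : Crossing c d M
      hub with Completes.dom comp₀ Mw
      ... | inj₂ (_ , here refl , e) = ⊥-elim (c≁w e)
      ... | inj₂ (_ , there (here refl) , e) = ⊥-elim (d≁w e)
      ... | inj₂ (x , there (there x∈) , e) = with-x (Completes.within comp₀ x∈) λ { refl → irrefl G e }
      ... | inj₁ (here refl) = ⊥-elim (Bd∉M (here refl) Mw)
      ... | inj₁ (there (here refl)) = ⊥-elim (Bd∉M (there (here refl)) Mw)
      ... | inj₁ (there (there w∈)) with first-step crit (Completes.conn comp₀ w c (there (there w∈)) (here refl)) (M≢ (here refl) Mw)
      ...   | _ , here refl , _ , e = ⊥-elim (c≁w (~sym e))
      ...   | _ , there (here refl) , _ , e = ⊥-elim (d≁w (~sym e))
      ...   | x , there (there x∈) , x≢w , e = with-x (Completes.within comp₀ x∈) x≢w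

    inner-path : Crossing c d M
    inner-path with dec G c d | Finₚ.any? (λ w → M? w ×-dec ¬? (dec G c w) ×-dec ¬? (dec G d w))
    ... | no c≁d | _ = nonadjacent-path c≁d
    ... | yes c~d | yes (w , Mw , c≁w , d≁w) = missing-path c~d Mw c≁w d≁w
    ... | yes c~d | no ¬any = clique-path record
          { within = λ ()
          ; conn = λ where
              _ _ (here refl) (here refl) → [ here refl ]
              _ _ (here refl) (there (here refl)) → step (here refl) c~d [ there (here refl) ]
              _ _ (there (here refl)) (here refl) → step (there (here refl)) (~sym c~d) [ here refl ]
              _ _ (there (here refl)) (there (here refl)) → [ there (here refl) ]
          ; dom = dom }
      where
      dom : ∀ {v} → M v → Dom _~_ (c ∷ d ∷ []) v
      dom {v} m with dec G c v | dec G d v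
      ... | yes e | _ = inj₂ (c , here refl , e)
      ... | no _ | yes e = inj₂ (d , there (here refl) , e)
      ... | no ¬e | no ¬f = ⊥-elim (¬any (v , m , ¬e , ¬f))

  -- The block between a cut vertex and the next one

  module Between {c R} (reg : Region c R) (c∈ : c ∈ C) {d} (d∈ : d ∈ C) (Rd : R d) where

    open Region reg

    c≢d : c ≢ d
    c≢d refl = c∉R Rd

    far : Region d (Far c d)
    far = far-region d∈ c≢d

    far⇒R : ∀ {u} → Far c d u → R u
    far⇒R = far⊆ reg Rd

    M : V → Set
    M u = R u × u ≢ d × ¬ Far c d u

    M? : Decidable M
    M? u = R? u ×-dec ¬? (u ≟ d) ×-dec ¬? (Far? c d u)

    data Zone (v : V) : Set where
      mid : M v → Zone v
      at-d : v ≡ d ⊎ Far c d v → Zone v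
      at-c : v ≡ c ⊎ ¬ R v → Zone v

    zone : ∀ v → Zone v
    zone v with R? v | v ≟ d | Far? c d v
    ... | no ¬r | _ | _ = at-c (inj₂ ¬r)
    ... | yes r | yes eq | _ = at-d (inj₁ eq)
    ... | yes r | no _ | yes f = at-d (inj₂ f)
    ... | yes r | no v≢d | no ¬f = mid (r , v≢d , ¬f)

    π′ : ∀ {v} → Zone v → V
    π′ {v} (mid _) = v
    π′ (at-d _) = d
    π′ (at-c _) = c

    c∉far : ¬ Far c d c
    c∉far (_ , ¬w) = ¬w [ c≢d ]

    mid-d : ∀ {u w} → M u → u ~ w → w ≡ d ⊎ Far c d w → w ≡ d
    mid-d _ _ (inj₁ eq) = eq
    mid-d (_ , u≢d , ¬f) e (inj₂ fw) = ⊥-elim (¬f (Region.closed far fw (~sym e) u≢d))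

    mid-c : ∀ {u w} → M u → u ~ w → w ≡ c ⊎ ¬ R w → w ≡ c
    mid-c _ _ (inj₁ eq) = eq
    mid-c {w = w} (Ru , _) e (inj₂ ¬rw) = decidable-stable (w ≟ c) λ w≢c → ¬rw (closed Ru e w≢c)

    d-c : ∀ {u w} → u ≡ d ⊎ Far c d u → u ~ w → w ≡ c ⊎ ¬ R w → u ≡ d × w ≡ c
    d-c {w = w} (inj₁ refl) e wc = refl , [ id , (λ ¬rw → decidable-stable (w ≟ c) λ w≢c → ¬rw (closed Rd e w≢c)) ]′ wc
    d-c {w = w} (inj₂ fu) e wc = ⊥-elim ([ (λ { refl → c∉far fw }) , (λ ¬rw → ¬rw (far⇒R fw)) ]′ wc)
      where
      w≢d : w ≢ d
      w≢d refl = [ (λ eq → c≢d (≡-sym eq)) , (λ ¬r → ¬r Rd) ]′ wc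
      fw = Region.closed far fu e w≢d

    π-adj′ : ∀ {u w} (zu : Zone u) (zw : Zone w) → u ~ w → π′ zu ≡ π′ zw ⊎ π′ zu ~ π′ zw
    π-adj′ (mid _) (mid _) e = inj₂ e
    π-adj′ (at-d _) (at-d _) e = inj₁ refl
    π-adj′ (at-c _) (at-c _) e = inj₁ refl
    π-adj′ (mid m) (at-d a) e with mid-d m e a
    ... | refl = inj₂ e
    π-adj′ (at-d a) (mid m) e with mid-d m (~sym e) a
    ... | refl = inj₂ e
    π-adj′ (mid m) (at-c a) e with mid-c m e a
    ... | refl = inj₂ e
    π-adj′ (at-c a) (mid m) e with mid-c m (~sym e) a
    ... | refl = inj₂ e
    π-adj′ (at-d a) (at-c b) e with d-c a e b
    ... | refl , refl = inj₂ e
    π-adj′ (at-c b) (at-d a) e with d-c a (~sym e) b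
    ... | refl , refl = inj₂ e

    c∉M : ¬ M c
    c∉M (r , _) = c∉R r

    d∉M : ¬ M d
    d∉M (_ , d≢d , _) = d≢d refl

    π-fix′ : ∀ {v} (z : Zone v) → M v ⊎ v ∈ c ∷ d ∷ [] → π′ z ≡ v
    π-fix′ (mid _) _ = refl
    π-fix′ (at-d (inj₁ eq)) _ = ≡-sym eq
    π-fix′ (at-d (inj₂ f)) (inj₁ (_ , _ , ¬f)) = ⊥-elim (¬f f)
    π-fix′ (at-d (inj₂ f)) (inj₂ (here refl)) = ⊥-elim (c∉far f)
    π-fix′ (at-d (inj₂ f)) (inj₂ (there (here refl))) = refl
    π-fix′ (at-c (inj₁ eq)) _ = ≡-sym eq
    π-fix′ (at-c (inj₂ ¬r)) (inj₁ (r , _)) = ⊥-elim (¬r r)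
    π-fix′ (at-c (inj₂ ¬r)) (inj₂ (here refl)) = refl
    π-fix′ (at-c (inj₂ ¬r)) (inj₂ (there (here refl))) = ⊥-elim (¬r Rd)

    π-out′ : ∀ {v} (z : Zone v) → ¬ M v → π′ z ∈ c ∷ d ∷ []
    π-out′ (mid m) ¬m = ⊥-elim (¬m m)
    π-out′ (at-d _) _ = there (here refl)
    π-out′ (at-c _) _ = here refl

    piece : Piece (c ∷ d ∷ []) M
    piece = record
      { M? = M?
      ; Bd∉M = λ { (here refl) → c∉M ; (there (here refl)) → d∉M }
      ; closed = closed′
      ; π = λ v → π′ (zone v)
      ; π-fix = λ {v} → π-fix′ (zone v)
      ; π-out = λ {v} → π-out′ (zone v)
      ; π-adj = λ {u} {w} → π-adj′ (zone u) (zone w)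
      ; separates = λ where
          (here refl) → (λ v → v ≢ c × ¬ R v) , Region.R? co ,
            (λ { (v≢c , ¬r) → (λ { (r , _) → ¬r r }) , λ { (here eq) → v≢c eq ; (there (here refl)) → ¬r Rd } }) ,
            Region.closed co , Region.nonempty co , (d , inj₂ (there (here refl)) , c≢d ∘ ≡-sym)
          (there (here refl)) → Far c d , Far? c d ,
            (λ f → (λ { (_ , _ , ¬f) → ¬f f }) , λ { (here refl) → c∉far f ; (there (here refl)) → Region.c∉R far f }) ,
            Region.closed far , Region.nonempty far , (c , inj₂ (here refl) , c≢d)
      }
      where
      co = co-region reg
      closed′ : ∀ {u w} → M u → u ~ w → M w ⊎ w ∈ c ∷ d ∷ []
      closed′ {u} {w} m e with zone w
      ... | mid mw = inj₁ mw
      ... | at-d a = inj₂ (there (here (mid-d m e a)))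
      ... | at-c a = inj₂ (here (mid-c m e a))

    -- With d chosen to cut off as much as possible, a cut vertex in M would give three disjoint ends.
    no-C : (∀ {d′} → d′ ∈ C → R d′ → size (Far? c d′) ≤ size (Far? c d)) → ∀ {v} → v ∈ C → ¬ M v
    no-C maximal {d′} d′∈ (Rd′ , d′≢d , d′∉far) = three-ends
        (λ f f′ → disjoint f f′) (λ f (_ , ¬r) → ¬r (far⇒R f)) (λ f (_ , ¬r) → ¬r (far⊆ reg Rd′ f))
        (sub-end′ far d∈) (sub-end′ (far-region d′∈ c≢d′) d′∈) (sub-end′ (co-region reg) c∈)
      where
      c≢d′ : c ≢ d′
      c≢d′ refl = c∉R Rd′
      avoid-or-hit : ∀ {a u} → WalkIn _~_ (_≢ d′) a u → WalkIn _~_ (_≢ d) a u ⊎ WalkIn _~_ (_≢ d′) a d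
      avoid-or-hit {a} w with a ≟ d
      avoid-or-hit [ p ] | yes refl = inj₂ [ p ]
      avoid-or-hit [ p ] | no a≢d = inj₁ [ a≢d ]
      avoid-or-hit (step p e w) | yes refl = inj₂ [ p ]
      avoid-or-hit (step p e w) | no a≢d with avoid-or-hit w
      ... | inj₁ q = inj₁ (step a≢d e q)
      ... | inj₂ q = inj₂ (step p e q)
      -- Otherwise d′ would cut off `d` and all that `d` cuts off, more than the maximal choice
      -- permits.
      d∉far′ : ¬ Far c d′ d
      d∉far′ (d≢d′ , ¬w) = ℕₚ.<⇒≱ (size-strict (Far? c d) (Far? c d′) {d} nested (d≢d′ , ¬w) (λ { (d≢d , _) → d≢d refl })) (maximal d′∈ Rd′)
        where
        nested : ∀ {u} → Far c d u → Far c d′ u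
        nested {u} (u≢d , ¬wu) = (λ { refl → d′∉far (u≢d , ¬wu) }) , λ w → [ ¬wu , ¬w ]′ (avoid-or-hit w)
      c-d : WalkIn _~_ (_≢ d′) c d
      c-d = ¬Far⇒walk (d′≢d ∘ ≡-sym) d∉far′
      c-d′ : WalkIn _~_ (_≢ d) c d′
      c-d′ = ¬Far⇒walk d′≢d d′∉far
      -- Follow any walk from `c`. Whenever it runs into the vertex to be avoided, exchange what
      -- came before for a walk from `c` that avoids the other one.
      reach : ∀ {a u} → WalkIn _~_ (λ _ → ⊤) a u → WalkIn _~_ (_≢ d) c a ⊎ WalkIn _~_ (_≢ d′) c a → WalkIn _~_ (_≢ d) c u ⊎ WalkIn _~_ (_≢ d′) c u
      reach [ _ ] r = r
      reach (step {w = w} _ e wk) (inj₁ q) with w ≟ d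
      ... | yes refl = reach wk (inj₂ c-d)
      ... | no w≢d = reach wk (inj₁ (walk-snoc q e w≢d))
      reach (step {w = w} _ e wk) (inj₂ q) with w ≟ d′
      ... | yes refl = reach wk (inj₁ c-d′)
      ... | no w≢d′ = reach wk (inj₂ (walk-snoc q e w≢d′))
      disjoint : ∀ {u} → Far c d u → ¬ Far c d′ u
      disjoint {u} (_ , ¬w) (_ , ¬w′) = [ ¬w , ¬w′ ]′ (reach (connected c u) (inj₁ [ c≢d ]))

    -- The end beyond `d` and the end on the other side of `c` already use two of the three further
    -- vertices.
    few : (∀ {v} → v ∈ C → ¬ M v) → length (filter M? D₀) ≤ 1
    few no-C = arith _ _ _ total (two-ends (λ f (_ , ¬r) → ¬r (far⇒R f)) E₁ E₂)
      where
      open SubEnd hiding (no-C)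
      E₁ = sub-end′ far d∈
      E₂ = sub-end′ (co-region reg) c∈
      total : length (filter M? D₀) + (length (extra E₁) + length (extra E₂)) ≤ 3
      total = budget M? (R′? E₁) (R′? E₂) no-C (SubEnd.no-C E₁) (SubEnd.no-C E₂)
        (λ { (_ , _ , ¬f) r → ¬f (sub E₁ r) }) (λ { (Rv , _) r → proj₂ (sub E₂ r) Rv }) (λ r r′ → proj₂ (sub E₂ r′) (far⇒R (sub E₁ r)))
      arith : ∀ m a b → m + (a + b) ≤ 3 → (a ≤ 1 → b ≤ 1 → ⊥) → m ≤ 1
      arith m a b total ab = ℕₚ.+-cancelʳ-≤ 2 m 1 (ℕₚ.≤-trans (ℕₚ.+-monoʳ-≤ m 2≤) total)
        where
        2≤ : 2 ≤ a + b
        2≤ with a ℕₚ.≤? 1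
        ... | no a≰1 = ℕₚ.≤-trans (ℕₚ.≰⇒> a≰1) (ℕₚ.m≤m+n a b)
        ... | yes a≤1 = ℕₚ.≤-trans (ℕₚ.≰⇒> (ab a≤1)) (ℕₚ.m≤n+m b a)

    append : Crossing c d M → HamFrom d (Far c d) → HamFrom c R
    append (q , xs , path , q~d , uxs , subxs , supxs) (e , ps , p , u , sub , sup) =
      e , xs ++ ps , (path ⟨ q~d ⟩ p) ,
      Uniqueₚ.++⁺ uxs u (λ (v∈xs , v∈ps) → disj (subxs v∈xs) (sub v∈ps)) ,
      (λ v∈ → [ to-R ∘ subxs , (λ v∈ps → inj₂ ([ (λ { refl → Rd }) , far⇒R ]′ (sub v∈ps))) ]′ (∈-++⁻ xs v∈)) ,
      place
      where
      disj : ∀ {v} → v ≡ c ⊎ M v → ¬ (v ≡ d ⊎ Far c d v)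
      disj (inj₁ refl) (inj₁ eq) = c≢d eq
      disj (inj₁ refl) (inj₂ f) = c∉far f
      disj (inj₂ m) (inj₁ refl) = d∉M m
      disj (inj₂ (_ , _ , ¬f)) (inj₂ f) = ¬f f
      to-R : ∀ {v} → v ≡ c ⊎ M v → v ≡ c ⊎ R v
      to-R (inj₁ eq) = inj₁ eq
      to-R (inj₂ (r , _)) = inj₂ r
      place : ∀ {v} → v ≡ c ⊎ R v → v ∈ xs ++ ps
      place (inj₁ eq) = ∈-++⁺ˡ (supxs (inj₁ eq))
      place {v} (inj₂ r) with v ≟ d | Far? c d v
      ... | yes eq | _ = ∈-++⁺ʳ xs (sup (inj₁ eq))
      ... | no _ | yes f = ∈-++⁺ʳ xs (sup (inj₂ f))
      ... | no v≢d | no ¬f = ∈-++⁺ˡ (supxs (inj₂ (r , v≢d , ¬f)))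

    extend : (∀ {v} → v ∈ C → ¬ M v) → HamFrom d (Far c d) → HamFrom c R
    extend no-C = append (Inner.inner-path piece c≢d no-C (few no-C))

  argmax : ∀ {P : V → Set} (P? : Decidable P) (f : V → ℕ) xs → Any.Any P xs → ∃[ d ] d ∈ xs × P d × (∀ {d′} → d′ ∈ xs → P d′ → f d′ ≤ f d)
  argmax {P} P? f (x ∷ xs) any with Any.any? P? xs
  ... | no ¬any with any
  ...   | here Px = x , here refl , Px , λ { (here refl) _ → ℕₚ.≤-refl ; (there d′∈) Pd′ → ⊥-elim (¬any (lose d′∈ Pd′)) }
  ...   | there any′ = ⊥-elim (¬any any′)
  argmax P? f (x ∷ xs) any | yes any′ with argmax P? f xs any′ | P? x
  ... | d , d∈ , Pd , max | no ¬Px = d , there d∈ , Pd , λ { (here refl) Px → ⊥-elim (¬Px Px) ; (there d′∈) → max d′∈ }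
  ... | d , d∈ , Pd , max | yes Px with ℕₚ.≤-total (f x) (f d)
  ...   | inj₁ x≤d = d , there d∈ , Pd , λ { (here refl) _ → x≤d ; (there d′∈) → max d′∈ }
  ...   | inj₂ d≤x = x , here refl , Px , λ { (here refl) _ → ℕₚ.≤-refl ; (there d′∈) Pd′ → ℕₚ.≤-trans (max d′∈ Pd′) d≤x }

  -- The cut vertex `d` that cuts off most is the next one of the chain: no cut vertex is left
  -- between it and `c`, and what lies beyond it is smaller.
  region-path : ∀ m {c R} (reg : Region c R) → c ∈ C → size (Region.R? reg) < m → ¬ ¬ HamFrom c R
  region-path (suc m) {c} {R} reg c∈ lt ¬ham with has-cut (Region.R? reg)
  -- The budget is spent on this one end, the other two parts being empty.
  ... | no ¬any = end-path crit E (suc (length T)) comp ℕₚ.≤-refl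
        (ℕₚ.≤-trans (ℕₚ.m≤m+n (length T) _) (budget R? none? none? (λ v∈ r → ¬any (lose v∈ r)) (λ _ ()) (λ _ ()) (λ _ ()) (λ _ ()) (λ ()))) ¬ham
    where
    open Region reg
    E = to-end reg ¬any
    T = filter R? D₀
    comp : Comp crit c R T
    comp = PieceFacts.Orig.restrict (region-piece reg) crit (here refl) cds₀
    none? : Decidable {A = V} (λ _ → ⊥)
    none? _ = no λ ()
  ... | yes any with argmax (Region.R? reg) (λ d → size (Far? c d)) C any
  ...   | d , d∈ , Rd , maximal = region-path m far d∈ (ℕₚ.≤-trans smaller (s≤s⁻¹ lt)) (¬ham ∘ extend (no-C maximal))
    where
    open Between reg c∈ d∈ Rd
    smaller : size (Far? c d) < size (Region.R? reg)
    smaller = size-strict (Far? c d) (Region.R? reg) far⇒R Rd (λ { (d≢d , _) → d≢d refl })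

  inhabited : ∀ (xs : List V) → k ≤ length xs + 3 → ∃[ c ] c ∈ xs
  inhabited [] k≤3 = ⊥-elim (ℕₚ.<⇒≱ 4≤k k≤3)
  inhabited (c ∷ _) _ = c , here refl

  -- A cut vertex splits the graph into two regions. Their hamiltonian paths from it are glued
  -- there, the first one reversed.
  traceable : ¬ ¬ Traceable G
  traceable ¬tr with inhabited C k≤
  ... | c , c∈ with C-cut c∈
  ...   | a , b , a≢c , b≢c , ¬w = region-path _ reg c∈ ℕₚ.≤-refl λ h₁ → region-path _ (co-region reg) c∈ ℕₚ.≤-refl λ h₂ → ¬tr (join h₁ h₂)
    where
    R = Far a c
    reg : Region c R
    reg = far-region c∈ a≢c
    join : HamFrom c R → HamFrom c (λ u → u ≢ c × ¬ R u) → Traceable G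
    join (e₁ , ps , p , u₁ , sub₁ , sup₁) (e₂ , qs , q , u₂ , sub₂ , sup₂) = go q u₂ sub₂ sup₂
      where
      go : ∀ {qs} → Path c e₂ qs → Unique qs → (∀ {v} → v ∈ qs → v ≡ c ⊎ (v ≢ c × ¬ R v)) →
           (∀ {v} → v ≡ c ⊎ (v ≢ c × ¬ R v) → v ∈ qs) → Traceable G
      go [-] u sub sup = ps , u₁ , all , linked p
        where
        all : ∀ v → v ∈ ps
        all v with Far? a c v | v ≟ c
        ... | yes r | _ = sup₁ (inj₂ r)
        ... | no _ | yes eq = sup₁ (inj₁ eq)
        ... | no ¬r | no v≢c with sup (inj₂ (v≢c , ¬r))
        ...   | here eq = sup₁ (inj₁ eq)
      go (_∷_ {xs = rs} f q) u sub sup = reverse ps ++ rs , unq , all , linked (reverseᵖ p ⟨ f ⟩ q)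
        where
        unq : Unique (reverse ps ++ rs)
        unq = Uniqueₚ.++⁺ (unique-↭ (↭-sym (Permₚ.↭-reverse ps)) u₁) (proj₁ (proj₂ (unique-++⁻ (c ∷ []) u)))
          λ (v∈ps , v∈rs) → disj (sub₁ (Permₚ.∈-resp-↭ (Permₚ.↭-reverse ps) v∈ps)) v∈rs
          where
          disj : ∀ {v} → v ≡ c ⊎ R v → ¬ v ∈ rs
          disj (inj₁ refl) v∈ = Uniqueₚ.Unique[x∷xs]⇒x∉xs u v∈
          disj (inj₂ r) v∈ = [ (λ { refl → Region.c∉R reg r }) , (λ (_ , ¬r) → ¬r r) ]′ (sub (there v∈))
        in-ps : ∀ {v} → v ∈ ps → v ∈ reverse ps ++ rs
        in-ps v∈ = ∈-++⁺ˡ (Permₚ.∈-resp-↭ (↭-sym (Permₚ.↭-reverse ps)) v∈)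
        all : ∀ v → v ∈ reverse ps ++ rs
        all v with Far? a c v | v ≟ c
        ... | yes r | _ = in-ps (sup₁ (inj₂ r))
        ... | no _ | yes eq = in-ps (sup₁ (inj₁ eq))
        ... | no ¬r | no v≢c with sup (inj₂ (v≢c , ¬r))
        ...   | here eq = in-ps (sup₁ (inj₁ eq))
        ...   | there v∈ = ∈-++⁺ʳ (reverse ps) v∈

-- Deciding traceability

exists-list? : ∀ {n} m {P : List (Fin n) → Set} → (∀ xs → Dec (P xs)) → Dec (∃[ xs ] length xs ≡ m × P xs)
exists-list? zero P? with P? []
... | yes p = yes ([] , refl , p)
... | no ¬p = no λ { ([] , _ , p) → ¬p p }
exists-list? (suc m) P? with Finₚ.any? (λ x → exists-list? m (λ xs → P? (x ∷ xs)))
... | yes (x , xs , len , p) = yes (x ∷ xs , cong suc len , p)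
... | no ¬any = no λ { (x ∷ xs , len , p) → ¬any (x , xs , ℕₚ.suc-injective len , p) }

-- A hamiltonian path lists exactly n vertices, so the search over lists of length n is complete.
traceable? : ∀ {n} (G : Graph n) → Dec (Traceable G)
traceable? {n} G with exists-list? n (λ xs → unique? xs ×-dec Finₚ.all? (_∈? xs) ×-dec linked? (dec G) xs)
  where
  open import Data.List.Relation.Unary.Unique.DecPropositional (Finₚ._≟_ {n}) using (unique?)
  open import Data.List.Membership.DecPropositional (Finₚ._≟_ {n}) using (_∈?_)
  open import Data.List.Relation.Unary.Linked using (linked?)
... | yes (xs , _ , t) = yes (xs , t)
... | no ¬ex = no λ (xs , u , all , l) → ¬ex (xs ,
      ℕₚ.≤-antisym (ℕₚ.≤-trans (unique-⊆⇒length≤ u (λ {v} _ → ∈-allFin v)) (ℕₚ.≤-reflexive (Listₚ.length-tabulate {n = n} id)))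
        (ℕₚ.≤-trans (ℕₚ.≤-reflexive (≡-sym (Listₚ.length-tabulate {n = n} id))) (unique-⊆⇒length≤ (Uniqueₚ.allFin⁺ n) (λ {v} _ → all v))) ,
      u , all , l)

theorem4p4 : (k ζ n : ℕ) → 4 ≤ k → (ζ ≡ k ∸ 3 ⊎ ζ ≡ k ∸ 2) →
    (G : Graph n) → IsCritical k G → NumCutVertices G ζ → Traceable G
theorem4p4 k ζ n 4≤k ζ-eq G crit (C , cuts , size) = decidable-stable (traceable? G)
  (Peel.traceable G (critical crit) 4≤k (elems C) (elems-unique C) (λ v∈ → proj₁ (cuts _) (∈-elems⁻ v∈)) (λ cut → ∈-elems⁺ (proj₂ (cuts _) cut))
    (subst (λ l → k ≤ l + 3) (≡-sym (trans (length-elems C) size)) (k≤ ζ-eq)))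
  where
  k≤ : ζ ≡ k ∸ 3 ⊎ ζ ≡ k ∸ 2 → k ≤ ζ + 3
  k≤ (inj₁ refl) = ℕₚ.≤-trans (ℕₚ.m≤n+m∸n k 3) (ℕₚ.≤-reflexive (ℕₚ.+-comm 3 (k ∸ 3)))
  k≤ (inj₂ refl) = ℕₚ.≤-trans (ℕₚ.m≤n+m∸n k 2) (ℕₚ.≤-trans (ℕₚ.≤-reflexive (ℕₚ.+-comm 2 (k ∸ 2))) (ℕₚ.+-monoʳ-≤ (k ∸ 2) (s≤s (s≤s z≤n))))
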